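{- There exist an absolute constant $C>0$ and a function $\varepsilon:\mathbb N\to[0,1]$ with $\varepsilon(r)\to0$ as $r\to\infty$ such that the following holds. Let $\mathcal H$ be an $r$-bounded $\kappa$-spread multi-hypergraph on a finite vertex set $X=V(\mathcal H)$. Let $k\ge r$ be an integer and let the elements of $X$ be colored independently and uniformly at random with colors from $[k]=\{1,\dots,k\}$. If $p\in[0,1]$ satisfies \[ p\ge \frac{C\log r}{\kappa}, \] then with probability at least $1-\varepsilon(r)$, $X_p$ contains a rainbow edge of $\mathcal H$.
   Context: A (multi-)hypergraph on a finite set $X$ is a non-empty finite collection of subsets of $X$ (edges), with repetitions allowed; $|\mathcal H|$ counts edges with multiplicity. $\mathcal H$ is $r$-bounded if every edge has size at most $r$. $\mathcal H$ is $\kappa$-spread ($\kappa>0$) if for every $S\subseteq X$ the number of edges of $\mathcal H$ (with multiplicity) containing $S$ is at most $\kappa^{ -|S|}|\mathcal H|$. $X_p$ denotes the random subset of $X$ containing each $x\in X$ independently with probability $p$, chosen independently of the coloring. An edge is rainbow if its vertices have pairwise distinct colors; $X_p$ contains an edge $e$ if $e\subseteq X_p$. -}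

module Defs where

open import Data.Fin.Base using (Fin)
import Data.Fin.Properties as Fin
open import Data.Fin.Subset using (Subset; Side; inside; outside; _∈_; _⊆_; ∣_∣)
open import Data.Fin.Subset.Properties using (_∈?_; _⊆?_)
open import Data.Integer.Base as ℤ using (+_; -[1+_])
import Data.Integer.Properties as ℤ
open import Data.List.Base using (List; []; _∷_; map; filter; foldr; length; allFin; cartesianProductWith)
open import Data.List.NonEmpty.Base using (List⁺; toList)
open import Data.List.Relation.Unary.All using (All)
open import Data.List.Relation.Unary.Any using (Any; any?)
open import Data.Nat.Base as ℕ using (ℕ; zero; suc)
import Data.Nat.Properties as ℕ
open import Data.Product.Base using (∃-syntax; _×_; _,_; proj₁; proj₂)
open import Data.Rational.Base as ℚ using (ℚ; mkℚ; 0ℚ; 1ℚ; *<*)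
import Data.Rational.Properties as ℚ
open import Data.Rational.Unnormalised.Base as ℚᵘ using (mkℚᵘ)
import Data.Rational.Unnormalised.Properties as ℚᵘ
open import Data.Rational.Solver using (module +-*-Solver)
open import Data.Sum.Base using (inj₁; inj₂)
open import Data.Vec.Base using (Vec; []; _∷_; lookup)
open import Function.Base using (_∘_)
open import Relation.Binary.PropositionalEquality
open import Relation.Nullary using (yes; no; contradiction; ¬?; _→-dec_; _×-dec_)
open import Relation.Unary using (Decidable)

private
  open +-*-Solver

  rescale : ∀ (K : ℚ) → 0ℚ ℚ.< K → ∀ δ → 0ℚ ℚ.< δ → ∃[ δ′ ] (0ℚ ℚ.< δ′ × K ℚ.* δ′ ≡ δ)
  rescale K 0<K δ 0<δ = K⁻¹ ℚ.* δ , 0<δ′ , eq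
    where
    instance
      posK = ℚ.positive 0<K
      nzK = ℚ.pos⇒nonZero K
    K⁻¹ = ℚ.1/ K
    instance
      posK⁻¹ = ℚ.1/pos⇒pos K
    0<δ′ : 0ℚ ℚ.< K⁻¹ ℚ.* δ
    0<δ′ = subst (ℚ._< K⁻¹ ℚ.* δ) (ℚ.*-zeroʳ K⁻¹) (ℚ.*-monoʳ-<-pos K⁻¹ 0<δ)
    eq : K ℚ.* (K⁻¹ ℚ.* δ) ≡ δ
    eq = trans (sym (ℚ.*-assoc K K⁻¹ δ)) (trans (cong (ℚ._* δ) (ℚ.*-inverseʳ K)) (ℚ.*-identityˡ δ))

  triangle : ∀ a b c → a ≡ b ℚ.+ c → ℚ.∣ a ∣ ℚ.≤ ℚ.∣ b ∣ ℚ.+ ℚ.∣ c ∣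
  triangle a b c refl = ℚ.∣p+q∣≤∣p∣+∣q∣ b c

  *-mono-≤-nonNeg : ∀ {a b c d} → 0ℚ ℚ.≤ c → 0ℚ ℚ.≤ b → a ℚ.≤ b → c ℚ.≤ d → a ℚ.* c ℚ.≤ b ℚ.* d
  *-mono-≤-nonNeg {a} {b} {c} {d} 0≤c 0≤b a≤b c≤d = ℚ.≤-trans
    (ℚ.*-monoʳ-≤-nonNeg c {{ℚ.nonNegative 0≤c}} a≤b)
    (ℚ.*-monoˡ-≤-nonNeg b {{ℚ.nonNegative 0≤b}} c≤d)

  0≤* : ∀ {a b} → 0ℚ ℚ.≤ a → 0ℚ ℚ.≤ b → 0ℚ ℚ.≤ a ℚ.* b
  0≤* {a} {b} 0≤a 0≤b = subst (ℚ._≤ a ℚ.* b) (ℚ.*-zeroʳ a) (ℚ.*-monoˡ-≤-nonNeg a {{ℚ.nonNegative 0≤a}} 0≤b)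

  ≤-+ʳ : ∀ {a b} → 0ℚ ℚ.≤ b → a ℚ.≤ a ℚ.+ b
  ≤-+ʳ {a} {b} 0≤b = subst (ℚ._≤ a ℚ.+ b) (ℚ.+-identityʳ a) (ℚ.+-monoʳ-≤ a 0≤b)

  ∣-∣-swap : ∀ a b → ℚ.∣ a ℚ.- b ∣ ≡ ℚ.∣ b ℚ.- a ∣
  ∣-∣-swap a b = trans (sym (ℚ.∣-p∣≡∣p∣ (a ℚ.- b)))
    (cong ℚ.∣_∣ (solve 2 (λ x y → :- (x :- y) := y :- x) refl a b))

  0<1 : 0ℚ ℚ.< 1ℚ
  0<1 = ℚ.positive⁻¹ 1ℚ

-- Real numbers as Cauchy sequences of rationals.  All operations act
-- termwise; the relations are invariant under equality of limits.

IsCauchy : (ℕ → ℚ) → Set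
IsCauchy x = ∀ δ → 0ℚ ℚ.< δ →
  ∃[ N ] (∀ m n → N ℕ.≤ m → N ℕ.≤ n → ℚ.∣ x m ℚ.- x n ∣ ℚ.< δ)

record ℝ : Set where
  constructor mkℝ
  field
    seq      : ℕ → ℚ
    isCauchy : IsCauchy seq

open ℝ public

infix 4 _≤ℝ_ _<ℝ_

_≤ℝ_ : ℝ → ℝ → Set
x ≤ℝ y = ∀ δ → 0ℚ ℚ.< δ → ∃[ N ] (∀ n → N ℕ.≤ n → seq x n ℚ.≤ seq y n ℚ.+ δ)

_<ℝ_ : ℝ → ℝ → Set
x <ℝ y = ∃[ δ ] (0ℚ ℚ.< δ × ∃[ N ] (∀ n → N ℕ.≤ n → seq x n ℚ.+ δ ℚ.≤ seq y n))

private
  cauchy-scaled : ∀ x K → 0ℚ ℚ.< K →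
    (∀ δ → 0ℚ ℚ.< δ → ∃[ N ] (∀ m n → N ℕ.≤ m → N ℕ.≤ n → ℚ.∣ x m ℚ.- x n ∣ ℚ.< K ℚ.* δ)) →
    IsCauchy x
  cauchy-scaled x K 0<K h δ 0<δ with rescale K 0<K δ 0<δ
  ... | δ′ , 0<δ′ , refl = h δ′ 0<δ′

  eventually-bounded : ∀ x → IsCauchy x →
    ∃[ B ] (0ℚ ℚ.< B × ∃[ N ] (∀ n → N ℕ.≤ n → ℚ.∣ x n ∣ ℚ.≤ B))
  eventually-bounded x c with c 1ℚ 0<1
  ... | N , h = 1ℚ ℚ.+ ℚ.∣ x N ∣ , 0<B , N , bound
    where
    0<B : 0ℚ ℚ.< 1ℚ ℚ.+ ℚ.∣ x N ∣
    0<B = ℚ.<-≤-trans 0<1 (≤-+ʳ (ℚ.0≤∣p∣ (x N)))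
    bound : ∀ n → N ℕ.≤ n → ℚ.∣ x n ∣ ℚ.≤ 1ℚ ℚ.+ ℚ.∣ x N ∣
    bound n N≤n = ℚ.≤-trans
      (triangle (x n) (x n ℚ.- x N) (x N) (solve 2 (λ a b → a := (a :- b) :+ b) refl (x n) (x N)))
      (ℚ.+-monoˡ-≤ ℚ.∣ x N ∣ (ℚ.<⇒≤ (h n N N≤n ℕ.≤-refl)))

  const-cauchy : ∀ q → IsCauchy (λ _ → q)
  const-cauchy q δ 0<δ = 0 , λ _ _ _ _ →
    subst (ℚ._< δ) (sym (cong ℚ.∣_∣ (ℚ.+-inverseʳ q))) 0<δ

  +-diff : ∀ a b c d → (a ℚ.+ b) ℚ.- (c ℚ.+ d) ≡ (a ℚ.- c) ℚ.+ (b ℚ.- d)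
  +-diff = solve 4 (λ a b c d → (a :+ b) :- (c :+ d) := (a :- c) :+ (b :- d)) refl

  double : ∀ d → d ℚ.+ d ≡ (1ℚ ℚ.+ 1ℚ) ℚ.* d
  double d = sym (trans (ℚ.*-distribʳ-+ d 1ℚ 1ℚ) (cong₂ ℚ._+_ (ℚ.*-identityˡ d) (ℚ.*-identityˡ d)))

  +-cauchy : ∀ x y → IsCauchy x → IsCauchy y → IsCauchy (λ n → x n ℚ.+ y n)
  +-cauchy x y cx cy = cauchy-scaled (λ n → x n ℚ.+ y n) (1ℚ ℚ.+ 1ℚ) (ℚ.positive⁻¹ (1ℚ ℚ.+ 1ℚ)) go
    where
    go : ∀ δ → 0ℚ ℚ.< δ → ∃[ N ] (∀ m n → N ℕ.≤ m → N ℕ.≤ n →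
           ℚ.∣ (x m ℚ.+ y m) ℚ.- (x n ℚ.+ y n) ∣ ℚ.< (1ℚ ℚ.+ 1ℚ) ℚ.* δ)
    go δ 0<δ with cx δ 0<δ | cy δ 0<δ
    ... | N₁ , h₁ | N₂ , h₂ = N₁ ℕ.⊔ N₂ , λ m n N≤m N≤n →
      ℚ.≤-<-trans
        (triangle ((x m ℚ.+ y m) ℚ.- (x n ℚ.+ y n)) (x m ℚ.- x n) (y m ℚ.- y n)
          (+-diff (x m) (y m) (x n) (y n)))
        (subst (ℚ.∣ x m ℚ.- x n ∣ ℚ.+ ℚ.∣ y m ℚ.- y n ∣ ℚ.<_)
          (double δ)
          (ℚ.+-mono-<
            (h₁ m n (ℕ.m⊔n≤o⇒m≤o N₁ N₂ N≤m) (ℕ.m⊔n≤o⇒m≤o N₁ N₂ N≤n))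
            (h₂ m n (ℕ.m⊔n≤o⇒n≤o N₁ N₂ N≤m) (ℕ.m⊔n≤o⇒n≤o N₁ N₂ N≤n))))

  neg-cauchy : ∀ x → IsCauchy x → IsCauchy (λ n → ℚ.- x n)
  neg-cauchy x cx δ 0<δ with cx δ 0<δ
  ... | N , h = N , λ m n N≤m N≤n → subst (ℚ._< δ)
    (trans (∣-∣-swap (x m) (x n))
      (cong ℚ.∣_∣ (solve 2 (λ a b → b :- a := (:- a) :- (:- b)) refl (x m) (x n))))
    (h m n N≤m N≤n)

  *-diff : ∀ a b c d → a ℚ.* b ℚ.- c ℚ.* d ≡ a ℚ.* (b ℚ.- d) ℚ.+ d ℚ.* (a ℚ.- c)
  *-diff = solve 4 (λ a b c d → (a :* b) :- (c :* d) := a :* (b :- d) :+ d :* (a :- c)) refl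

  ∣*∣-< : ∀ {A δ} a d → 0ℚ ℚ.< A → ℚ.∣ a ∣ ℚ.≤ A → ℚ.∣ d ∣ ℚ.< δ → ℚ.∣ a ℚ.* d ∣ ℚ.< A ℚ.* δ
  ∣*∣-< {A} {δ} a d 0<A ∣a∣≤A ∣d∣<δ = subst (ℚ._< A ℚ.* δ) (sym (ℚ.∣p*q∣≡∣p∣*∣q∣ a d))
    (ℚ.≤-<-trans (ℚ.*-monoʳ-≤-nonNeg ℚ.∣ d ∣ {{ℚ.∣-∣-nonNeg d}} ∣a∣≤A)
      (ℚ.*-monoʳ-<-pos A {{ℚ.positive 0<A}} ∣d∣<δ))

  ⊔-≤ : ∀ {a b m} → a ℕ.⊔ b ℕ.≤ m → a ℕ.≤ m × b ℕ.≤ m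
  ⊔-≤ {a} {b} h = ℕ.m⊔n≤o⇒m≤o a b h , ℕ.m⊔n≤o⇒n≤o a b h

  *-close : ∀ {A B δ} a b c d → 0ℚ ℚ.< A → 0ℚ ℚ.< B → ℚ.∣ a ∣ ℚ.≤ A → ℚ.∣ d ∣ ℚ.≤ B →
    ℚ.∣ a ℚ.- c ∣ ℚ.< δ → ℚ.∣ b ℚ.- d ∣ ℚ.< δ →
    ℚ.∣ a ℚ.* b ℚ.- c ℚ.* d ∣ ℚ.< (A ℚ.+ B) ℚ.* δ
  *-close {A} {B} {δ} a b c d 0<A 0<B a≤A d≤B ac bd = ℚ.≤-<-trans
    (triangle (a ℚ.* b ℚ.- c ℚ.* d) (a ℚ.* (b ℚ.- d)) (d ℚ.* (a ℚ.- c)) (*-diff a b c d))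
    (subst (ℚ.∣ a ℚ.* (b ℚ.- d) ∣ ℚ.+ ℚ.∣ d ℚ.* (a ℚ.- c) ∣ ℚ.<_)
      (sym (ℚ.*-distribʳ-+ δ A B))
      (ℚ.+-mono-< (∣*∣-< a (b ℚ.- d) 0<A a≤A bd) (∣*∣-< d (a ℚ.- c) 0<B d≤B ac)))

  *-cauchy : ∀ x y → IsCauchy x → IsCauchy y → IsCauchy (λ n → x n ℚ.* y n)
  *-cauchy x y cx cy = bounded (eventually-bounded x cx) (eventually-bounded y cy)
    where
    bounded : ∃[ A ] (0ℚ ℚ.< A × ∃[ N ] (∀ n → N ℕ.≤ n → ℚ.∣ x n ∣ ℚ.≤ A)) →
              ∃[ B ] (0ℚ ℚ.< B × ∃[ N ] (∀ n → N ℕ.≤ n → ℚ.∣ y n ∣ ℚ.≤ B)) →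
              IsCauchy (λ n → x n ℚ.* y n)
    bounded (A , 0<A , Nᵃ , ha) (B , 0<B , Nᵇ , hb) =
      cauchy-scaled (λ n → x n ℚ.* y n) (A ℚ.+ B) (ℚ.<-≤-trans 0<A (≤-+ʳ (ℚ.<⇒≤ 0<B))) go
      where
      go : ∀ δ → 0ℚ ℚ.< δ → ∃[ N ] (∀ m n → N ℕ.≤ m → N ℕ.≤ n →
             ℚ.∣ x m ℚ.* y m ℚ.- x n ℚ.* y n ∣ ℚ.< (A ℚ.+ B) ℚ.* δ)
      go δ 0<δ with cx δ 0<δ | cy δ 0<δ
      ... | N₁ , h₁ | N₂ , h₂ = (Nᵃ ℕ.⊔ Nᵇ) ℕ.⊔ (N₁ ℕ.⊔ N₂) , close
        where
        close : ∀ m n → (Nᵃ ℕ.⊔ Nᵇ) ℕ.⊔ (N₁ ℕ.⊔ N₂) ℕ.≤ m → (Nᵃ ℕ.⊔ Nᵇ) ℕ.⊔ (N₁ ℕ.⊔ N₂) ℕ.≤ n →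
          ℚ.∣ x m ℚ.* y m ℚ.- x n ℚ.* y n ∣ ℚ.< (A ℚ.+ B) ℚ.* δ
        close m n N≤m N≤n =
          let ≤m₁ , ≤m₂ = ⊔-≤ {Nᵃ ℕ.⊔ Nᵇ} {N₁ ℕ.⊔ N₂} N≤m
              ≤n₁ , ≤n₂ = ⊔-≤ {Nᵃ ℕ.⊔ Nᵇ} {N₁ ℕ.⊔ N₂} N≤n
              Nᵃ≤m , _    = ⊔-≤ {Nᵃ} {Nᵇ} ≤m₁
              _    , Nᵇ≤n = ⊔-≤ {Nᵃ} {Nᵇ} ≤n₁
              N₁≤m , N₂≤m = ⊔-≤ {N₁} {N₂} ≤m₂
              N₁≤n , N₂≤n = ⊔-≤ {N₁} {N₂} ≤n₂
          in *-close {A} {B} {δ} (x m) (y m) (x n) (y n) 0<A 0<B (ha m Nᵃ≤m) (hb n Nᵇ≤n)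
               (h₁ m n N₁≤m N₁≤n) (h₂ m n N₂≤m N₂≤n)

fromℚ : ℚ → ℝ
fromℚ q = mkℝ (λ _ → q) (const-cauchy q)

fromℕ : ℕ → ℝ
fromℕ n = fromℚ (+ n ℚ./ 1)

0ℝ 1ℝ : ℝ
0ℝ = fromℚ 0ℚ
1ℝ = fromℚ 1ℚ

infixl 6 _+ℝ_ _-ℝ_
infixl 7 _*ℝ_
infix  8 -ℝ_
infixr 8 _^ℝ_

_+ℝ_ : ℝ → ℝ → ℝ
x +ℝ y = mkℝ (λ n → seq x n ℚ.+ seq y n) (+-cauchy (seq x) (seq y) (isCauchy x) (isCauchy y))

-ℝ_ : ℝ → ℝ
-ℝ x = mkℝ (λ n → ℚ.- seq x n) (neg-cauchy (seq x) (isCauchy x))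

_-ℝ_ : ℝ → ℝ → ℝ
x -ℝ y = x +ℝ (-ℝ y)

_*ℝ_ : ℝ → ℝ → ℝ
x *ℝ y = mkℝ (λ n → seq x n ℚ.* seq y n) (*-cauchy (seq x) (seq y) (isCauchy x) (isCauchy y))

_^ℝ_ : ℝ → ℕ → ℝ
x ^ℝ zero  = 1ℝ
x ^ℝ suc n = x *ℝ x ^ℝ n

-- Reciprocal of a positive real.  Only finitely many terms of the
-- sequence can be non-positive, so the value chosen at 0 is immaterial.

recip : ℚ → ℚ
recip q with q ℚ.≟ 0ℚ
... | yes _   = 0ℚ
... | no q≢0 = (ℚ.1/ q) {{ℚ.≢-nonZero q≢0}}

private
  recip-inverse : ∀ q → 0ℚ ℚ.< q → q ℚ.* recip q ≡ 1ℚ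
  recip-inverse q 0<q with q ℚ.≟ 0ℚ
  ... | yes refl = contradiction 0<q (ℚ.<-irrefl refl)
  ... | no q≢0  = ℚ.*-inverseʳ q {{ℚ.≢-nonZero q≢0}}

  recip-pos : ∀ q → 0ℚ ℚ.< q → 0ℚ ℚ.< recip q
  recip-pos q 0<q = ℚ.*-cancelˡ-<-nonNeg q {{ℚ.nonNegative (ℚ.<⇒≤ 0<q)}}
    (subst₂ ℚ._<_ (sym (ℚ.*-zeroʳ q)) (sym (recip-inverse q 0<q)) 0<1)

  recip-anti : ∀ p q → 0ℚ ℚ.< p → p ℚ.≤ q → recip q ℚ.≤ recip p
  recip-anti p q 0<p p≤q = subst₂ ℚ._≤_ eqˡ eqʳ
      (ℚ.*-monoʳ-≤-nonNeg (recip p ℚ.* recip q) {{ℚ.nonNegative (0≤* (ℚ.<⇒≤ (recip-pos p 0<p)) (ℚ.<⇒≤ (recip-pos q 0<q)))}} p≤q)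
    where
    0<q = ℚ.<-≤-trans 0<p p≤q
    eqˡ : p ℚ.* (recip p ℚ.* recip q) ≡ recip q
    eqˡ = trans (sym (ℚ.*-assoc p (recip p) (recip q)))
      (trans (cong (ℚ._* recip q) (recip-inverse p 0<p)) (ℚ.*-identityˡ (recip q)))
    eqʳ : q ℚ.* (recip p ℚ.* recip q) ≡ recip p
    eqʳ = trans (solve 3 (λ a b c → a :* (b :* c) := (a :* c) :* b) refl q (recip p) (recip q))
      (trans (cong (ℚ._* recip p) (recip-inverse q 0<q)) (ℚ.*-identityˡ (recip p)))

  recip-diff : ∀ p q → 0ℚ ℚ.< p → 0ℚ ℚ.< q →
    recip p ℚ.- recip q ≡ (recip p ℚ.* recip q) ℚ.* (q ℚ.- p)
  recip-diff p q 0<p 0<q = sym (begin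
    (a ℚ.* b) ℚ.* (q ℚ.- p)
      ≡⟨ solve 4 (λ a b p q → (a :* b) :* (q :- p) := a :* (q :* b) :- b :* (p :* a)) refl a b p q ⟩
    a ℚ.* (q ℚ.* b) ℚ.- b ℚ.* (p ℚ.* a)
      ≡⟨ cong₂ (λ s t → a ℚ.* s ℚ.- b ℚ.* t) (recip-inverse q 0<q) (recip-inverse p 0<p) ⟩
    a ℚ.* 1ℚ ℚ.- b ℚ.* 1ℚ
      ≡⟨ cong₂ ℚ._-_ (ℚ.*-identityʳ a) (ℚ.*-identityʳ b) ⟩
    a ℚ.- b ∎)
    where
    open ≡-Reasoning
    a = recip p
    b = recip q

  recip-cauchy : ∀ x → 0ℝ <ℝ x → IsCauchy (λ n → recip (seq x n))
  recip-cauchy x (η , 0<η , N₀ , h₀) = cauchy-scaled (λ n → recip (seq x n)) (ρ ℚ.* ρ) 0<ρ² λ δ 0<δ →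
    let N₁ , h₁ = isCauchy x δ 0<δ
    in N₀ ℕ.⊔ N₁ , λ m n N≤m N≤n →
      let η≤m = η≤ m (ℕ.m⊔n≤o⇒m≤o N₀ N₁ N≤m)
          η≤n = η≤ n (ℕ.m⊔n≤o⇒m≤o N₀ N₁ N≤n)
          a = seq x m
          b = seq x n
          0<a = ℚ.<-≤-trans 0<η η≤m
          0<b = ℚ.<-≤-trans 0<η η≤n
          0≤ra = ℚ.<⇒≤ (recip-pos a 0<a)
          0≤rb = ℚ.<⇒≤ (recip-pos b 0<b)
          eq : ℚ.∣ recip a ℚ.- recip b ∣ ≡ (recip a ℚ.* recip b) ℚ.* ℚ.∣ a ℚ.- b ∣
          eq = trans (cong ℚ.∣_∣ (recip-diff a b 0<a 0<b))
            (trans (ℚ.∣p*q∣≡∣p∣*∣q∣ (recip a ℚ.* recip b) (b ℚ.- a))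
              (cong₂ ℚ._*_ (ℚ.0≤p⇒∣p∣≡p (0≤* 0≤ra 0≤rb)) (∣-∣-swap b a)))
      in subst (ℚ._< (ρ ℚ.* ρ) ℚ.* δ) (sym eq)
        (ℚ.≤-<-trans
          (ℚ.*-monoʳ-≤-nonNeg ℚ.∣ a ℚ.- b ∣ {{ℚ.∣-∣-nonNeg (a ℚ.- b)}}
            (*-mono-≤-nonNeg 0≤rb (ℚ.<⇒≤ 0<ρ) (recip-anti η a 0<η η≤m) (recip-anti η b 0<η η≤n)))
          (ℚ.*-monoʳ-<-pos (ρ ℚ.* ρ) {{ℚ.positive 0<ρ²}}
            (h₁ m n (ℕ.m⊔n≤o⇒n≤o N₀ N₁ N≤m) (ℕ.m⊔n≤o⇒n≤o N₀ N₁ N≤n))))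
    where
    ρ = recip η
    0<ρ = recip-pos η 0<η
    0<ρ² : 0ℚ ℚ.< ρ ℚ.* ρ
    0<ρ² = subst (ℚ._< ρ ℚ.* ρ) (ℚ.*-zeroʳ ρ) (ℚ.*-monoʳ-<-pos ρ {{ℚ.positive 0<ρ}} 0<ρ)
    η≤ : ∀ n → N₀ ℕ.≤ n → η ℚ.≤ seq x n
    η≤ n N₀≤n = subst (ℚ._≤ seq x n) (ℚ.+-identityˡ η) (h₀ n N₀≤n)

inv : (x : ℝ) → 0ℝ <ℝ x → ℝ
inv x 0<x = mkℝ (λ n → recip (seq x n)) (recip-cauchy x 0<x)

-- Natural logarithm of a positive integer r, through the Mercator series
--   log r = - log (1 - q) = Σ_{j ≥ 1} q ^ j / j    with  q = 1 - 1 / r;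
-- mercator q n is its n-th partial sum.

private
  fromℕ-recip : ∀ m → (+ suc m ℚ./ 1) ℚ.* (+ 1 ℚ./ suc m) ≡ 1ℚ
  fromℕ-recip m = ℚ.toℚᵘ-injective (begin
    ℚ.toℚᵘ ((+ suc m ℚ./ 1) ℚ.* (+ 1 ℚ./ suc m))
      ≈⟨ ℚ.toℚᵘ-homo-* (+ suc m ℚ./ 1) (+ 1 ℚ./ suc m) ⟩
    ℚ.toℚᵘ (+ suc m ℚ./ 1) ℚᵘ.* ℚ.toℚᵘ (+ 1 ℚ./ suc m)
      ≈⟨ ℚᵘ.*-cong (ℚ.toℚᵘ-fromℚᵘ (mkℚᵘ (+ suc m) 0)) (ℚ.toℚᵘ-fromℚᵘ (mkℚᵘ (+ 1) m)) ⟩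
    mkℚᵘ (+ suc m) 0 ℚᵘ.* mkℚᵘ (+ 1) m
      ≈⟨ ℚᵘ.*≡* (trans (ℤ.*-identityʳ _) (trans (ℤ.*-identityʳ (+ suc m)) (sym (trans (ℤ.*-identityˡ _) (cong +_ (ℕ.*-identityˡ (suc m))))))) ⟩
    ℚᵘ.1ℚᵘ ∎)
    where open ℚᵘ.≃-Reasoning

  unit-pos : ∀ m → 0ℚ ℚ.< + 1 ℚ./ suc m
  unit-pos m = ℚ.positive⁻¹ _ {{ℚ.normalize-pos 1 (suc m)}}

  unit-anti : ∀ {m n} → m ℕ.≤ n → + 1 ℚ./ suc n ℚ.≤ + 1 ℚ./ suc m
  unit-anti {m} {n} m≤n = ℚ.toℚᵘ-cancel-≤ (ℚᵘ.≤-trans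
    (ℚᵘ.≤-reflexive (ℚ.toℚᵘ-fromℚᵘ (mkℚᵘ (+ 1) n)))
    (ℚᵘ.≤-trans
      (ℚᵘ.*≤* (ℤ.*-monoˡ-≤-nonNeg (+ 1) (ℤ.+≤+ (ℕ.s≤s m≤n))))
      (ℚᵘ.≤-reflexive (ℚᵘ.≃-sym (ℚ.toℚᵘ-fromℚᵘ (mkℚᵘ (+ 1) m))))))

  archimedean : ∀ δ → 0ℚ ℚ.< δ → ∃[ N ] (+ 1 ℚ./ suc N ℚ.< δ)
  archimedean (mkℚ (+ zero) d c) (*<* (ℤ.+<+ ()))
  archimedean (mkℚ -[1+ a ] d c) (*<* ())
  archimedean δ@(mkℚ (+ suc a) d c) _ = suc d , ℚ.toℚᵘ-cancel-< (ℚᵘ.≤-<-trans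
    (ℚᵘ.≤-reflexive (ℚ.toℚᵘ-fromℚᵘ (mkℚᵘ (+ 1) (suc d))))
    (ℚᵘ.*<* (ℤ.+<+ lt)))
    where
    lt : 1 ℕ.* suc d ℕ.< suc a ℕ.* suc (suc d)
    lt = subst (ℕ._< suc a ℕ.* suc (suc d)) (sym (ℕ.*-identityˡ (suc d)))
      (ℕ.≤-trans (ℕ.n<1+n (suc d)) (ℕ.m≤m+n (suc (suc d)) (a ℕ.* suc (suc d))))

infixr 8 _^ℚ_

_^ℚ_ : ℚ → ℕ → ℚ
q ^ℚ zero  = 1ℚ
q ^ℚ suc n = q ℚ.* q ^ℚ n

mercator : ℚ → ℕ → ℚ
mercator q zero    = 0ℚ
mercator q (suc n) = mercator q n ℚ.+ q ^ℚ suc n ℚ.* (+ 1 ℚ./ suc n)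

1-1/ : (r : ℕ) .{{_ : ℕ.NonZero r}} → ℚ
1-1/ r = 1ℚ ℚ.- (+ 1 ℚ./ r)

private
  module Log (m : ℕ) where
    r u q : ℚ
    r = + suc m ℚ./ 1
    u = + 1 ℚ./ suc m
    q = 1-1/ (suc m)

    0<r : 0ℚ ℚ.< r
    0<r = ℚ.positive⁻¹ _ {{ℚ.normalize-pos (suc m) 1}}

    0≤q : 0ℚ ℚ.≤ q
    0≤q = subst (ℚ._≤ q) (ℚ.+-inverseʳ u) (ℚ.+-monoˡ-≤ (ℚ.- u) (unit-anti {0} {m} ℕ.z≤n))

    q≤1 : q ℚ.≤ 1ℚ
    q≤1 = subst (q ℚ.≤_) (ℚ.+-identityʳ 1ℚ) (ℚ.+-monoʳ-≤ 1ℚ (ℚ.neg-antimono-≤ (ℚ.<⇒≤ (unit-pos m))))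

    0≤q^ : ∀ n → 0ℚ ℚ.≤ q ^ℚ n
    0≤q^ zero    = ℚ.<⇒≤ 0<1
    0≤q^ (suc n) = 0≤* 0≤q (0≤q^ n)

    q^≤1 : ∀ n → q ^ℚ n ℚ.≤ 1ℚ
    q^≤1 zero    = ℚ.≤-refl
    q^≤1 (suc n) = *-mono-≤-nonNeg (0≤q^ n) (ℚ.<⇒≤ 0<1) q≤1 (q^≤1 n)

    geometric : ∀ n → q ^ℚ n ≡ r ℚ.* (q ^ℚ n ℚ.- q ^ℚ suc n)
    geometric n = sym (begin
      r ℚ.* (x ℚ.- (1ℚ ℚ.- u) ℚ.* x)
        ≡⟨ solve 3 (λ r u x → r :* (x :- (con 1ℚ :- u) :* x) := (r :* u) :* x) refl r u x ⟩
      (r ℚ.* u) ℚ.* x ≡⟨ cong (ℚ._* x) (fromℕ-recip m) ⟩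
      1ℚ ℚ.* x        ≡⟨ ℚ.*-identityˡ x ⟩
      x ∎)
      where
      open ≡-Reasoning
      x = q ^ℚ n

    s : ℕ → ℚ
    s = mercator q

    s-mono : ∀ N d → s N ℚ.≤ s (d ℕ.+ N)
    s-mono N zero    = ℚ.≤-refl
    s-mono N (suc d) = ℚ.≤-trans (s-mono N d)
      (≤-+ʳ (0≤* (0≤q^ (suc (d ℕ.+ N))) (ℚ.<⇒≤ (unit-pos (d ℕ.+ N)))))

    tail : ∀ N d → s (d ℕ.+ N) ℚ.- s N ℚ.≤ (r ℚ.* (q ^ℚ suc N ℚ.- q ^ℚ suc (d ℕ.+ N))) ℚ.* (+ 1 ℚ./ suc N)
    tail N zero = ℚ.≤-reflexive (solve 4 (λ s r x v → s :- s := (r :* (x :- x)) :* v) refl (s N) r (q ^ℚ suc N) (+ 1 ℚ./ suc N))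
    tail N (suc d) = subst₂ ℚ._≤_
      (solve 3 (λ a b c → (a :- b) :+ c := (a :+ c) :- b) refl (s n) (s N) (q ^ℚ suc n ℚ.* w))
      (solve 5 (λ r x y z v → (r :* (x :- y)) :* v :+ (r :* (y :- z)) :* v := (r :* (x :- z)) :* v) refl
        r (q ^ℚ suc N) (q ^ℚ suc n) (q ^ℚ suc (suc n)) v)
      (ℚ.+-mono-≤ (tail N d)
        (subst (λ t → q ^ℚ suc n ℚ.* w ℚ.≤ t ℚ.* v) (geometric (suc n))
          (ℚ.*-monoˡ-≤-nonNeg (q ^ℚ suc n) {{ℚ.nonNegative (0≤q^ (suc n))}} (unit-anti (ℕ.m≤n+m N d)))))
      where
      n = d ℕ.+ N
      v = + 1 ℚ./ suc N
      w = + 1 ℚ./ suc n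

    tail≤ : ∀ N d → s (d ℕ.+ N) ℚ.- s N ℚ.≤ r ℚ.* (+ 1 ℚ./ suc N)
    tail≤ N d = ℚ.≤-trans (tail N d) (ℚ.*-monoʳ-≤-nonNeg (+ 1 ℚ./ suc N) {{ℚ.nonNegative (ℚ.<⇒≤ (unit-pos N))}}
      (subst (r ℚ.* (a ℚ.- b) ℚ.≤_) (ℚ.*-identityʳ r)
        (ℚ.*-monoˡ-≤-nonNeg r {{ℚ.nonNegative (ℚ.<⇒≤ 0<r)}}
          (subst (a ℚ.- b ℚ.≤_) (ℚ.+-identityʳ 1ℚ)
            (ℚ.+-mono-≤ (q^≤1 (suc N)) (ℚ.neg-antimono-≤ (0≤q^ (suc (d ℕ.+ N)))))))))
      where
      a = q ^ℚ suc N
      b = q ^ℚ suc (d ℕ.+ N)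

    ordered : ∀ N m n → N ℕ.≤ m → m ℕ.≤ n → ℚ.∣ s n ℚ.- s m ∣ ℚ.≤ r ℚ.* (+ 1 ℚ./ suc N)
    ordered N m n N≤m m≤n = subst (λ k → ℚ.∣ s k ℚ.- s m ∣ ℚ.≤ r ℚ.* (+ 1 ℚ./ suc N)) (ℕ.m∸n+n≡m m≤n)
      (ℚ.≤-trans
        (ℚ.≤-reflexive (ℚ.0≤p⇒∣p∣≡p
          (subst (ℚ._≤ s (n ℕ.∸ m ℕ.+ m) ℚ.- s m) (ℚ.+-inverseʳ (s m)) (ℚ.+-monoˡ-≤ (ℚ.- s m) (s-mono m (n ℕ.∸ m))))))
        (ℚ.≤-trans (tail≤ m (n ℕ.∸ m))
          (ℚ.*-monoˡ-≤-nonNeg r {{ℚ.nonNegative (ℚ.<⇒≤ 0<r)}} (unit-anti N≤m))))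

    cauchy : IsCauchy s
    cauchy = cauchy-scaled s r 0<r λ δ 0<δ →
      let N , h = archimedean δ 0<δ
          lt = ℚ.*-monoʳ-<-pos r {{ℚ.positive 0<r}} h
      in N , λ m n N≤m N≤n → case-total N m n N≤m N≤n lt (ℕ.≤-total m n)
      where
      case-total : ∀ N m n → N ℕ.≤ m → N ℕ.≤ n → ∀ {t} → r ℚ.* (+ 1 ℚ./ suc N) ℚ.< t →
        _ → ℚ.∣ s m ℚ.- s n ∣ ℚ.< t
      case-total N m n N≤m N≤n {t} lt (inj₁ m≤n) =
        subst (ℚ._< t) (∣-∣-swap (s n) (s m)) (ℚ.≤-<-trans (ordered N m n N≤m m≤n) lt)
      case-total N m n N≤m N≤n lt (inj₂ n≤m) = ℚ.≤-<-trans (ordered N n m N≤n n≤m) lt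

-- log 0 := 0; since probabilities are nonnegative, a hypothesis
-- p ≥ C log 0 / κ then always holds, as it would be with log 0 = -∞.
log : ℕ → ℝ
log zero      = 0ℝ
log r@(suc m) = mkℝ (mercator (1-1/ r)) (Log.cauchy m)

TendsToZero : (ℕ → ℝ) → Set
TendsToZero f = ∀ δ → 0ℝ <ℝ δ → ∃[ N ] (∀ n → N ℕ.≤ n → (-ℝ δ) <ℝ f n × f n <ℝ δ)

-- Finite discrete distributions: lists of outcomes with their weights.  Nothing
-- forces weights to be nonnegative or to sum to 1; for bernoulli p this
-- needs 0 ≤ p ≤ 1.
Dist : Set → Set
Dist A = List (A × ℝ)

infixr 5 _⊗_

_⊗_ : ∀ {A B} → Dist A → Dist B → Dist (A × B)
_⊗_ = cartesianProductWith λ (a , v) (b , w) → (a , b) , v *ℝ w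

iid : ∀ {A} (n : ℕ) → Dist A → Dist (Vec A n)
iid zero    d = ([] , 1ℝ) ∷ []
iid (suc n) d = map (λ ((a , as) , w) → a ∷ as , w) (d ⊗ iid n d)

bernoulli : ℝ → Dist Side
bernoulli p = (inside , p) ∷ (outside , 1ℝ -ℝ p) ∷ []

uniform : (k : ℕ) .{{_ : ℕ.NonZero k}} → Dist (Fin k)
uniform k = map (λ c → c , fromℚ (+ 1 ℚ./ k)) (allFin k)

Pr : ∀ {A} → Dist A → {E : A → Set} → Decidable E → ℝ
Pr d E? = foldr _+ℝ_ 0ℝ (map proj₂ (filter (E? ∘ proj₁) d))

-- A subset of Fin n is a vector of n membership flags, so independent
-- flags give the binomial random subset.
randomSubset : (n : ℕ) → ℝ → Dist (Subset n)
randomSubset n p = iid n (bernoulli p)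

randomColoring : (n k : ℕ) .{{_ : ℕ.NonZero k}} → Dist (Vec (Fin k) n)
randomColoring n k = iid n (uniform k)

-- Edges are listed with repetition; the vertex set is Fin n.
MultiHypergraph : ℕ → Set
MultiHypergraph n = List⁺ (Subset n)

module _ {n : ℕ} (H : MultiHypergraph n) where

  edges : List (Subset n)
  edges = toList H

  size : ℕ
  size = length edges

  degree : Subset n → ℕ
  degree S = length (filter (S ⊆?_) edges)

  Bounded : ℕ → Set
  Bounded r = All (λ e → ∣ e ∣ ℕ.≤ r) edges

  Spread : (κ : ℝ) → 0ℝ <ℝ κ → Set
  Spread κ κ>0 = ∀ S → fromℕ (degree S) ≤ℝ inv κ κ>0 ^ℝ ∣ S ∣ *ℝ fromℕ size

Rainbow : ∀ {n k} → Vec (Fin k) n → Subset n → Set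
Rainbow c e = ∀ x y → x ∈ e → y ∈ e → x ≢ y → lookup c x ≢ lookup c y

rainbow? : ∀ {n k} (c : Vec (Fin k) n) → Decidable (Rainbow c)
rainbow? c e = Fin.all? λ x → Fin.all? λ y →
  (x ∈? e) →-dec (y ∈? e) →-dec ¬? (x Fin.≟ y) →-dec ¬? (lookup c x Fin.≟ lookup c y)

ContainsRainbowEdge : ∀ {n k} → MultiHypergraph n → Vec (Fin k) n × Subset n → Set
ContainsRainbowEdge H (c , W) = Any (λ e → e ⊆ W × Rainbow c e) (edges H)

containsRainbowEdge? : ∀ {n k} (H : MultiHypergraph n) → Decidable (ContainsRainbowEdge {n} {k} H)
containsRainbowEdge? H (c , W) = any? (λ e → (e ⊆? W) ×-dec rainbow? c e) (edges H)

{-# OPTIONS --safe #-}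
-- A rainbow colouring of an edge is an edge of a hypergraph on X × [k]: every edge e is replaced by
-- the graphs of its injective colourings.  Since k ^ s ≤ 3 ^ s k (k - 1) ⋯ (k - s + 1), this hypergraph
-- is (κ k / 3)-spread.  A p-biased set with uniform colours succeeds at least as often as a
-- (p / k)-biased subset of X × [k]: a coloured edge uses at most one colour of each vertex, so by the
-- union bound independent colours of a vertex are no better than a single random one.
--
-- It remains to show that a random set of density of order (log r) u contains an edge of an r-bounded
-- hypergraph in which a set S has degree at most u ^ ∣ S ∣ times the number of edges.  The random set is
-- exposed in rounds of density p, halving the edge sizes (Park and Pham).  Given the set W of a round, an
-- edge e is replaced by e′ ─ W for some edge e′ ⊆ W ∪ e with ∣ e′ ─ W ∣ < m.  If there is none, a minimal
-- T = e′ ─ W has at least m elements and lies in every edge contained in Z = W ∪ T; so Z determines T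
-- up to 2 ^ (2 m) choices, and the expected proportion of lost edges is at most (4 u / p) ^ m.
module Submission where

open import Defs
open import Data.Fin.Base using (Fin; zero; suc)
import Data.Fin.Properties as Fin
open import Data.Fin.Subset using (Subset; inside; outside; _∈_; _⊆_; _∪_; _─_; ∁; ∣_∣; ⊥; ⊤; ⁅_⁆) renaming (_-_ to _∖_)
open import Data.Fin.Subset.Properties using (_∈?_; _⊆?_; drop-∷-⊆; out⊆; in⊆in; s⊆s; ⊆-min; p⊆q⇒∣p∣≤∣q∣; ∣p∣≤∣x∷p∣; ∣⊥∣≡0; ∣⊤∣≡n; ∣⁅x⁆∣≡1; ∉⊥; x∈⁅x⁆; x∈⁅y⁆⇒x≡y; x∉p⇒x∈∁p; nonempty?; Empty-unique; q⊆p∪q; x∈p∪q⁻; x∈p∪q⁺; p─q⊆p; p─⊥≡p; p─x─y≡p─y─x; x∈p∧x∉q⇒x∈p─q; x∈p∧x≢y⇒x∈p-y)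
open import Data.Integer.Base as ℤ using ()
import Data.Integer.Properties as ℤ
open import Data.List.Base using (List; []; _∷_; _++_; length; map; concatMap; replicate; allFin; tabulate; filter; foldr)
open import Data.List.Membership.Propositional using (find; lose) renaming (_∈_ to _∈ᴸ_)
open import Data.List.Relation.Unary.All as All using (All; []; _∷_; all?)
open import Data.List.Relation.Unary.All.Properties using (¬All⇒Any¬; map⁺; concat⁺; tabulate⁺; replicate⁺)
open import Data.List.Relation.Unary.Any as Any using (Any; here; there; any?)
open import Data.Maybe.Base using (Maybe; just; nothing)
open import Data.Nat.Base as ℕ using (ℕ; zero; suc; _!)
import Data.Nat.Properties as ℕ
open import Data.Product.Base using (Σ; ∃-syntax; _×_; _,_; proj₁; proj₂)
open import Data.Rational.Base as ℚ using (ℚ; 0ℚ; 1ℚ; _+_; _*_; _-_; -_; _≤_; _<_)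
import Data.Rational.Properties as ℚ
open import Data.Rational.Solver using (module +-*-Solver)
open +-*-Solver using (solve; _:+_; _:*_; _:-_; :-_; _:=_; con)
open import Data.Rational.Unnormalised.Base as ℚᵘ using (mkℚᵘ)
import Data.Rational.Unnormalised.Properties as ℚᵘ
open import Data.Sum.Base using (_⊎_; inj₁; inj₂)
open import Data.Unit.Base using (tt) renaming (⊤ to Unit)
open import Data.Vec.Base as Vec using (Vec; []; _∷_)
open import Function.Base using (_∘_; id)
open import Relation.Binary.PropositionalEquality
open import Relation.Nullary using (Dec; yes; no; ¬_; contradiction; ¬?; _×-dec_; _→-dec_)

-- Rational arithmetic

-- The bound (4 u / p) ^ m is weak for small m: at one constant density the bounds for the last few
-- rounds would not tend to zero. The density is therefore raised towards the end by a surplus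
-- proportional to L / 2 ^ j. Being geometric, the surplus costs a constant factor in the total,
-- while the failure probability drops to order 1 / log r. The number k of colours cancels: passing
-- to X × [k] multiplies u by 3 / k and the density by 1 / k. The combinatorics is done over the
-- rationals. Real operations act termwise, so the i-th term of the probability is a polynomial in
-- the i-th term of p. Two obstacles remain in the limit: terms of p may leave [0,1], and real
-- inequalities hold only for large i and up to a slack. Clamping with a Lipschitz bound meets the
-- first; spare room in the constants meets the second, on a scale given by a positive rational
-- lower bound for 1 / κ.

0≤1 : 0ℚ ≤ 1ℚ
0≤1 = ℚ.nonNegative⁻¹ 1ℚ

+-nonNeg : ∀ {a b} → 0ℚ ≤ a → 0ℚ ≤ b → 0ℚ ≤ a + b
+-nonNeg = ℚ.+-mono-≤

*-monoˡ : ∀ {a b} c → 0ℚ ≤ c → a ≤ b → c * a ≤ c * b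
*-monoˡ c 0≤c = ℚ.*-monoˡ-≤-nonNeg c {{ℚ.nonNegative 0≤c}}

*-monoʳ : ∀ {a b} c → 0ℚ ≤ c → a ≤ b → a * c ≤ b * c
*-monoʳ c 0≤c = ℚ.*-monoʳ-≤-nonNeg c {{ℚ.nonNegative 0≤c}}

*-nonNeg : ∀ {a b} → 0ℚ ≤ a → 0ℚ ≤ b → 0ℚ ≤ a * b
*-nonNeg {a} {b} 0≤a 0≤b = subst (_≤ a * b) (ℚ.*-zeroʳ a) (*-monoˡ a 0≤a 0≤b)

*-mono : ∀ {a b c d} → 0ℚ ≤ c → 0ℚ ≤ b → a ≤ b → c ≤ d → a * c ≤ b * d
*-mono {a} {b} {c} {d} 0≤c 0≤b a≤b c≤d = ℚ.≤-trans (*-monoʳ c 0≤c a≤b) (*-monoˡ b 0≤b c≤d)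

*-pos : ∀ {a b} → 0ℚ < a → 0ℚ < b → 0ℚ < a * b
*-pos {a} {b} 0<a 0<b =
  subst (_< a * b) (ℚ.*-zeroʳ a) (ℚ.*-monoʳ-<-pos a {{ℚ.positive 0<a}} 0<b)

p≤p+q : ∀ {a b} → 0ℚ ≤ b → a ≤ a + b
p≤p+q {a} {b} 0≤b = subst (_≤ a + b) (ℚ.+-identityʳ a) (ℚ.+-monoʳ-≤ a 0≤b)

q≤p+q : ∀ {a b} → 0ℚ ≤ a → b ≤ a + b
q≤p+q {a} {b} 0≤a = subst (_≤ a + b) (ℚ.+-identityˡ b) (ℚ.+-monoˡ-≤ b 0≤a)

0≤q-p : ∀ {a b} → a ≤ b → 0ℚ ≤ b - a
0≤q-p {a} {b} a≤b = subst (_≤ b - a) (ℚ.+-inverseʳ a) (ℚ.+-monoˡ-≤ (- a) a≤b)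

-- Reduces an inequality to a ring identity.
≤-by : ∀ {a b} d → 0ℚ ≤ d → a + d ≡ b → a ≤ b
≤-by d 0≤d refl = p≤p+q 0≤d

+-cancelʳ-≤ : ∀ {a b} c → a + c ≤ b + c → a ≤ b
+-cancelʳ-≤ {a} {b} c h = ≤-by ((b + c) - (a + c)) (0≤q-p h)
  (solve 3 (λ a b c → a :+ ((b :+ c) :- (a :+ c)) := b) refl a b c)

^-nonNeg : ∀ {q} → 0ℚ ≤ q → ∀ n → 0ℚ ≤ q ^ℚ n
^-nonNeg 0≤q zero    = 0≤1
^-nonNeg 0≤q (suc n) = *-nonNeg 0≤q (^-nonNeg 0≤q n)

^-pos : ∀ {q} → 0ℚ < q → ∀ n → 0ℚ < q ^ℚ n
^-pos 0<q zero    = ℚ.positive⁻¹ 1ℚ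
^-pos 0<q (suc n) = *-pos 0<q (^-pos 0<q n)

^-mono : ∀ {a b} → 0ℚ ≤ a → a ≤ b → ∀ n → a ^ℚ n ≤ b ^ℚ n
^-mono 0≤a a≤b zero    = ℚ.≤-refl
^-mono 0≤a a≤b (suc n) = *-mono (^-nonNeg 0≤a n) (ℚ.≤-trans 0≤a a≤b) a≤b (^-mono 0≤a a≤b n)

^-+ : ∀ q m n → q ^ℚ (m ℕ.+ n) ≡ q ^ℚ m * q ^ℚ n
^-+ q zero    n = sym (ℚ.*-identityˡ _)
^-+ q (suc m) n = trans (cong (q *_) (^-+ q m n)) (sym (ℚ.*-assoc q _ _))

^-distrib-* : ∀ a b n → (a * b) ^ℚ n ≡ a ^ℚ n * b ^ℚ n
^-distrib-* a b zero    = refl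
^-distrib-* a b (suc n) = trans (cong (a * b *_) (^-distrib-* a b n))
  (solve 4 (λ a b x y → (a :* b) :* (x :* y) := (a :* x) :* (b :* y)) refl a b (a ^ℚ n) (b ^ℚ n))

1^n≡1 : ∀ n → 1ℚ ^ℚ n ≡ 1ℚ
1^n≡1 zero    = refl
1^n≡1 (suc n) = trans (ℚ.*-identityˡ (1ℚ ^ℚ n)) (1^n≡1 n)

^-≤1 : ∀ {q} → 0ℚ ≤ q → q ≤ 1ℚ → ∀ n → q ^ℚ n ≤ 1ℚ
^-≤1 0≤q q≤1 zero    = ℚ.≤-refl
^-≤1 0≤q q≤1 (suc n) = *-mono (^-nonNeg 0≤q n) 0≤1 q≤1 (^-≤1 0≤q q≤1 n)

^-antitone : ∀ {q} → 0ℚ ≤ q → q ≤ 1ℚ → ∀ {m n} → m ℕ.≤ n → q ^ℚ n ≤ q ^ℚ m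
^-antitone 0≤q q≤1 {n = n} ℕ.z≤n = ^-≤1 0≤q q≤1 n
^-antitone 0≤q q≤1 (ℕ.s≤s m≤n)   = *-monoˡ _ 0≤q (^-antitone 0≤q q≤1 m≤n)

^-monoʳ : ∀ {q} → 1ℚ ≤ q → ∀ {m n} → m ℕ.≤ n → q ^ℚ m ≤ q ^ℚ n
^-monoʳ 1≤q {n = zero}  ℕ.z≤n = ℚ.≤-refl
^-monoʳ 1≤q {n = suc n} ℕ.z≤n = *-mono 0≤1 (ℚ.≤-trans 0≤1 1≤q) 1≤q (^-monoʳ 1≤q {n = n} ℕ.z≤n)
^-monoʳ 1≤q (ℕ.s≤s m≤n)       = *-monoˡ _ (ℚ.≤-trans 0≤1 1≤q) (^-monoʳ 1≤q m≤n)

infix 9 ⟦_⟧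

⟦_⟧ : ℕ → ℚ
⟦ n ⟧ = ℤ.+ n ℚ./ 1

private
  ⟦⟧-toℚᵘ : ∀ n → ℚ.toℚᵘ ⟦ n ⟧ ℚᵘ.≃ mkℚᵘ (ℤ.+ n) 0
  ⟦⟧-toℚᵘ n = ℚ.toℚᵘ-fromℚᵘ (mkℚᵘ (ℤ.+ n) 0)

⟦⟧-+ : ∀ m n → ⟦ m ℕ.+ n ⟧ ≡ ⟦ m ⟧ + ⟦ n ⟧
⟦⟧-+ m n = ℚ.toℚᵘ-injective (begin
  ℚ.toℚᵘ ⟦ m ℕ.+ n ⟧                ≈⟨ ⟦⟧-toℚᵘ (m ℕ.+ n) ⟩
  mkℚᵘ (ℤ.+ (m ℕ.+ n)) 0              ≈⟨ ℚᵘ.*≡* (cong (λ x → x ℤ.* ℤ.+ 1) (trans (ℤ.pos-+ m n)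
                                        (cong₂ ℤ._+_ (sym (ℤ.*-identityʳ (ℤ.+ m))) (sym (ℤ.*-identityʳ (ℤ.+ n)))))) ⟩
  mkℚᵘ (ℤ.+ m) 0 ℚᵘ.+ mkℚᵘ (ℤ.+ n) 0    ≈⟨ ℚᵘ.+-cong (ℚᵘ.≃-sym (⟦⟧-toℚᵘ m)) (ℚᵘ.≃-sym (⟦⟧-toℚᵘ n)) ⟩
  ℚ.toℚᵘ ⟦ m ⟧ ℚᵘ.+ ℚ.toℚᵘ ⟦ n ⟧    ≈⟨ ℚᵘ.≃-sym (ℚ.toℚᵘ-homo-+ ⟦ m ⟧ ⟦ n ⟧) ⟩
  ℚ.toℚᵘ (⟦ m ⟧ + ⟦ n ⟧)            ∎)
  where open ℚᵘ.≃-Reasoning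

⟦⟧-* : ∀ m n → ⟦ m ℕ.* n ⟧ ≡ ⟦ m ⟧ * ⟦ n ⟧
⟦⟧-* m n = ℚ.toℚᵘ-injective (begin
  ℚ.toℚᵘ ⟦ m ℕ.* n ⟧                ≈⟨ ⟦⟧-toℚᵘ (m ℕ.* n) ⟩
  mkℚᵘ (ℤ.+ (m ℕ.* n)) 0              ≈⟨ ℚᵘ.*≡* (cong (λ x → x ℤ.* ℤ.+ 1) (ℤ.pos-* m n)) ⟩
  mkℚᵘ (ℤ.+ m) 0 ℚᵘ.* mkℚᵘ (ℤ.+ n) 0    ≈⟨ ℚᵘ.*-cong (ℚᵘ.≃-sym (⟦⟧-toℚᵘ m)) (ℚᵘ.≃-sym (⟦⟧-toℚᵘ n)) ⟩
  ℚ.toℚᵘ ⟦ m ⟧ ℚᵘ.* ℚ.toℚᵘ ⟦ n ⟧    ≈⟨ ℚᵘ.≃-sym (ℚ.toℚᵘ-homo-* ⟦ m ⟧ ⟦ n ⟧) ⟩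
  ℚ.toℚᵘ (⟦ m ⟧ * ⟦ n ⟧)            ∎)
  where open ℚᵘ.≃-Reasoning

⟦⟧-nonNeg : ∀ n → 0ℚ ≤ ⟦ n ⟧
⟦⟧-nonNeg n = ℚ.nonNegative⁻¹ _ {{ℚ.normalize-nonNeg n 1}}

⟦⟧-pos : ∀ n → 0ℚ < ⟦ suc n ⟧
⟦⟧-pos n = ℚ.positive⁻¹ _ {{ℚ.normalize-pos (suc n) 1}}

⟦⟧-mono : ∀ {m n} → m ℕ.≤ n → ⟦ m ⟧ ≤ ⟦ n ⟧
⟦⟧-mono {m} {n} m≤n = ≤-by ⟦ n ℕ.∸ m ⟧ (⟦⟧-nonNeg (n ℕ.∸ m))
  (trans (sym (⟦⟧-+ m (n ℕ.∸ m))) (cong ⟦_⟧ (ℕ.m+[n∸m]≡n m≤n)))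

⟦⟧-^ : ∀ m n → ⟦ m ℕ.^ n ⟧ ≡ ⟦ m ⟧ ^ℚ n
⟦⟧-^ m zero    = refl
⟦⟧-^ m (suc n) = trans (⟦⟧-* m (m ℕ.^ n)) (cong (⟦ m ⟧ *_) (⟦⟧-^ m n))

⟦⟧-unit : ∀ m .{{_ : ℕ.NonZero m}} → ⟦ m ⟧ * (ℤ.+ 1 ℚ./ m) ≡ 1ℚ
⟦⟧-unit (suc m) = ℚ.toℚᵘ-injective (begin
  ℚ.toℚᵘ (⟦ suc m ⟧ * (ℤ.+ 1 ℚ./ suc m))
    ≈⟨ ℚ.toℚᵘ-homo-* ⟦ suc m ⟧ (ℤ.+ 1 ℚ./ suc m) ⟩
  ℚ.toℚᵘ ⟦ suc m ⟧ ℚᵘ.* ℚ.toℚᵘ (ℤ.+ 1 ℚ./ suc m)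
    ≈⟨ ℚᵘ.*-cong (⟦⟧-toℚᵘ (suc m)) (ℚ.toℚᵘ-fromℚᵘ (mkℚᵘ (ℤ.+ 1) m)) ⟩
  mkℚᵘ (ℤ.+ suc m) 0 ℚᵘ.* mkℚᵘ (ℤ.+ 1) m
    ≈⟨ ℚᵘ.*≡* (trans (ℤ.*-identityʳ _) (trans (ℤ.*-identityʳ (ℤ.+ suc m)) (sym (trans (ℤ.*-identityˡ _) (cong ℤ.+_ (ℕ.*-identityˡ (suc m))))))) ⟩
  ℚᵘ.1ℚᵘ ∎)
  where open ℚᵘ.≃-Reasoning

unit-pos : ∀ m .{{_ : ℕ.NonZero m}} → 0ℚ < ℤ.+ 1 ℚ./ m
unit-pos (suc m) = ℚ.positive⁻¹ _ {{ℚ.normalize-pos 1 (suc m)}}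

unit-antitone : ∀ {a b} → suc a ℕ.≤ b → .{{_ : ℕ.NonZero b}} → ℤ.+ 1 ℚ./ b ≤ ℤ.+ 1 ℚ./ suc a
unit-antitone {a} {b} a≤b = begin
  b⁻¹                       ≡⟨ trans (sym (ℚ.*-identityʳ b⁻¹)) (cong (b⁻¹ *_) (sym (⟦⟧-unit (suc a)))) ⟩
  b⁻¹ * (⟦ suc a ⟧ * a⁻¹)   ≤⟨ *-monoˡ b⁻¹ (ℚ.<⇒≤ (unit-pos b)) (*-monoʳ a⁻¹ (ℚ.<⇒≤ (unit-pos (suc a))) (⟦⟧-mono a≤b)) ⟩
  b⁻¹ * (⟦ b ⟧ * a⁻¹)       ≡⟨ solve 3 (λ x y z → x :* (y :* z) := (y :* x) :* z) refl b⁻¹ ⟦ b ⟧ a⁻¹ ⟩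
  ⟦ b ⟧ * b⁻¹ * a⁻¹         ≡⟨ trans (cong (_* a⁻¹) (⟦⟧-unit b)) (ℚ.*-identityˡ a⁻¹) ⟩
  a⁻¹                       ∎
  where
  open ℚ.≤-Reasoning
  a⁻¹ = ℤ.+ 1 ℚ./ suc a
  b⁻¹ = ℤ.+ 1 ℚ./ b

p/k≤1 : ∀ {p} k .{{_ : ℕ.NonZero k}} → p ≤ 1ℚ → p * (ℤ.+ 1 ℚ./ k) ≤ 1ℚ
p/k≤1 k p≤1 = *-mono (ℚ.<⇒≤ (unit-pos k)) 0≤1 p≤1 (unit-antitone {0} {k} (ℕ.>-nonZero⁻¹ k))

-- Expectation over p-biased random sets

E : ∀ {N} → ℚ → (Subset N → ℚ) → ℚ
E {zero}  p f = f []
E {suc N} p f = p * E p (f ∘ (inside ∷_)) + (1ℚ - p) * E p (f ∘ (outside ∷_))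

E-cong : ∀ {N} p {f g : Subset N → ℚ} → (∀ W → f W ≡ g W) → E p f ≡ E p g
E-cong {zero}  p h = h []
E-cong {suc N} p h = cong₂ (λ x y → p * x + (1ℚ - p) * y) (E-cong p (h ∘ (inside ∷_))) (E-cong p (h ∘ (outside ∷_)))

E-const : ∀ {N} p c → E {N} p (λ _ → c) ≡ c
E-const {zero}  p c = refl
E-const {suc N} p c = trans (cong₂ (λ x y → p * x + (1ℚ - p) * y) (E-const {N} p c) (E-const {N} p c))
  (solve 2 (λ p c → p :* c :+ (con 1ℚ :- p) :* c := c) refl p c)

E-lin : ∀ {N} p a b (f g : Subset N → ℚ) → E p (λ W → a * f W + b * g W) ≡ a * E p f + b * E p g
E-lin {zero}  p a b f g = refl
E-lin {suc N} p a b f g = trans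
  (cong₂ (λ x y → p * x + (1ℚ - p) * y)
    (E-lin p a b (f ∘ (inside ∷_)) (g ∘ (inside ∷_))) (E-lin p a b (f ∘ (outside ∷_)) (g ∘ (outside ∷_))))
  (solve 7 (λ p a b x y z w →
      p :* (a :* x :+ b :* y) :+ (con 1ℚ :- p) :* (a :* z :+ b :* w) :=
      a :* (p :* x :+ (con 1ℚ :- p) :* z) :+ b :* (p :* y :+ (con 1ℚ :- p) :* w)) refl
    p a b (E p (f ∘ (inside ∷_))) (E p (g ∘ (inside ∷_))) (E p (f ∘ (outside ∷_))) (E p (g ∘ (outside ∷_))))

E-+ : ∀ {N} p (f g : Subset N → ℚ) → E p (λ W → f W + g W) ≡ E p f + E p g
E-+ p f g = trans
  (E-cong p (λ W → cong₂ _+_ (sym (ℚ.*-identityˡ (f W))) (sym (ℚ.*-identityˡ (g W)))))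
  (trans (E-lin p 1ℚ 1ℚ f g) (cong₂ _+_ (ℚ.*-identityˡ (E p f)) (ℚ.*-identityˡ (E p g))))

E-* : ∀ {N} p c (f : Subset N → ℚ) → E p (λ W → c * f W) ≡ c * E p f
E-* p c f = trans
  (E-cong p (λ W → solve 2 (λ c x → c :* x := c :* x :+ con 0ℚ :* x) refl c (f W)))
  (trans (E-lin p c 0ℚ f f) (solve 2 (λ c x → c :* x :+ con 0ℚ :* x := c :* x) refl c (E p f)))

module _ {p : ℚ} (0≤p : 0ℚ ≤ p) (p≤1 : p ≤ 1ℚ) where

  E-mono : ∀ {N} {f g : Subset N → ℚ} → (∀ W → f W ≤ g W) → E p f ≤ E p g
  E-mono {zero}  h = h []
  E-mono {suc N} h = ℚ.+-mono-≤
    (*-monoˡ p 0≤p (E-mono (h ∘ (inside ∷_))))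
    (*-monoˡ (1ℚ - p) (0≤q-p p≤1) (E-mono (h ∘ (outside ∷_))))

  E-nonNeg : ∀ {N} {f : Subset N → ℚ} → (∀ W → 0ℚ ≤ f W) → 0ℚ ≤ E p f
  E-nonNeg {N} {f} h = subst (_≤ E p f) (E-const {N} p 0ℚ) (E-mono h)

-- The union of independent p₁- and p₂-biased sets is (1 - (1-p₁)(1-p₂))-biased.
E-union : ∀ {N ρ p₁ p₂} → 0ℚ ≤ ρ → ρ ≤ 1ℚ → 0ℚ ≤ p₁ → p₁ ≤ 1ℚ → 0ℚ ≤ p₂ → p₂ ≤ 1ℚ →
  1ℚ - ρ ≤ (1ℚ - p₁) * (1ℚ - p₂) →
  (f : Subset N → ℚ) → (∀ {S T} → S ⊆ T → f T ≤ f S) →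
  E ρ f ≤ E p₁ (λ W → E p₂ (λ W′ → f (W ∪ W′)))
E-union {zero}  0≤ρ ρ≤1 0≤p₁ p₁≤1 0≤p₂ p₂≤1 h f anti = ℚ.≤-refl
E-union {suc N} {ρ} {p₁} {p₂} 0≤ρ ρ≤1 0≤p₁ p₁≤1 0≤p₂ p₂≤1 h f anti = begin
  ρ * E ρ fᵢ + (1ℚ - ρ) * E ρ fₒ
    ≤⟨ ℚ.+-mono-≤ (*-monoˡ ρ 0≤ρ (ih fᵢ (anti ∘ s⊆s))) (*-monoˡ (1ℚ - ρ) (0≤q-p ρ≤1) (ih fₒ (anti ∘ s⊆s))) ⟩
  ρ * A fᵢ + (1ℚ - ρ) * A fₒ
    -- A vertex avoids both sets with probability (1 - p₁)(1 - p₂) ≥ 1 - ρ, and a decreasing `f` is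
    -- larger when the vertex is missing; the difference of the two sides is the product of these
    -- surpluses.
    ≤⟨ ≤-by (((1ℚ - p₁) * (1ℚ - p₂) - (1ℚ - ρ)) * (A fₒ - A fᵢ))
         (*-nonNeg (0≤q-p h) (0≤q-p Aᵢ≤Aₒ))
         (solve 5 (λ ρ p q x y →
            (ρ :* x :+ (con 1ℚ :- ρ) :* y) :+ ((con 1ℚ :- p) :* (con 1ℚ :- q) :- (con 1ℚ :- ρ)) :* (y :- x) :=
            p :* (q :* x :+ (con 1ℚ :- q) :* x) :+ (con 1ℚ :- p) :* (q :* x :+ (con 1ℚ :- q) :* y)) refl
            ρ p₁ p₂ (A fᵢ) (A fₒ)) ⟩
  p₁ * (p₂ * A fᵢ + (1ℚ - p₂) * A fᵢ) + (1ℚ - p₁) * (p₂ * A fᵢ + (1ℚ - p₂) * A fₒ)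
    ≡⟨ sym (cong₂ (λ x y → p₁ * x + (1ℚ - p₁) * y)
         (E-lin p₁ p₂ (1ℚ - p₂) (λ W → E p₂ (λ W′ → fᵢ (W ∪ W′))) (λ W → E p₂ (λ W′ → fᵢ (W ∪ W′))))
         (E-lin p₁ p₂ (1ℚ - p₂) (λ W → E p₂ (λ W′ → fᵢ (W ∪ W′))) (λ W → E p₂ (λ W′ → fₒ (W ∪ W′))))) ⟩
  E p₁ (λ W → E p₂ (λ W′ → f (W ∪ W′))) ∎
  where
  open ℚ.≤-Reasoning
  fᵢ = f ∘ (inside ∷_)
  fₒ = f ∘ (outside ∷_)
  A : (Subset N → ℚ) → ℚ
  A g = E p₁ (λ W → E p₂ (λ W′ → g (W ∪ W′)))
  Aᵢ≤Aₒ : A fᵢ ≤ A fₒ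
  Aᵢ≤Aₒ = E-mono 0≤p₁ p₁≤1 λ W → E-mono 0≤p₂ p₂≤1 λ W′ → anti (out⊆ {p = W ∪ W′} (λ z → z))
  ih : (g : Subset N → ℚ) → (∀ {S T} → S ⊆ T → g T ≤ g S) → E ρ g ≤ A g
  ih = E-union 0≤ρ ρ≤1 0≤p₁ p₁≤1 0≤p₂ p₂≤1 h

-- Recursion on the same coordinates as `E` lets the change of variables in `E-absorb` be carried
-- out one vertex at a time.
Sub : ∀ {N} → Subset N → (Subset N → ℚ) → ℚ
Sub []            f = f []
Sub (inside ∷ Z)  f = Sub Z (f ∘ (outside ∷_)) + Sub Z (f ∘ (inside ∷_))
Sub (outside ∷ Z) f = Sub Z (f ∘ (outside ∷_))

Sub-cong : ∀ {N} (Z : Subset N) {f g} → (∀ T → f T ≡ g T) → Sub Z f ≡ Sub Z g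
Sub-cong []            h = h []
Sub-cong (inside ∷ Z)  h = cong₂ _+_ (Sub-cong Z (h ∘ (outside ∷_))) (Sub-cong Z (h ∘ (inside ∷_)))
Sub-cong (outside ∷ Z) h = Sub-cong Z (h ∘ (outside ∷_))

Sub-mono : ∀ {N} (Z : Subset N) {f g} → (∀ T → f T ≤ g T) → Sub Z f ≤ Sub Z g
Sub-mono []            h = h []
Sub-mono (inside ∷ Z)  h = ℚ.+-mono-≤ (Sub-mono Z (h ∘ (outside ∷_))) (Sub-mono Z (h ∘ (inside ∷_)))
Sub-mono (outside ∷ Z) h = Sub-mono Z (h ∘ (outside ∷_))

Sub-0 : ∀ {N} (Z : Subset N) → Sub Z (λ _ → 0ℚ) ≡ 0ℚ
Sub-0 []            = refl
Sub-0 (inside ∷ Z)  = cong₂ _+_ (Sub-0 Z) (Sub-0 Z)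
Sub-0 (outside ∷ Z) = Sub-0 Z

Sub-+ : ∀ {N} (Z : Subset N) (f g : Subset N → ℚ) → Sub Z (λ T → f T + g T) ≡ Sub Z f + Sub Z g
Sub-+ []            f g = refl
Sub-+ (outside ∷ Z) f g = Sub-+ Z (f ∘ (outside ∷_)) (g ∘ (outside ∷_))
Sub-+ (inside ∷ Z)  f g = trans
  (cong₂ _+_ (Sub-+ Z (f ∘ (outside ∷_)) (g ∘ (outside ∷_))) (Sub-+ Z (f ∘ (inside ∷_)) (g ∘ (inside ∷_))))
  (solve 4 (λ a b c d → (a :+ b) :+ (c :+ d) := (a :+ c) :+ (b :+ d)) refl
    (Sub Z (f ∘ (outside ∷_))) (Sub Z (g ∘ (outside ∷_))) (Sub Z (f ∘ (inside ∷_))) (Sub Z (g ∘ (inside ∷_))))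

Sub-* : ∀ {N} (Z : Subset N) c (f : Subset N → ℚ) → Sub Z (λ T → c * f T) ≡ c * Sub Z f
Sub-* []            c f = refl
Sub-* (outside ∷ Z) c f = Sub-* Z c (f ∘ (outside ∷_))
Sub-* (inside ∷ Z)  c f = trans
  (cong₂ _+_ (Sub-* Z c (f ∘ (outside ∷_))) (Sub-* Z c (f ∘ (inside ∷_))))
  (sym (ℚ.*-distribˡ-+ c _ _))

Sub-nonNeg : ∀ {N} (Z : Subset N) {f} → (∀ T → 0ℚ ≤ f T) → 0ℚ ≤ Sub Z f
Sub-nonNeg Z {f} h = subst (_≤ Sub Z f) (Sub-0 Z) (Sub-mono Z h)

Sub-nonPos : ∀ {N} (Z : Subset N) {f} → (∀ T → f T ≤ 0ℚ) → Sub Z f ≤ 0ℚ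
Sub-nonPos Z {f} h = subst (Sub Z f ≤_) (Sub-0 Z) (Sub-mono Z h)

Sub-term : ∀ {N} (Z T : Subset N) {f} → (∀ S → 0ℚ ≤ f S) → T ⊆ Z → f T ≤ Sub Z f
Sub-term []            []            h T⊆Z = ℚ.≤-refl
Sub-term (inside ∷ Z)  (inside ∷ T)  h T⊆Z =
  ℚ.≤-trans (Sub-term Z T (h ∘ (inside ∷_)) (drop-∷-⊆ T⊆Z)) (q≤p+q (Sub-nonNeg Z (h ∘ (outside ∷_))))
Sub-term (inside ∷ Z)  (outside ∷ T) h T⊆Z =
  ℚ.≤-trans (Sub-term Z T (h ∘ (outside ∷_)) (drop-∷-⊆ T⊆Z)) (p≤p+q (Sub-nonNeg Z (h ∘ (inside ∷_))))
Sub-term (outside ∷ Z) (outside ∷ T) h T⊆Z = Sub-term Z T (h ∘ (outside ∷_)) (drop-∷-⊆ T⊆Z)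
Sub-term (outside ∷ Z) (inside ∷ T)  h T⊆Z with T⊆Z Vec.here
... | ()

-- Sets `T` outside `e` contribute nothing positive, so the number of relevant terms is governed by
-- `e`, however large `Z` is.
Sub-≤2^ : ∀ {N} (Z e : Subset N) {f c} → 0ℚ ≤ c →
  (∀ T → T ⊆ e → f T ≤ c) → (∀ T → ¬ T ⊆ e → f T ≤ 0ℚ) → Sub Z f ≤ ⟦ 2 ⟧ ^ℚ ∣ e ∣ * c
Sub-≤2^ [] [] {c = c} 0≤c h h′ = ℚ.≤-trans (h [] (λ z → z)) (ℚ.≤-reflexive (sym (ℚ.*-identityˡ c)))
Sub-≤2^ (outside ∷ Z) (s ∷ e) {c = c} 0≤c h h′ = ℚ.≤-trans
  (Sub-≤2^ Z e 0≤c (λ T → h (outside ∷ T) ∘ out⊆) (λ T n → h′ (outside ∷ T) (n ∘ drop-∷-⊆)))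
  (*-monoʳ c 0≤c (^-monoʳ (⟦⟧-mono {1} {2} (ℕ.s≤s ℕ.z≤n)) (∣p∣≤∣x∷p∣ s e)))
Sub-≤2^ (inside ∷ Z) (inside ∷ e) {f} {c} 0≤c h h′ = subst (Sub (inside ∷ Z) f ≤_)
  (solve 2 (λ x c → x :* c :+ x :* c := (con ⟦ 2 ⟧ :* x) :* c) refl (⟦ 2 ⟧ ^ℚ ∣ e ∣) c)
  (ℚ.+-mono-≤
    (Sub-≤2^ Z e 0≤c (λ T → h (outside ∷ T) ∘ out⊆) (λ T n → h′ (outside ∷ T) (n ∘ drop-∷-⊆)))
    (Sub-≤2^ Z e 0≤c (λ T → h (inside ∷ T) ∘ in⊆in) (λ T n → h′ (inside ∷ T) (n ∘ drop-∷-⊆))))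
Sub-≤2^ (inside ∷ Z) (outside ∷ e) {f} {c} 0≤c h h′ = subst (Sub (inside ∷ Z) f ≤_)
  (ℚ.+-identityʳ _)
  (ℚ.+-mono-≤
    (Sub-≤2^ Z e 0≤c (λ T → h (outside ∷ T) ∘ out⊆) (λ T n → h′ (outside ∷ T) (n ∘ drop-∷-⊆)))
    (Sub-nonPos Z (λ T → h′ (inside ∷ T) (λ i → contradiction (i Vec.here) λ ()))))

-- (W , T) ↦ (W ∪ T , T) is injective on disjoint pairs, and adding T to W
-- changes the weight of W by the factor (p / (1 - p)) ^ ∣ T ∣ ≥ p ^ ∣ T ∣.
E-absorb : ∀ {N p} → 0ℚ ≤ p → p ≤ 1ℚ → (g : Subset N → Subset N → ℚ) → (∀ Z T → 0ℚ ≤ g Z T) →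
  E p (λ W → Sub (∁ W) (λ T → p ^ℚ ∣ T ∣ * g (W ∪ T) T)) ≤ E p (λ Z → Sub Z (g Z))
E-absorb {zero}  0≤p p≤1 g 0≤g = ℚ.≤-reflexive (ℚ.*-identityˡ _)
E-absorb {suc N} {p} 0≤p p≤1 g 0≤g = begin
  p * E p (λ W → Sub (∁ W) (λ T → p ^ℚ ∣ T ∣ * a (W ∪ T) T)) +
  (1ℚ - p) * E p (λ W → Sub (∁ W) (λ T → p ^ℚ ∣ T ∣ * b (W ∪ T) T) +
                        Sub (∁ W) (λ T → (p * p ^ℚ ∣ T ∣) * d (W ∪ T) T))
    ≡⟨ cong (λ x → p * L a + (1ℚ - p) * x)
         (trans (E-+ p (λ W → Sub (∁ W) (term b W)) (λ W → Sub (∁ W) (λ T → (p * p ^ℚ ∣ T ∣) * d (W ∪ T) T)))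
           (cong (L b +_) (trans
             (E-cong p (λ W → trans (Sub-cong (∁ W) (λ T → ℚ.*-assoc p (p ^ℚ ∣ T ∣) (d (W ∪ T) T))) (Sub-* (∁ W) p (term d W))))
             (E-* p p (λ W → Sub (∁ W) (term d W)))))) ⟩
  p * L a + (1ℚ - p) * (L b + p * L d)
    -- The first three summands are the induction hypotheses. The last, p² · `R d`, is given away by
    -- using the factor p in place of p / (1 - p), which also keeps p = 1 admissible.
    ≤⟨ ≤-by (p * (R a - L a) + (1ℚ - p) * (R b - L b) + p * (1ℚ - p) * (R d - L d) + p * p * R d)
         (+-nonNeg (+-nonNeg (+-nonNeg
           (*-nonNeg 0≤p (0≤q-p (ih a (λ Z T → 0≤g (inside ∷ Z) (outside ∷ T)))))
           (*-nonNeg 0≤1-p (0≤q-p (ih b (λ Z T → 0≤g (outside ∷ Z) (outside ∷ T))))))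
           (*-nonNeg (*-nonNeg 0≤p 0≤1-p) (0≤q-p (ih d 0≤d))))
           (*-nonNeg (*-nonNeg 0≤p 0≤p) (E-nonNeg 0≤p p≤1 (λ Z → Sub-nonNeg Z (0≤d Z)))))
         (solve 7 (λ p la lb ld ra rb rd →
           (p :* la :+ (con 1ℚ :- p) :* (lb :+ p :* ld)) :+
           (p :* (ra :- la) :+ (con 1ℚ :- p) :* (rb :- lb) :+ p :* (con 1ℚ :- p) :* (rd :- ld) :+ p :* p :* rd) :=
           p :* (ra :+ rd) :+ (con 1ℚ :- p) :* rb) refl
           p (L a) (L b) (L d) (R a) (R b) (R d)) ⟩
  p * (R a + R d) + (1ℚ - p) * R b
    ≡⟨ cong (λ x → p * x + (1ℚ - p) * R b) (sym (E-+ p (λ Z → Sub Z (a Z)) (λ Z → Sub Z (d Z)))) ⟩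
  E p (λ Z → Sub Z (g Z)) ∎
  where
  open ℚ.≤-Reasoning
  0≤1-p = 0≤q-p p≤1
  a b d : Subset N → Subset N → ℚ
  a Z T = g (inside ∷ Z) (outside ∷ T)
  b Z T = g (outside ∷ Z) (outside ∷ T)
  d Z T = g (inside ∷ Z) (inside ∷ T)
  term : (Subset N → Subset N → ℚ) → Subset N → Subset N → ℚ
  term h W T = p ^ℚ ∣ T ∣ * h (W ∪ T) T
  L R : (Subset N → Subset N → ℚ) → ℚ
  L h = E p (λ W → Sub (∁ W) (term h W))
  R h = E p (λ Z → Sub Z (h Z))
  0≤d : ∀ Z T → 0ℚ ≤ d Z T
  0≤d Z T = 0≤g (inside ∷ Z) (inside ∷ T)
  ih : ∀ h → (∀ Z T → 0ℚ ≤ h Z T) → L h ≤ R h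
  ih = E-absorb 0≤p p≤1

-- One round of exposure

𝟙 : ∀ {P : Set} → Dec P → ℚ
𝟙 (yes _) = 1ℚ
𝟙 (no _)  = 0ℚ

𝟙-nonNeg : ∀ {P : Set} (P? : Dec P) → 0ℚ ≤ 𝟙 P?
𝟙-nonNeg (yes _) = 0≤1
𝟙-nonNeg (no _)  = ℚ.≤-refl

𝟙-≤1 : ∀ {P : Set} (P? : Dec P) → 𝟙 P? ≤ 1ℚ
𝟙-≤1 (yes _) = ℚ.≤-refl
𝟙-≤1 (no _)  = 0≤1

𝟙-mono : ∀ {P Q : Set} (P? : Dec P) (Q? : Dec Q) → (P → Q) → 𝟙 P? ≤ 𝟙 Q?
𝟙-mono (yes p) (yes q) f = ℚ.≤-refl
𝟙-mono (yes p) (no ¬q) f = contradiction (f p) ¬q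
𝟙-mono (no ¬p) Q?      f = 𝟙-nonNeg Q?

𝟙-yes : ∀ {P : Set} (P? : Dec P) → P → 𝟙 P? ≡ 1ℚ
𝟙-yes (yes _) p = refl
𝟙-yes (no ¬p) p = contradiction p ¬p

𝟙-no : ∀ {P : Set} (P? : Dec P) → ¬ P → 𝟙 P? ≡ 0ℚ
𝟙-no (yes p) ¬p = contradiction p ¬p
𝟙-no (no _)  ¬p = refl

ΣL : ∀ {A : Set} → List A → (A → ℚ) → ℚ
ΣL []       f = 0ℚ
ΣL (a ∷ as) f = f a + ΣL as f

ΣL-mono : ∀ {A : Set} (as : List A) {f g} → (∀ a → a ∈ᴸ as → f a ≤ g a) → ΣL as f ≤ ΣL as g
ΣL-mono []       h = ℚ.≤-refl
ΣL-mono (a ∷ as) h = ℚ.+-mono-≤ (h a (here refl)) (ΣL-mono as (λ b → h b ∘ there))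

ΣL-* : ∀ {A : Set} (as : List A) c f → ΣL as (λ a → c * f a) ≡ c * ΣL as f
ΣL-* []       c f = sym (ℚ.*-zeroʳ c)
ΣL-* (a ∷ as) c f = trans (cong (c * f a +_) (ΣL-* as c f)) (sym (ℚ.*-distribˡ-+ c (f a) (ΣL as f)))

Sub-ΣL : ∀ {A : Set} {N} (Z : Subset N) (as : List A) (f : Subset N → A → ℚ) →
  Sub Z (λ T → ΣL as (f T)) ≡ ΣL as (λ a → Sub Z (λ T → f T a))
Sub-ΣL Z []       f = Sub-0 Z
Sub-ΣL Z (a ∷ as) f = trans (Sub-+ Z (λ T → f T a) (λ T → ΣL as (f T)))
  (cong (Sub Z (λ T → f T a) +_) (Sub-ΣL Z as f))

deg : ∀ {N} → List (Subset N) → Subset N → ℚ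
deg Es S = ΣL Es (λ e → 𝟙 (S ⊆? e))

fail : ∀ {N} → List (Subset N) → Subset N → ℚ
fail Es W = 𝟙 (¬? (any? (_⊆? W) Es))

length≤deg⊥ : ∀ {N} (Es : List (Subset N)) → ⟦ length Es ⟧ ≤ deg Es ⊥
length≤deg⊥ []       = ℚ.≤-refl
length≤deg⊥ (e ∷ Es) = ℚ.≤-trans (ℚ.≤-reflexive (⟦⟧-+ 1 (length Es)))
  (ℚ.+-mono-≤ (ℚ.≤-reflexive (sym (𝟙-yes (⊥ ⊆? e) (⊆-min e)))) (length≤deg⊥ Es))

fail-antitone : ∀ {N} (Es : List (Subset N)) {S T : Subset N} → S ⊆ T → fail Es T ≤ fail Es S
fail-antitone Es {S} {T} S⊆T = 𝟙-mono (¬? (any? (_⊆? T) Es)) (¬? (any? (_⊆? S) Es))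
  (λ h a → h (Any.map {P = _⊆ S} {Q = _⊆ T} (λ e⊆S {x} x∈e → S⊆T (e⊆S x∈e)) a))

∣p∣≡0⇒p⊆q : ∀ {N} (p q : Subset N) → ∣ p ∣ ≡ 0 → p ⊆ q
∣p∣≡0⇒p⊆q (inside ∷ p)  q       () 
∣p∣≡0⇒p⊆q (outside ∷ p) (_ ∷ q) h (Vec.there x∈p) = Vec.there (∣p∣≡0⇒p⊆q p q h x∈p)

p⊆q∧q⊈p⇒∣p∣<∣q∣ : ∀ {N} (p q : Subset N) → p ⊆ q → ¬ q ⊆ p → ∣ p ∣ ℕ.< ∣ q ∣
p⊆q∧q⊈p⇒∣p∣<∣q∣ []            []            p⊆q q⊈p = contradiction (λ {x} → p⊆q {x}) q⊈p
p⊆q∧q⊈p⇒∣p∣<∣q∣ (inside ∷ p)  (inside ∷ q)  p⊆q q⊈p = ℕ.s≤s (p⊆q∧q⊈p⇒∣p∣<∣q∣ p q (drop-∷-⊆ p⊆q) (q⊈p ∘ s⊆s))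
p⊆q∧q⊈p⇒∣p∣<∣q∣ (inside ∷ p)  (outside ∷ q) p⊆q q⊈p = contradiction (p⊆q Vec.here) λ ()
p⊆q∧q⊈p⇒∣p∣<∣q∣ (outside ∷ p) (inside ∷ q)  p⊆q q⊈p = ℕ.s≤s (p⊆q⇒∣p∣≤∣q∣ (drop-∷-⊆ p⊆q))
p⊆q∧q⊈p⇒∣p∣<∣q∣ (outside ∷ p) (outside ∷ q) p⊆q q⊈p = p⊆q∧q⊈p⇒∣p∣<∣q∣ p q (drop-∷-⊆ p⊆q) (q⊈p ∘ s⊆s)

x∈p─q⇒x∉q : ∀ {N} (p q : Subset N) {x} → x ∈ p ─ q → ¬ x ∈ q
x∈p─q⇒x∉q (_ ∷ p)      (_ ∷ q)       (Vec.there i) (Vec.there j) = x∈p─q⇒x∉q p q i j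
x∈p─q⇒x∉q (_ ∷ p)      (inside ∷ q)  () Vec.here

module _ {N} {p q r : Subset N} where

  p⊆q∪r⇒p─q⊆r : p ⊆ q ∪ r → p ─ q ⊆ r
  p⊆q∪r⇒p─q⊆r h {x} x∈ with x∈p∪q⁻ q r (h (p─q⊆p p q x∈))
  ... | inj₁ x∈q = contradiction x∈q (x∈p─q⇒x∉q p q x∈)
  ... | inj₂ x∈r = x∈r

  p─q⊆r⇒p⊆q∪r : p ─ q ⊆ r → p ⊆ q ∪ r
  p─q⊆r⇒p⊆q∪r h {x} x∈p with x ∈? q
  ... | yes x∈q = x∈p∪q⁺ (inj₁ x∈q)
  ... | no x∉q  = x∈p∪q⁺ (inj₂ (h (x∈p∧x∉q⇒x∈p─q x∈p x∉q)))

module Round {N} (Es : List (Subset N)) (m : ℕ) where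

  Short : Subset N → Subset N → Subset N → Set
  Short W e e′ = e′ ⊆ W ∪ e × ∣ e′ ─ W ∣ ℕ.< m

  short? : ∀ W e → Dec (Any (Short W e) Es)
  short? W e = any? (λ e′ → (e′ ⊆? W ∪ e) ×-dec (∣ e′ ─ W ∣ ℕ.<? m)) Es

  bad : Subset N → Subset N → ℚ
  bad W e = 𝟙 (¬? (short? W e))

  -- Replacements are sought in the full list `Es` while the recursion shortens `es`, hence the
  -- separate argument.
  next : Subset N → List (Subset N) → List (Subset N)
  next W []       = []
  next W (e ∷ es) with short? W e
  ... | yes s = (proj₁ (find s) ─ W) ∷ next W es
  ... | no _  = next W es

  next-length : ∀ W es → ⟦ length (next W es) ⟧ + ΣL es (bad W) ≡ ⟦ length es ⟧
  next-length W []       = refl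
  next-length W (e ∷ es) with short? W e
  ... | yes s = trans (cong (_+ (0ℚ + ΣL es (bad W))) (⟦⟧-+ 1 (length (next W es))))
    (trans (solve 3 (λ a b c → (a :+ b) :+ (con 0ℚ :+ c) := a :+ (b :+ c)) refl ⟦ 1 ⟧ ⟦ length (next W es) ⟧ (ΣL es (bad W)))
      (trans (cong (⟦ 1 ⟧ +_) (next-length W es)) (sym (⟦⟧-+ 1 (length es)))))
  ... | no _  = trans (solve 3 (λ a b c → b :+ (a :+ c) := a :+ (b :+ c)) refl ⟦ 1 ⟧ ⟦ length (next W es) ⟧ (ΣL es (bad W)))
      (trans (cong (⟦ 1 ⟧ +_) (next-length W es)) (sym (⟦⟧-+ 1 (length es))))

  -- A replacement `e′ ─ W` lies inside the edge `e` that it replaces, because e′ ⊆ W ∪ e. So the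
  -- degree bound survives every round with the same `u` and `M`.
  next-deg : ∀ W es S → deg (next W es) S ≤ deg es S
  next-deg W []       S = ℚ.≤-refl
  next-deg W (e ∷ es) S with short? W e
  ... | yes s = ℚ.+-mono-≤
    (𝟙-mono (S ⊆? (proj₁ (find s) ─ W)) (S ⊆? e)
      (λ S⊆ {x} x∈S → p⊆q∪r⇒p─q⊆r {q = W} (proj₁ (proj₂ (proj₂ (find s)))) (S⊆ x∈S)))
    (next-deg W es S)
  ... | no _  = ℚ.≤-trans (next-deg W es S) (q≤p+q (𝟙-nonNeg (S ⊆? e)))

  next-small : ∀ W es → All (λ e → ∣ e ∣ ℕ.< m) (next W es)
  next-small W []       = []
  next-small W (e ∷ es) with short? W e
  ... | yes s = proj₂ (proj₂ (proj₂ (find s))) ∷ next-small W es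
  ... | no _  = next-small W es

  next-covers : ∀ W W′ es → Any (_⊆ W′) (next W es) → Any (_⊆ W ∪ W′) Es
  next-covers W W′ (e ∷ es) a with short? W e
  next-covers W W′ (e ∷ es) (here h)  | yes s = lose (proj₁ (proj₂ (find s))) (p─q⊆r⇒p⊆q∪r h)
  next-covers W W′ (e ∷ es) (there a) | yes s = next-covers W W′ es a
  next-covers W W′ (e ∷ es) a         | no _  = next-covers W W′ es a

  next-fail : ∀ W W′ → fail Es (W ∪ W′) ≤ fail (next W Es) W′
  next-fail W W′ = 𝟙-mono (¬? (any? (_⊆? W ∪ W′) Es)) (¬? (any? (_⊆? W′) (next W Es)))
    (λ h a → h (next-covers W W′ Es a))

  -- T is recognisable from Z = W ∪ T as a subset of any edge inside Z.
  Fragment : Subset N → Subset N → Set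
  Fragment Z T = m ℕ.≤ ∣ T ∣ × Any (_⊆ Z) Es × All (λ e → e ⊆ Z → T ⊆ e) Es

  fragment? : ∀ Z T → Dec (Fragment Z T)
  fragment? Z T = (m ℕ.≤? ∣ T ∣) ×-dec any? (_⊆? Z) Es ×-dec all? (λ e → (e ⊆? Z) →-dec (T ⊆? e)) Es

  -- Descent on ∣ e′ ─ W ∣, started at e′ = e: an edge e″ ⊆ W ∪ (e′ ─ W) that does not contain
  -- `e′ ─ W` has a strictly smaller `e″ ─ W` and still lies in W ∪ e. When there is none, T =
  -- `e′ ─ W` is a fragment; it has at least m elements because no edge is `Short` for `e`. `fuel`
  -- bounds the length of the descent.
  minimal-fragment : ∀ W e → ¬ Any (Short W e) Es → ∀ fuel e′ → e′ ∈ᴸ Es → e′ ⊆ W ∪ e → ∣ e′ ─ W ∣ ℕ.≤ fuel →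
    ∃[ T ] (T ⊆ ∁ W × T ⊆ e × Fragment (W ∪ T) T)
  minimal-fragment W e bad fuel e′ e′∈Es e′⊆ h
    with all? (λ e″ → (e″ ⊆? W ∪ (e′ ─ W)) →-dec ((e′ ─ W) ⊆? e″)) Es
  ... | yes all = e′ ─ W , (λ x∈ → x∉p⇒x∈∁p (x∈p─q⇒x∉q e′ W x∈)) , p⊆q∪r⇒p─q⊆r e′⊆ ,
    ℕ.≮⇒≥ (λ lt → bad (lose e′∈Es (e′⊆ , lt))) , lose e′∈Es (p─q⊆r⇒p⊆q∪r id) , all
  ... | no ¬all with find (¬All⇒Any¬ (λ e″ → (e″ ⊆? W ∪ (e′ ─ W)) →-dec ((e′ ─ W) ⊆? e″)) Es ¬all)
  ... | e″ , e″∈Es , ¬imp with e″ ⊆? W ∪ (e′ ─ W)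
  ... | no e″⊈  = contradiction (λ i {x} → contradiction (λ {y} → i {y}) e″⊈) ¬imp
  ... | yes e″⊆ = descend fuel h
    where
    smaller : ∣ e″ ─ W ∣ ℕ.< ∣ e′ ─ W ∣
    smaller = p⊆q∧q⊈p⇒∣p∣<∣q∣ (e″ ─ W) (e′ ─ W) (p⊆q∪r⇒p─q⊆r e″⊆)
      (λ i → ¬imp (λ _ {x} x∈ → p─q⊆p e″ W (i x∈)))
    e″⊆W∪e : e″ ⊆ W ∪ e
    e″⊆W∪e = p─q⊆r⇒p⊆q∪r {q = W} λ {x} x∈ → p⊆q∪r⇒p─q⊆r {q = W} e′⊆ (p⊆q∪r⇒p─q⊆r {q = W} e″⊆ x∈)
    descend : ∀ fuel → ∣ e′ ─ W ∣ ℕ.≤ fuel → ∃[ T ] (T ⊆ ∁ W × T ⊆ e × Fragment (W ∪ T) T)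
    descend zero    h = contradiction (ℕ.<-≤-trans smaller h) λ ()
    descend (suc f) h = minimal-fragment W e bad f e″ e″∈Es e″⊆W∪e (ℕ.≤-pred (ℕ.<-≤-trans smaller h))

module _ {N} (Es : List (Subset N)) (m : ℕ) {p x u M : ℚ}
  (0≤p : 0ℚ ≤ p) (p≤1 : p ≤ 1ℚ) (0≤x : 0ℚ ≤ x) (x≤1 : x ≤ 1ℚ) (u≡xp : u ≡ x * p) (0≤M : 0ℚ ≤ M)
  (spread : ∀ S → deg Es S ≤ u ^ℚ ∣ S ∣ * M) (small : All (λ e → ∣ e ∣ ℕ.≤ m ℕ.+ m) Es) where

  open Round Es m

  private
    -- The degree bound u ^ ∣ T ∣ is split as p ^ ∣ T ∣ · x ^ ∣ T ∣ with x = u / p. The first factor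
    -- is consumed by `E-absorb` in passing from W to W ∪ T; the second is what remains.
    weight : Subset N → Subset N → ℚ
    weight Z T = 𝟙 (fragment? Z T) * x ^ℚ ∣ T ∣

    weight-nonNeg : ∀ Z T → 0ℚ ≤ weight Z T
    weight-nonNeg Z T = *-nonNeg (𝟙-nonNeg (fragment? Z T)) (^-nonNeg 0≤x ∣ T ∣)

    -- Each lost edge is charged to one fragment that it contains, and a fragment `T` receives at
    -- most `deg Es T` charges.
    bad-count : ∀ W → ΣL Es (bad W) ≤ Sub (∁ W) (λ T → 𝟙 (fragment? (W ∪ T) T) * deg Es T)
    bad-count W = ℚ.≤-trans (ΣL-mono Es charge) (ℚ.≤-reflexive (sym (trans
      (Sub-cong (∁ W) (λ T → sym (ΣL-* Es (𝟙 (fragment? (W ∪ T) T)) (λ e → 𝟙 (T ⊆? e)))))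
      (Sub-ΣL (∁ W) Es f))))
      where
      f : Subset N → Subset N → ℚ
      f T e = 𝟙 (fragment? (W ∪ T) T) * 𝟙 (T ⊆? e)
      0≤f : ∀ e T → 0ℚ ≤ f T e
      0≤f e T = *-nonNeg (𝟙-nonNeg (fragment? (W ∪ T) T)) (𝟙-nonNeg (T ⊆? e))
      charge : ∀ e → e ∈ᴸ Es → bad W e ≤ Sub (∁ W) (λ T → f T e)
      charge e e∈Es with short? W e
      ... | yes _ = Sub-nonNeg (∁ W) (0≤f e)
      ... | no ¬s with minimal-fragment W e ¬s ∣ e ─ W ∣ e e∈Es (q⊆p∪q W e) ℕ.≤-refl
      ... | T , T⊆∁W , T⊆e , frag = ℚ.≤-trans
        (ℚ.≤-reflexive (sym (cong₂ _*_ (𝟙-yes (fragment? (W ∪ T) T) frag) (𝟙-yes (T ⊆? e) T⊆e))))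
        (Sub-term (∁ W) T (0≤f e) T⊆∁W)

    bad-weight : ∀ W → ΣL Es (bad W) ≤ M * Sub (∁ W) (λ T → p ^ℚ ∣ T ∣ * weight (W ∪ T) T)
    bad-weight W = ℚ.≤-trans (bad-count W) (ℚ.≤-trans
      (Sub-mono (∁ W) (λ T → *-monoˡ (𝟙 (fragment? (W ∪ T) T)) (𝟙-nonNeg (fragment? (W ∪ T) T)) (spread T)))
      (ℚ.≤-reflexive (trans (Sub-cong (∁ W) eq) (Sub-* (∁ W) M (λ T → p ^ℚ ∣ T ∣ * weight (W ∪ T) T)))))
      where
      eq : ∀ T → 𝟙 (fragment? (W ∪ T) T) * (u ^ℚ ∣ T ∣ * M) ≡ M * (p ^ℚ ∣ T ∣ * weight (W ∪ T) T)
      eq T = trans (cong (λ t → 𝟙 (fragment? (W ∪ T) T) * (t * M)) (trans (cong (_^ℚ ∣ T ∣) u≡xp) (^-distrib-* x p ∣ T ∣)))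
        (solve 4 (λ i a b M → i :* ((a :* b) :* M) := M :* (b :* (i :* a))) refl
          (𝟙 (fragment? (W ∪ T) T)) (x ^ℚ ∣ T ∣) (p ^ℚ ∣ T ∣) M)

    -- If `Z` contains no edge, there is no fragment. Otherwise any one edge inside `Z` contains all
    -- fragments, and x ≤ 1 makes the least admissible size m the worst.
    total-weight : ∀ Z → Dec (Any (_⊆ Z) Es) → Sub Z (weight Z) ≤ (⟦ 4 ⟧ * x) ^ℚ m
    total-weight Z (no ¬a) = ℚ.≤-trans (Sub-nonPos Z (λ T → ℚ.≤-reflexive (trans
        (cong (_* x ^ℚ ∣ T ∣) (𝟙-no (fragment? Z T) (¬a ∘ proj₁ ∘ proj₂))) (ℚ.*-zeroˡ (x ^ℚ ∣ T ∣)))))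
      (^-nonNeg (*-nonNeg (⟦⟧-nonNeg 4) 0≤x) m)
    total-weight Z (yes a) with find a
    ... | e , e∈Es , e⊆Z = begin
      Sub Z (weight Z)            ≤⟨ Sub-≤2^ Z e (^-nonNeg 0≤x m) below outside-e ⟩
      ⟦ 2 ⟧ ^ℚ ∣ e ∣ * x ^ℚ m     ≤⟨ *-monoʳ (x ^ℚ m) (^-nonNeg 0≤x m) (^-monoʳ (⟦⟧-mono {1} {2} (ℕ.s≤s ℕ.z≤n)) (All.lookup small e∈Es)) ⟩
      ⟦ 2 ⟧ ^ℚ (m ℕ.+ m) * x ^ℚ m ≡⟨ cong (_* x ^ℚ m) (trans (^-+ ⟦ 2 ⟧ m m) (sym (^-distrib-* ⟦ 2 ⟧ ⟦ 2 ⟧ m))) ⟩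
      ⟦ 4 ⟧ ^ℚ m * x ^ℚ m         ≡⟨ sym (^-distrib-* ⟦ 4 ⟧ x m) ⟩
      (⟦ 4 ⟧ * x) ^ℚ m            ∎
      where
      open ℚ.≤-Reasoning
      below : ∀ T → T ⊆ e → weight Z T ≤ x ^ℚ m
      below T _ with fragment? Z T
      ... | yes (m≤ , _) = ℚ.≤-trans (ℚ.≤-reflexive (ℚ.*-identityˡ (x ^ℚ ∣ T ∣))) (^-antitone 0≤x x≤1 m≤)
      ... | no _         = ℚ.≤-trans (ℚ.≤-reflexive (ℚ.*-zeroˡ (x ^ℚ ∣ T ∣))) (^-nonNeg 0≤x m)
      outside-e : ∀ T → ¬ T ⊆ e → weight Z T ≤ 0ℚ
      outside-e T T⊈e = ℚ.≤-reflexive (trans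
        (cong (_* x ^ℚ ∣ T ∣) (𝟙-no (fragment? Z T) (λ (_ , _ , all) → T⊈e (λ {y} → All.lookup all e∈Es e⊆Z {y}))))
        (ℚ.*-zeroˡ (x ^ℚ ∣ T ∣)))

  expected-loss : E p (λ W → ΣL Es (bad W)) ≤ M * (⟦ 4 ⟧ * x) ^ℚ m
  expected-loss = begin
    E p (λ W → ΣL Es (bad W))
      ≤⟨ E-mono 0≤p p≤1 bad-weight ⟩
    E p (λ W → M * Sub (∁ W) (λ T → p ^ℚ ∣ T ∣ * weight (W ∪ T) T))
      ≡⟨ E-* p M (λ W → Sub (∁ W) (λ T → p ^ℚ ∣ T ∣ * weight (W ∪ T) T)) ⟩
    M * E p (λ W → Sub (∁ W) (λ T → p ^ℚ ∣ T ∣ * weight (W ∪ T) T))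
      ≤⟨ *-monoˡ M 0≤M (E-absorb 0≤p p≤1 weight weight-nonNeg) ⟩
    M * E p (λ Z → Sub Z (weight Z))
      ≤⟨ *-monoˡ M 0≤M (E-mono 0≤p p≤1 (λ Z → total-weight Z (any? (_⊆? Z) Es))) ⟩
    M * E {N} p (λ _ → (⟦ 4 ⟧ * x) ^ℚ m)
      ≡⟨ cong (M *_) (E-const {N} p ((⟦ 4 ⟧ * x) ^ℚ m)) ⟩
    M * (⟦ 4 ⟧ * x) ^ℚ m ∎
    where open ℚ.≤-Reasoning

-- Iterating the rounds

Σ< : (ℕ → ℚ) → ℕ → ℚ
Σ< f zero    = 0ℚ
Σ< f (suc n) = Σ< f n + f n

Σ<-nonNeg : ∀ {f} → (∀ n → 0ℚ ≤ f n) → ∀ n → 0ℚ ≤ Σ< f n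
Σ<-nonNeg h zero    = ℚ.≤-refl
Σ<-nonNeg h (suc n) = +-nonNeg (Σ<-nonNeg h n) (h n)

module _ {u : ℚ} (p x η : ℕ → ℚ)
  (0≤p : ∀ j → 0ℚ ≤ p j) (0≤x : ∀ j → 0ℚ ≤ x j) (x≤1 : ∀ j → x j ≤ 1ℚ) (u≡xp : ∀ j → u ≡ x j * p j)
  (loss : ∀ j → (⟦ 4 ⟧ * x j) ^ℚ (2 ℕ.^ j) ≤ η j) where

  -- `M` stands for the number of edges at the start and stays fixed while `Es` shrinks, so M -
  -- `length Es` is the number of edges lost so far. Each lost edge costs at most 1 / M of failure
  -- probability, and round j loses at most M · `η j` edges in expectation. Rounds run from j - 1
  -- down to 0; a surplus of ρ over the sum of the densities is harmless.
  fail-bound : ∀ {N} j {ρ M} → Σ< p j ≤ ρ → ρ ≤ 1ℚ → 0ℚ ≤ M → (Es : List (Subset N)) →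
    All (λ e → ∣ e ∣ ℕ.< 2 ℕ.^ j) Es → (∀ S → deg Es S ≤ u ^ℚ ∣ S ∣ * M) →
    M * E ρ (fail Es) ≤ (M - ⟦ length Es ⟧) + M * Σ< η j
  -- After the last round only empty edges can remain. Failure is then certain if the list is empty,
  -- matching a loss of all `M` edges, and impossible otherwise.
  fail-bound {N} zero {ρ} {M} _ _ _ [] _ _ = ℚ.≤-reflexive (trans (cong (M *_) (E-const {N} ρ 1ℚ))
    (solve 1 (λ M → M :* con 1ℚ := (M :- con 0ℚ) :+ M :* con 0ℚ) refl M))
  fail-bound {N} zero {ρ} {M} _ _ _ Es@(e ∷ _) (∣e∣<1 ∷ _) spread = begin
    M * E ρ (fail Es)
      ≡⟨ cong (M *_) (trans (E-cong ρ (λ W → 𝟙-no (¬? (any? (_⊆? W) Es)) (λ h → h (here (∣p∣≡0⇒p⊆q e W (ℕ.n<1⇒n≡0 ∣e∣<1))))))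
          (E-const {N} ρ 0ℚ)) ⟩
    M * 0ℚ
      ≤⟨ ≤-by (M - ⟦ length Es ⟧) (0≤q-p len≤M)
          (solve 2 (λ M l → M :* con 0ℚ :+ (M :- l) := (M :- l) :+ M :* con 0ℚ) refl M ⟦ length Es ⟧) ⟩
    (M - ⟦ length Es ⟧) + M * 0ℚ ∎
    where
    open ℚ.≤-Reasoning
    len≤M : ⟦ length Es ⟧ ≤ M
    len≤M = ℚ.≤-trans (length≤deg⊥ Es) (ℚ.≤-trans (spread ⊥)
      (ℚ.≤-reflexive (trans (cong (λ s → u ^ℚ s * M) (∣⊥∣≡0 N)) (ℚ.*-identityˡ M))))
  fail-bound {N} (suc j) {ρ} {M} Σp≤ρ ρ≤1 0≤M Es small spread = begin
    M * E ρ (fail Es)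
      ≤⟨ *-monoˡ M 0≤M (E-union 0≤ρ ρ≤1 (0≤p j) pj≤1 0≤ρ′ ρ′≤1 union (fail Es) (fail-antitone Es)) ⟩
    M * E (p j) (λ W → E ρ′ (λ W′ → fail Es (W ∪ W′)))
      ≤⟨ *-monoˡ M 0≤M (E-mono (0≤p j) pj≤1 (λ W → E-mono 0≤ρ′ ρ′≤1 (next-fail W))) ⟩
    M * E (p j) (λ W → E ρ′ (fail (next W Es)))
      ≡⟨ sym (E-* (p j) M (λ W → E ρ′ (fail (next W Es)))) ⟩
    E (p j) (λ W → M * E ρ′ (fail (next W Es)))
      -- The induction hypothesis is affine in the number of edges left, so only the expected loss
      -- of this round enters.
      ≤⟨ E-mono (0≤p j) pj≤1 (λ W → ℚ.≤-trans
           (fail-bound j ℚ.≤-refl ρ′≤1 0≤M (next W Es) (next-small W Es)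
             (λ S → ℚ.≤-trans (next-deg W Es S) (spread S)))
           (ℚ.≤-reflexive (length-eq W))) ⟩
    E (p j) (λ W → ΣL Es (bad W) + c)
      ≡⟨ trans (E-+ (p j) (λ W → ΣL Es (bad W)) (λ _ → c)) (cong (E (p j) (λ W → ΣL Es (bad W)) +_) (E-const {N} (p j) c)) ⟩
    E (p j) (λ W → ΣL Es (bad W)) + c
      ≤⟨ ℚ.+-monoˡ-≤ c (ℚ.≤-trans
           (expected-loss Es (2 ℕ.^ j) (0≤p j) pj≤1 (0≤x j) (x≤1 j) (u≡xp j) 0≤M spread
             (All.map (λ {e} lt → subst (∣ e ∣ ℕ.≤_) (cong (2 ℕ.^ j ℕ.+_) (ℕ.+-identityʳ (2 ℕ.^ j))) (ℕ.<⇒≤ lt)) small))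
           (*-monoˡ M 0≤M (loss j))) ⟩
    M * η j + c
      ≡⟨ solve 4 (λ M l s t → M :* t :+ ((M :- l) :+ M :* s) := (M :- l) :+ M :* (s :+ t)) refl M ⟦ length Es ⟧ (Σ< η j) (η j) ⟩
    (M - ⟦ length Es ⟧) + M * Σ< η (suc j) ∎
    where
    open ℚ.≤-Reasoning
    open Round Es (2 ℕ.^ j)
    ρ′ = Σ< p j
    c = (M - ⟦ length Es ⟧) + M * Σ< η j
    0≤ρ′ = Σ<-nonNeg 0≤p j
    0≤ρ = ℚ.≤-trans (Σ<-nonNeg 0≤p (suc j)) Σp≤ρ
    ρ′≤1 = ℚ.≤-trans (ℚ.≤-trans (p≤p+q (0≤p j)) Σp≤ρ) ρ≤1
    pj≤1 = ℚ.≤-trans (ℚ.≤-trans (q≤p+q 0≤ρ′) Σp≤ρ) ρ≤1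
    union : 1ℚ - ρ ≤ (1ℚ - p j) * (1ℚ - ρ′)
    union = ≤-by ((ρ - (ρ′ + p j)) + p j * ρ′) (+-nonNeg (0≤q-p Σp≤ρ) (*-nonNeg (0≤p j) 0≤ρ′))
      (solve 3 (λ ρ r p → (con 1ℚ :- ρ) :+ ((ρ :- (r :+ p)) :+ p :* r) := (con 1ℚ :- p) :* (con 1ℚ :- r)) refl ρ ρ′ (p j))
    length-eq : ∀ W → (M - ⟦ length (next W Es) ⟧) + M * Σ< η j ≡ ΣL Es (bad W) + c
    length-eq W = trans
      (solve 4 (λ M l s b → (M :- l) :+ s := b :+ ((M :- (l :+ b)) :+ s)) refl
        M ⟦ length (next W Es) ⟧ (M * Σ< η j) (ΣL Es (bad W)))
      (cong (λ l → ΣL Es (bad W) + ((M - l) + M * Σ< η j)) (next-length W Es))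

-- The spread lemma

inverse : ∀ q → 0ℚ < q → ∃[ r ] (0ℚ < r × r * q ≡ 1ℚ)
inverse q 0<q = (ℚ.1/ q) , ℚ.positive⁻¹ (ℚ.1/ q) {{ℚ.1/pos⇒pos q}} , ℚ.*-inverseˡ q
  where
  instance
    q⁺  = ℚ.positive 0<q
    q≢0 = ℚ.pos⇒nonZero q

bernoulli-≤ : ∀ {a} → 0ℚ ≤ a → ∀ m → 1ℚ + ⟦ m ⟧ * a ≤ (1ℚ + a) ^ℚ m
bernoulli-≤ {a} 0≤a zero    = ℚ.≤-reflexive (solve 1 (λ a → con 1ℚ :+ con 0ℚ :* a := con 1ℚ) refl a)
bernoulli-≤ {a} 0≤a (suc m) = ℚ.≤-trans
  (≤-by (⟦ m ⟧ * (a * a)) (*-nonNeg (⟦⟧-nonNeg m) (*-nonNeg 0≤a 0≤a)) (trans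
    (cong (λ t → 1ℚ + t * a + ⟦ m ⟧ * (a * a)) (⟦⟧-+ 1 m))
    (solve 2 (λ a m → (con 1ℚ :+ (con 1ℚ :+ m) :* a) :+ m :* (a :* a) := (con 1ℚ :+ a) :* (con 1ℚ :+ m :* a)) refl a ⟦ m ⟧)))
  (*-monoˡ (1ℚ + a) (+-nonNeg 0≤1 0≤a) (bernoulli-≤ 0≤a m))

1+n≤2^n : ∀ n → suc n ℕ.≤ 2 ℕ.^ n
1+n≤2^n zero    = ℕ.≤-refl
1+n≤2^n (suc n) = ℕ.≤-trans (ℕ.s≤s (1+n≤2^n n)) (ℕ.+-mono-≤ (ℕ.m^n>0 2 n) (ℕ.m≤m+n (2 ℕ.^ n) 0))

½ : ℚ
½ = ℤ.+ 1 ℚ./ 2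

0≤½ : 0ℚ ≤ ½
0≤½ = ℚ.nonNegative⁻¹ ½

½≤1 : ½ ≤ 1ℚ
½≤1 = ≤-by ½ 0≤½ refl

-- Round j has density 8 u (1 + L / 2 ^ j): the densities add up to at most 24 L u, while by
-- Bernoulli's inequality the losses (1 / (2 (1 + L / 2 ^ j))) ^ (2 ^ j) add up to at most 1 / (1 + L).
module Rounds (L : ℕ) {u : ℚ} (0≤u : 0ℚ ≤ u) where

  private
    a y p x η : ℕ → ℚ
    v : ℚ
    0≤a : ∀ j → 0ℚ ≤ a j
    0<1+a : ∀ j → 0ℚ < 1ℚ + a j

    a j = ⟦ L ⟧ * ½ ^ℚ j
    0≤a j = *-nonNeg (⟦⟧-nonNeg L) (^-nonNeg 0≤½ j)
    0<1+a j = ℚ.<-≤-trans (ℚ.positive⁻¹ 1ℚ) (p≤p+q (0≤a j))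
    y j = proj₁ (inverse (1ℚ + a j) (0<1+a j))
    -- 8 = 4 · 2: the 4 cancels the one in `expected-loss`, and the 2 leaves a factor ½ that makes
    -- the losses summable over j.
    x j = (ℤ.+ 1 ℚ./ 8) * y j
    p j = ⟦ 8 ⟧ * u * (1ℚ + a j)
    v = ℤ.+ 1 ℚ./ suc L
    η j = ½ ^ℚ suc j * v

    0≤y : ∀ j → 0ℚ ≤ y j
    0≤y j = ℚ.<⇒≤ (proj₁ (proj₂ (inverse (1ℚ + a j) (0<1+a j))))

    y-inv : ∀ j → y j * (1ℚ + a j) ≡ 1ℚ
    y-inv j = proj₂ (proj₂ (inverse (1ℚ + a j) (0<1+a j)))

    0≤v : 0ℚ ≤ v
    0≤v = ℚ.<⇒≤ (unit-pos (suc L))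

    0≤x : ∀ j → 0ℚ ≤ x j
    0≤x j = *-nonNeg (ℚ.nonNegative⁻¹ (ℤ.+ 1 ℚ./ 8)) (0≤y j)

    y≤1 : ∀ j → y j ≤ 1ℚ
    y≤1 j = ≤-by (y j * a j) (*-nonNeg (0≤y j) (0≤a j))
      (trans (solve 2 (λ y a → y :+ y :* a := y :* (con 1ℚ :+ a)) refl (y j) (a j)) (y-inv j))

    x≤1 : ∀ j → x j ≤ 1ℚ
    x≤1 j = *-mono (0≤y j) 0≤1 (≤-by (ℤ.+ 7 ℚ./ 8) (ℚ.nonNegative⁻¹ (ℤ.+ 7 ℚ./ 8)) refl) (y≤1 j)

    0≤p : ∀ j → 0ℚ ≤ p j
    0≤p j = *-nonNeg (*-nonNeg (⟦⟧-nonNeg 8) 0≤u) (ℚ.<⇒≤ (0<1+a j))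

    u≡xp : ∀ j → u ≡ x j * p j
    u≡xp j = sym (trans
      (solve 3 (λ y u a → (con (ℤ.+ 1 ℚ./ 8) :* y) :* (con ⟦ 8 ⟧ :* u :* a) := u :* (y :* a)) refl (y j) u (1ℚ + a j))
      (trans (cong (u *_) (y-inv j)) (ℚ.*-identityʳ u)))

    2^*½^ : ∀ j → ⟦ 2 ℕ.^ j ⟧ * ½ ^ℚ j ≡ 1ℚ
    2^*½^ j = trans (cong (_* ½ ^ℚ j) (⟦⟧-^ 2 j)) (trans (sym (^-distrib-* ⟦ 2 ⟧ ½ j)) (1^n≡1 j))

    -- (1 + L / 2 ^ j) ^ (2 ^ j) ≥ 1 + L: the surplus is inverse to the exponent of its round, so
    -- every round gains the same factor 1 + L.
    y^≤v : ∀ j → y j ^ℚ (2 ℕ.^ j) ≤ v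
    y^≤v j = begin
      Y                                   ≡⟨ sym (ℚ.*-identityʳ Y) ⟩
      Y * 1ℚ                              ≡⟨ cong (Y *_) (sym (⟦⟧-unit (suc L))) ⟩
      Y * (⟦ suc L ⟧ * v)                 ≡⟨ cong (λ t → Y * (t * v)) 1+L ⟩
      Y * ((1ℚ + ⟦ m ⟧ * a j) * v)        ≤⟨ *-monoˡ Y (^-nonNeg (0≤y j) m) (*-monoʳ v 0≤v (bernoulli-≤ (0≤a j) m)) ⟩
      Y * ((1ℚ + a j) ^ℚ m * v)           ≡⟨ sym (ℚ.*-assoc Y ((1ℚ + a j) ^ℚ m) v) ⟩
      Y * (1ℚ + a j) ^ℚ m * v             ≡⟨ cong (_* v) (sym (^-distrib-* (y j) (1ℚ + a j) m)) ⟩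
      (y j * (1ℚ + a j)) ^ℚ m * v         ≤⟨ *-monoʳ v 0≤v (^-≤1 (*-nonNeg (0≤y j) (ℚ.<⇒≤ (0<1+a j))) (ℚ.≤-reflexive (y-inv j)) m) ⟩
      1ℚ * v                              ≡⟨ ℚ.*-identityˡ v ⟩
      v                                   ∎
      where
      open ℚ.≤-Reasoning
      m = 2 ℕ.^ j
      Y = y j ^ℚ m
      1+L : ⟦ suc L ⟧ ≡ 1ℚ + ⟦ m ⟧ * a j
      1+L = trans (⟦⟧-+ 1 L) (cong (1ℚ +_) (sym (trans
        (solve 3 (λ m l h → m :* (l :* h) := l :* (m :* h)) refl ⟦ m ⟧ ⟦ L ⟧ (½ ^ℚ j))
        (trans (cong (⟦ L ⟧ *_) (2^*½^ j)) (ℚ.*-identityʳ ⟦ L ⟧)))))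

    loss : ∀ j → (⟦ 4 ⟧ * x j) ^ℚ (2 ℕ.^ j) ≤ η j
    loss j = ℚ.≤-trans
      (ℚ.≤-reflexive (trans
        (cong (_^ℚ (2 ℕ.^ j)) (solve 1 (λ y → con ⟦ 4 ⟧ :* (con (ℤ.+ 1 ℚ./ 8) :* y) := con ½ :* y) refl (y j)))
        (^-distrib-* ½ (y j) (2 ℕ.^ j))))
      (*-mono (^-nonNeg (0≤y j) (2 ℕ.^ j)) (^-nonNeg 0≤½ (suc j)) (^-antitone 0≤½ ½≤1 (1+n≤2^n j)) (y^≤v j))

    Ση : ∀ n → Σ< η n ≡ (1ℚ - ½ ^ℚ n) * v
    Ση zero    = sym (ℚ.*-zeroˡ v)
    Ση (suc n) = trans (cong (_+ η n) (Ση n))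
      (solve 2 (λ h v → (con 1ℚ :- h) :* v :+ (con ½ :* h) :* v := (con 1ℚ :- con ½ :* h) :* v) refl (½ ^ℚ n) v)

    Ση≤v : Σ< η L ≤ v
    Ση≤v = ≤-by (½ ^ℚ L * v) (*-nonNeg (^-nonNeg 0≤½ L) 0≤v) (trans (cong (_+ ½ ^ℚ L * v) (Ση L))
      (solve 2 (λ h v → (con 1ℚ :- h) :* v :+ h :* v := v) refl (½ ^ℚ L) v))

    Σp : ∀ n → Σ< p n ≡ ⟦ 8 ⟧ * u * (⟦ n ⟧ + ⟦ 2 ⟧ * ⟦ L ⟧ * (1ℚ - ½ ^ℚ n))
    Σp zero    = solve 2 (λ u L → con 0ℚ := con ⟦ 8 ⟧ :* u :* (con 0ℚ :+ con ⟦ 2 ⟧ :* L :* (con 1ℚ :- con 1ℚ))) refl u ⟦ L ⟧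
    Σp (suc n) = trans (cong (_+ p n) (Σp n)) (trans
      (solve 4 (λ u L n h →
        con ⟦ 8 ⟧ :* u :* (n :+ con ⟦ 2 ⟧ :* L :* (con 1ℚ :- h)) :+ con ⟦ 8 ⟧ :* u :* (con 1ℚ :+ L :* h) :=
        con ⟦ 8 ⟧ :* u :* ((con 1ℚ :+ n) :+ con ⟦ 2 ⟧ :* L :* (con 1ℚ :- con ½ :* h))) refl u ⟦ L ⟧ ⟦ n ⟧ (½ ^ℚ n))
      (cong (λ t → ⟦ 8 ⟧ * u * (t + ⟦ 2 ⟧ * ⟦ L ⟧ * (1ℚ - ½ ^ℚ suc n))) (sym (⟦⟧-+ 1 n))))

    -- 24 = 8 · (1 + 2): the constant parts of the L densities add up to L, the geometric surpluses
    -- to at most 2 L.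
    Σp≤ : Σ< p L ≤ ⟦ 24 ⟧ * ⟦ L ⟧ * u
    Σp≤ = ≤-by (⟦ 16 ⟧ * (⟦ L ⟧ * u) * ½ ^ℚ L)
      (*-nonNeg (*-nonNeg (⟦⟧-nonNeg 16) (*-nonNeg (⟦⟧-nonNeg L) 0≤u)) (^-nonNeg 0≤½ L))
      (trans (cong (_+ ⟦ 16 ⟧ * (⟦ L ⟧ * u) * ½ ^ℚ L) (Σp L))
        (solve 3 (λ u L h → con ⟦ 8 ⟧ :* u :* (L :+ con ⟦ 2 ⟧ :* L :* (con 1ℚ :- h)) :+ con ⟦ 16 ⟧ :* (L :* u) :* h :=
          con ⟦ 24 ⟧ :* L :* u) refl u ⟦ L ⟧ (½ ^ℚ L)))

  spread⇒fail≤ : ∀ {N ρ} → ⟦ 24 ⟧ * ⟦ L ⟧ * u ≤ ρ → ρ ≤ 1ℚ → (Es : List (Subset N)) → 0ℚ < ⟦ length Es ⟧ →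
    All (λ e → ∣ e ∣ ℕ.< 2 ℕ.^ L) Es → (∀ S → deg Es S ≤ u ^ℚ ∣ S ∣ * ⟦ length Es ⟧) →
    E ρ (fail Es) ≤ ℤ.+ 1 ℚ./ suc L
  spread⇒fail≤ {ρ = ρ} ρ≥ ρ≤1 Es 0<M small spread = ℚ.*-cancelˡ-≤-pos M {{ℚ.positive 0<M}} (begin
    M * E ρ (fail Es)      ≤⟨ fail-bound p x η 0≤p 0≤x x≤1 u≡xp loss L (ℚ.≤-trans Σp≤ ρ≥) ρ≤1 (⟦⟧-nonNeg (length Es)) Es small spread ⟩
    (M - M) + M * Σ< η L   ≡⟨ solve 2 (λ M s → (M :- M) :+ s := s) refl M (M * Σ< η L) ⟩
    M * Σ< η L             ≤⟨ *-monoˡ M (ℚ.<⇒≤ 0<M) Ση≤v ⟩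
    M * v                  ∎)
    where
    open ℚ.≤-Reasoning
    M = ⟦ length Es ⟧

-- Finite sums and falling factorials

ΣF : ∀ {k} → (Fin k → ℚ) → ℚ
ΣF {zero}  f = 0ℚ
ΣF {suc k} f = f zero + ΣF (f ∘ suc)

ΣF-mono : ∀ {k} {f g : Fin k → ℚ} → (∀ c → f c ≤ g c) → ΣF f ≤ ΣF g
ΣF-mono {zero}  h = ℚ.≤-refl
ΣF-mono {suc k} h = ℚ.+-mono-≤ (h zero) (ΣF-mono (h ∘ suc))

ΣF-cong : ∀ {k} {f g : Fin k → ℚ} → (∀ c → f c ≡ g c) → ΣF f ≡ ΣF g
ΣF-cong {zero}  h = refl
ΣF-cong {suc k} h = cong₂ _+_ (h zero) (ΣF-cong (h ∘ suc))

ΣF-* : ∀ {k} a (f : Fin k → ℚ) → ΣF (λ c → a * f c) ≡ a * ΣF f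
ΣF-* {zero}  a f = sym (ℚ.*-zeroʳ a)
ΣF-* {suc k} a f = trans (cong (a * f zero +_) (ΣF-* a (f ∘ suc))) (sym (ℚ.*-distribˡ-+ a (f zero) (ΣF (f ∘ suc))))

ΣF-0 : ∀ {k} {f : Fin k → ℚ} → (∀ c → f c ≡ 0ℚ) → ΣF f ≡ 0ℚ
ΣF-0 {zero}  h = refl
ΣF-0 {suc k} h = cong₂ _+_ (h zero) (ΣF-0 (h ∘ suc))

ΣF-δ : ∀ {k} (d : Fin k) (f : Fin k → ℚ) → ΣF (λ c → 𝟙 (d Fin.≟ c) * f c) ≡ f d
ΣF-δ zero f = trans (cong₂ _+_ (ℚ.*-identityˡ (f zero)) (ΣF-0 (λ c → ℚ.*-zeroˡ (f (suc c))))) (ℚ.+-identityʳ (f zero))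
ΣF-δ (suc d) f = trans (cong₂ _+_ (ℚ.*-zeroˡ (f zero)) (trans (ΣF-cong shift) (ΣF-δ d (f ∘ suc)))) (ℚ.+-identityˡ (f (suc d)))
  where
  shift : ∀ c → 𝟙 (suc d Fin.≟ suc c) * f (suc c) ≡ 𝟙 (d Fin.≟ c) * f (suc c)
  shift c with d Fin.≟ c
  ... | yes _ = refl
  ... | no _  = refl

ΣF-∈ : ∀ {k} (A : Subset k) → ΣF (λ c → 𝟙 (c ∈? A)) ≡ ⟦ ∣ A ∣ ⟧
ΣF-∈ [] = refl
ΣF-∈ (s ∷ A) = trans (cong (𝟙 (zero ∈? (s ∷ A)) +_) (trans (ΣF-cong shift) (ΣF-∈ A))) (head s)
  where
  shift : ∀ c → 𝟙 (suc c ∈? (s ∷ A)) ≡ 𝟙 (c ∈? A)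
  shift c with c ∈? A
  ... | yes _ = refl
  ... | no _  = refl
  head : ∀ s → 𝟙 (zero ∈? (s ∷ A)) + ⟦ ∣ A ∣ ⟧ ≡ ⟦ ∣ s ∷ A ∣ ⟧
  head inside  = sym (⟦⟧-+ 1 ∣ A ∣)
  head outside = ℚ.+-identityˡ ⟦ ∣ A ∣ ⟧

ΣL-++ : ∀ {A : Set} (as bs : List A) f → ΣL (as ++ bs) f ≡ ΣL as f + ΣL bs f
ΣL-++ []       bs f = sym (ℚ.+-identityˡ (ΣL bs f))
ΣL-++ (a ∷ as) bs f = trans (cong (f a +_) (ΣL-++ as bs f)) (sym (ℚ.+-assoc (f a) (ΣL as f) (ΣL bs f)))

ΣL-map : ∀ {A B : Set} (g : A → B) as f → ΣL (map g as) f ≡ ΣL as (f ∘ g)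
ΣL-map g []       f = refl
ΣL-map g (a ∷ as) f = cong (f (g a) +_) (ΣL-map g as f)

ΣL-concatMap : ∀ {A B : Set} (g : A → List B) as f → ΣL (concatMap g as) f ≡ ΣL as (λ a → ΣL (g a) f)
ΣL-concatMap g []       f = refl
ΣL-concatMap g (a ∷ as) f = trans (ΣL-++ (g a) (concatMap g as) f) (cong (ΣL (g a) f +_) (ΣL-concatMap g as f))

ΣL-tabulate : ∀ {A : Set} {k} (g : Fin k → A) f → ΣL (tabulate g) f ≡ ΣF (f ∘ g)
ΣL-tabulate {k = zero}  g f = refl
ΣL-tabulate {k = suc k} g f = cong (f (g zero) +_) (ΣL-tabulate (g ∘ suc) f)

ΣL-const : ∀ {A : Set} (as : List A) c → ΣL as (λ _ → c) ≡ ⟦ length as ⟧ * c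
ΣL-const []       c = sym (ℚ.*-zeroˡ c)
ΣL-const (a ∷ as) c = trans (cong (c +_) (ΣL-const as c))
  (trans (solve 2 (λ n c → c :+ n :* c := (con 1ℚ :+ n) :* c) refl ⟦ length as ⟧ c)
    (cong (_* c) (sym (⟦⟧-+ 1 (length as)))))

ΣL-replicate : ∀ {A : Set} n (a : A) f → ΣL (replicate n a) f ≡ ⟦ n ⟧ * f a
ΣL-replicate zero    a f = sym (ℚ.*-zeroˡ (f a))
ΣL-replicate (suc n) a f = trans (cong (f a +_) (ΣL-replicate n a f))
  (trans (solve 2 (λ n c → c :+ n :* c := (con 1ℚ :+ n) :* c) refl ⟦ n ⟧ (f a)) (cong (_* f a) (sym (⟦⟧-+ 1 n))))

ΣL-cong : ∀ {A : Set} (as : List A) {f g} → (∀ a → f a ≡ g a) → ΣL as f ≡ ΣL as g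
ΣL-cong []       h = refl
ΣL-cong (a ∷ as) h = cong₂ _+_ (h a) (ΣL-cong as h)

-- This is (1 + 1 / n) ^ m ≤ 1 + m / n + (m / n)² for m ≤ n, cleared of denominators; n = m + j
-- encodes m ≤ n. The quadratic term carries the induction on m, whose step has surplus m (n - m) +
-- n with the old m.
^-suc-bound : ∀ m j → let n = ⟦ m ℕ.+ j ⟧ in
  (1ℚ + n) ^ℚ m * (n * n) ≤ n ^ℚ m * (n * n + ⟦ m ⟧ * n + ⟦ m ⟧ * ⟦ m ⟧)
^-suc-bound zero j = ℚ.≤-reflexive (solve 1 (λ n → con 1ℚ :* (n :* n) := con 1ℚ :* (n :* n :+ con 0ℚ :* n :+ con 0ℚ :* con 0ℚ)) refl ⟦ j ⟧)
^-suc-bound (suc m) j = begin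
  (1ℚ + n) * (1ℚ + n) ^ℚ m * (n * n)
    ≡⟨ ℚ.*-assoc (1ℚ + n) ((1ℚ + n) ^ℚ m) (n * n) ⟩
  (1ℚ + n) * ((1ℚ + n) ^ℚ m * (n * n))
    ≤⟨ *-monoˡ (1ℚ + n) (+-nonNeg 0≤1 0≤n) ih ⟩
  (1ℚ + n) * (n ^ℚ m * (n * n + ⟦ m ⟧ * n + ⟦ m ⟧ * ⟦ m ⟧))
    ≤⟨ ≤-by (n ^ℚ m * (⟦ m ⟧ * (1ℚ + ⟦ j ⟧) + n)) (*-nonNeg (^-nonNeg 0≤n m)
         (+-nonNeg (*-nonNeg (⟦⟧-nonNeg m) (+-nonNeg 0≤1 (⟦⟧-nonNeg j))) 0≤n)) eq ⟩
  n * n ^ℚ m * (n * n + ⟦ suc m ⟧ * n + ⟦ suc m ⟧ * ⟦ suc m ⟧) ∎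
  where
  open ℚ.≤-Reasoning
  n = ⟦ suc m ℕ.+ j ⟧
  0≤n = ⟦⟧-nonNeg (suc m ℕ.+ j)
  ih : (1ℚ + n) ^ℚ m * (n * n) ≤ n ^ℚ m * (n * n + ⟦ m ⟧ * n + ⟦ m ⟧ * ⟦ m ⟧)
  ih = subst (λ i → (1ℚ + ⟦ i ⟧) ^ℚ m * (⟦ i ⟧ * ⟦ i ⟧) ≤ ⟦ i ⟧ ^ℚ m * (⟦ i ⟧ * ⟦ i ⟧ + ⟦ m ⟧ * ⟦ i ⟧ + ⟦ m ⟧ * ⟦ m ⟧))
    (ℕ.+-suc m j) (^-suc-bound m (suc j))
  n≡ : n ≡ 1ℚ + ⟦ m ⟧ + ⟦ j ⟧
  n≡ = trans (⟦⟧-+ (suc m) j) (cong (_+ ⟦ j ⟧) (⟦⟧-+ 1 m))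
  eq : (1ℚ + n) * (n ^ℚ m * (n * n + ⟦ m ⟧ * n + ⟦ m ⟧ * ⟦ m ⟧)) + n ^ℚ m * (⟦ m ⟧ * (1ℚ + ⟦ j ⟧) + n) ≡
    n * n ^ℚ m * (n * n + ⟦ suc m ⟧ * n + ⟦ suc m ⟧ * ⟦ suc m ⟧)
  eq = trans (cong (λ t → (1ℚ + t) * (n ^ℚ m * (t * t + ⟦ m ⟧ * t + ⟦ m ⟧ * ⟦ m ⟧)) + n ^ℚ m * (⟦ m ⟧ * (1ℚ + ⟦ j ⟧) + t)) n≡)
    (trans (solve 3 (λ x m j → let n = con 1ℚ :+ m :+ j ; m′ = con 1ℚ :+ m in
        (con 1ℚ :+ n) :* (x :* (n :* n :+ m :* n :+ m :* m)) :+ x :* (m :* (con 1ℚ :+ j) :+ n) :=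
        n :* x :* (n :* n :+ m′ :* n :+ m′ :* m′)) refl (n ^ℚ m) ⟦ m ⟧ ⟦ j ⟧)
      (cong₂ (λ t m′ → t * n ^ℚ m * (t * t + m′ * t + m′ * m′)) (sym n≡) (sym (⟦⟧-+ 1 m))))

[1+n]^m≤3n^m : ∀ n m → m ℕ.≤ n → (1ℚ + ⟦ n ⟧) ^ℚ m ≤ ⟦ 3 ⟧ * ⟦ n ⟧ ^ℚ m
[1+n]^m≤3n^m zero    zero _ = ⟦⟧-mono {1} {3} (ℕ.s≤s ℕ.z≤n)
[1+n]^m≤3n^m n′@(suc _) m m≤n = ℚ.*-cancelʳ-≤-pos (n * n) {{ℚ.positive (*-pos 0<n 0<n)}} (begin
  (1ℚ + n) ^ℚ m * (n * n)
    ≤⟨ subst (λ i → (1ℚ + ⟦ i ⟧) ^ℚ m * (⟦ i ⟧ * ⟦ i ⟧) ≤ ⟦ i ⟧ ^ℚ m * (⟦ i ⟧ * ⟦ i ⟧ + ⟦ m ⟧ * ⟦ i ⟧ + ⟦ m ⟧ * ⟦ m ⟧))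
         (ℕ.m+[n∸m]≡n m≤n) (^-suc-bound m (n′ ℕ.∸ m)) ⟩
  n ^ℚ m * (n * n + ⟦ m ⟧ * n + ⟦ m ⟧ * ⟦ m ⟧)
    ≤⟨ *-monoˡ (n ^ℚ m) (^-nonNeg 0≤n m) (ℚ.+-mono-≤ (ℚ.+-monoʳ-≤ (n * n) (*-monoʳ n 0≤n ⟦m⟧≤n)) (*-mono (⟦⟧-nonNeg m) 0≤n ⟦m⟧≤n ⟦m⟧≤n)) ⟩
  n ^ℚ m * (n * n + n * n + n * n)
    ≡⟨ solve 2 (λ x n → x :* (n :* n :+ n :* n :+ n :* n) := con ⟦ 3 ⟧ :* x :* (n :* n)) refl (n ^ℚ m) n ⟩
  ⟦ 3 ⟧ * n ^ℚ m * (n * n) ∎)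
  where
  open ℚ.≤-Reasoning
  n = ⟦ n′ ⟧
  0<n = ⟦⟧-pos (ℕ.pred n′)
  0≤n = ⟦⟧-nonNeg n′
  ⟦m⟧≤n = ⟦⟧-mono m≤n

-- Lowering the base of the remaining power from n + 1 to n costs one factor 3. The factor (k ∸ s) !
-- completes the falling factorial to k !.
k^s[k∸s]!≤3^sk! : ∀ k s → s ℕ.≤ k → ⟦ k ⟧ ^ℚ s * ⟦ (k ℕ.∸ s) ! ⟧ ≤ ⟦ 3 ⟧ ^ℚ s * ⟦ k ! ⟧
k^s[k∸s]!≤3^sk! k       zero    _             = ℚ.≤-refl
k^s[k∸s]!≤3^sk! (suc n) (suc s) (ℕ.s≤s s≤n) = begin
  K * K ^ℚ s * F                     ≡⟨ ℚ.*-assoc K (K ^ℚ s) F ⟩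
  K * (K ^ℚ s * F)                   ≤⟨ *-monoˡ K 0≤K (*-monoʳ F (⟦⟧-nonNeg ((n ℕ.∸ s) !)) K^s≤) ⟩
  K * (⟦ 3 ⟧ * ⟦ n ⟧ ^ℚ s * F)       ≡⟨ cong (K *_) (ℚ.*-assoc ⟦ 3 ⟧ (⟦ n ⟧ ^ℚ s) F) ⟩
  K * (⟦ 3 ⟧ * (⟦ n ⟧ ^ℚ s * F))     ≤⟨ *-monoˡ K 0≤K (*-monoˡ ⟦ 3 ⟧ (⟦⟧-nonNeg 3) (k^s[k∸s]!≤3^sk! n s s≤n)) ⟩
  K * (⟦ 3 ⟧ * (⟦ 3 ⟧ ^ℚ s * ⟦ n ! ⟧)) ≡⟨ solve 4 (λ K t x f → K :* (t :* (x :* f)) := (t :* x) :* (K :* f)) refl K ⟦ 3 ⟧ (⟦ 3 ⟧ ^ℚ s) ⟦ n ! ⟧ ⟩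
  ⟦ 3 ⟧ * ⟦ 3 ⟧ ^ℚ s * (K * ⟦ n ! ⟧)   ≡⟨ cong (⟦ 3 ⟧ * ⟦ 3 ⟧ ^ℚ s *_) (sym (⟦⟧-* (suc n) (n !))) ⟩
  ⟦ 3 ⟧ * ⟦ 3 ⟧ ^ℚ s * ⟦ suc n ! ⟧   ∎
  where
  open ℚ.≤-Reasoning
  K = ⟦ suc n ⟧
  0≤K = ⟦⟧-nonNeg (suc n)
  F = ⟦ (n ℕ.∸ s) ! ⟧
  K^s≤ : K ^ℚ s ≤ ⟦ 3 ⟧ * ⟦ n ⟧ ^ℚ s
  K^s≤ = subst (λ t → t ^ℚ s ≤ ⟦ 3 ⟧ * ⟦ n ⟧ ^ℚ s) (sym (⟦⟧-+ 1 n)) ([1+n]^m≤3n^m n s s≤n)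

-- The coloured hypergraph

PColoring : ℕ → ℕ → Set
PColoring k n = Vec (Maybe (Fin k)) n

supp : ∀ {k n} → PColoring k n → Subset n
supp []            = []
supp (nothing ∷ t) = outside ∷ supp t
supp (just _ ∷ t)  = inside ∷ supp t

-- The indicator that `s` extends `t`, as a product over the vertices so that sums over the colours
-- of one vertex factor out.
match : ∀ {k n} → PColoring k n → PColoring k n → ℚ
match []            []            = 1ℚ
match (nothing ∷ t) (_ ∷ s)       = match t s
match (just c ∷ t)  (nothing ∷ s) = 0ℚ
match (just c ∷ t)  (just d ∷ s)  = 𝟙 (c Fin.≟ d) * match t s

match-nonNeg : ∀ {k n} (t s : PColoring k n) → 0ℚ ≤ match t s
match-nonNeg []            []            = 0≤1
match-nonNeg (nothing ∷ t) (_ ∷ s)       = match-nonNeg t s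
match-nonNeg (just c ∷ t)  (nothing ∷ s) = ℚ.≤-refl
match-nonNeg (just c ∷ t)  (just d ∷ s)  = *-nonNeg (𝟙-nonNeg (c Fin.≟ d)) (match-nonNeg t s)

match≤supp : ∀ {k n} (t s : PColoring k n) → match t s ≤ 𝟙 (supp t ⊆? supp s)
match≤supp []            []            = ℚ.≤-refl
match≤supp (nothing ∷ t) (nothing ∷ s) = ℚ.≤-trans (match≤supp t s)
  (𝟙-mono (supp t ⊆? supp s) ((outside ∷ supp t) ⊆? (outside ∷ supp s)) (λ i {x} → out⊆ i {x}))
match≤supp (nothing ∷ t) (just _ ∷ s)  = ℚ.≤-trans (match≤supp t s)
  (𝟙-mono (supp t ⊆? supp s) ((outside ∷ supp t) ⊆? (inside ∷ supp s)) (λ i {x} → out⊆ i {x}))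
match≤supp (just c ∷ t)  (nothing ∷ s) = 𝟙-nonNeg ((inside ∷ supp t) ⊆? (outside ∷ supp s))
match≤supp (just c ∷ t)  (just d ∷ s)  = ℚ.≤-trans
  (*-mono (match-nonNeg t s) 0≤1 (𝟙-≤1 (c Fin.≟ d)) (match≤supp t s))
  (ℚ.≤-trans (ℚ.≤-reflexive (ℚ.*-identityˡ (𝟙 (supp t ⊆? supp s))))
    (𝟙-mono (supp t ⊆? supp s) ((inside ∷ supp t) ⊆? (inside ∷ supp s)) (λ i {x} → in⊆in i {x})))

opt : ∀ {P A : Set} → Dec P → List A → List A
opt (yes _) xs = xs
opt (no _)  xs = []

ΣL-opt : ∀ {P A : Set} (P? : Dec P) (xs : List A) f → ΣL (opt P? xs) f ≡ 𝟙 P? * ΣL xs f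
ΣL-opt (yes _) xs f = sym (ℚ.*-identityˡ (ΣL xs f))
ΣL-opt (no _)  xs f = sym (ℚ.*-zeroˡ (ΣL xs f))

All-opt : ∀ {P A : Set} {Q : A → Set} (P? : Dec P) {xs : List A} → (P → All Q xs) → All Q (opt P? xs)
All-opt (yes p) h = h p
All-opt (no _)  h = []

-- All injective colourings of e with colours from A.  Each is repeated (∣ A ∣ ∸ ∣ e ∣) ! times,
-- so that every edge contributes the same number of coloured edges.
rainbows : ∀ {k n} → Subset n → Subset k → List (PColoring k n)
rainbows             []            A = replicate (∣ A ∣ !) []
rainbows             (outside ∷ e) A = map (nothing ∷_) (rainbows e A)
rainbows {k} {suc n} (inside ∷ e)  A =
  concatMap (λ c → opt (c ∈? A) (map (just c ∷_) (rainbows e (A ∖ c)))) (allFin k)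

∣A∖c∣ : ∀ {k} (A : Subset k) c → c ∈ A → suc ∣ A ∖ c ∣ ≡ ∣ A ∣
∣A∖c∣ (inside ∷ A)  zero    Vec.here = cong (suc ∘ ∣_∣) (p─⊥≡p A)
∣A∖c∣ (inside ∷ A)  (suc c) (Vec.there c∈A) = cong suc (∣A∖c∣ A c c∈A)
∣A∖c∣ (outside ∷ A) (suc c) (Vec.there c∈A) = ∣A∖c∣ A c c∈A

ΣL-inside : ∀ {k n} (e : Subset n) (A : Subset k) f →
  ΣL (rainbows (inside ∷ e) A) f ≡ ΣF (λ c → 𝟙 (c ∈? A) * ΣL (rainbows e (A ∖ c)) (f ∘ (just c ∷_)))
ΣL-inside {k} e A f = trans (ΣL-concatMap (λ c → opt (c ∈? A) (map (just c ∷_) (rainbows e (A ∖ c)))) (allFin k) f)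
  (trans (ΣL-tabulate id (λ c → ΣL (opt (c ∈? A) (map (just c ∷_) (rainbows e (A ∖ c)))) f))
    (ΣF-cong (λ c → trans (ΣL-opt (c ∈? A) (map (just c ∷_) (rainbows e (A ∖ c))) f)
      (cong (𝟙 (c ∈? A) *_) (ΣL-map (just c ∷_) (rainbows e (A ∖ c)) f)))))

rainbows-length : ∀ {k n} (e : Subset n) (A : Subset k) → ∣ e ∣ ℕ.≤ ∣ A ∣ → ΣL (rainbows e A) (λ _ → 1ℚ) ≡ ⟦ ∣ A ∣ ! ⟧
rainbows-length []            A _ = trans (ΣL-replicate (∣ A ∣ !) [] (λ _ → 1ℚ)) (ℚ.*-identityʳ ⟦ ∣ A ∣ ! ⟧)
rainbows-length (outside ∷ e) A h = trans (ΣL-map (nothing ∷_) (rainbows e A) (λ _ → 1ℚ)) (rainbows-length e A h)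
rainbows-length (inside ∷ e)  A h = trans (ΣL-inside e A (λ _ → 1ℚ)) (count ∣ A ∣ refl h)
  where
  count : ∀ a → ∣ A ∣ ≡ a → suc ∣ e ∣ ℕ.≤ a → ΣF (λ c → 𝟙 (c ∈? A) * ΣL (rainbows e (A ∖ c)) (λ _ → 1ℚ)) ≡ ⟦ a ! ⟧
  count (suc a) ∣A∣≡ (ℕ.s≤s ∣e∣≤a) = trans (ΣF-cong each) (trans (ΣF-* ⟦ a ! ⟧ (λ c → 𝟙 (c ∈? A)))
    (trans (cong (⟦ a ! ⟧ *_) (trans (ΣF-∈ A) (cong ⟦_⟧ ∣A∣≡)))
      (trans (ℚ.*-comm ⟦ a ! ⟧ ⟦ suc a ⟧) (sym (⟦⟧-* (suc a) (a !))))))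
    where
    each : ∀ c → 𝟙 (c ∈? A) * ΣL (rainbows e (A ∖ c)) (λ _ → 1ℚ) ≡ ⟦ a ! ⟧ * 𝟙 (c ∈? A)
    each c with c ∈? A
    ... | no _    = trans (ℚ.*-zeroˡ (ΣL (rainbows e (A ∖ c)) (λ _ → 1ℚ))) (sym (ℚ.*-zeroʳ ⟦ a ! ⟧))
    ... | yes c∈A = trans (cong (1ℚ *_) (trans (rainbows-length e (A ∖ c) (subst (∣ e ∣ ℕ.≤_) (sym ∣A∖c∣≡a) ∣e∣≤a))
        (cong (λ i → ⟦ i ! ⟧) ∣A∖c∣≡a))) (ℚ.*-comm 1ℚ ⟦ a ! ⟧)
      where
      ∣A∖c∣≡a : ∣ A ∖ c ∣ ≡ a
      ∣A∖c∣≡a = ℕ.suc-injective (trans (∣A∖c∣ A c c∈A) ∣A∣≡)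

-- The indicator that `t` is injective with colours in `A`; `Fits` is the corresponding proposition.
fits : ∀ {k n} → PColoring k n → Subset k → ℚ
fits []            A = 1ℚ
fits (nothing ∷ t) A = fits t A
fits (just c ∷ t)  A = 𝟙 (c ∈? A) * fits t (A ∖ c)

fits-nonNeg : ∀ {k n} (t : PColoring k n) A → 0ℚ ≤ fits t A
fits-nonNeg []            A = 0≤1
fits-nonNeg (nothing ∷ t) A = fits-nonNeg t A
fits-nonNeg (just c ∷ t)  A = *-nonNeg (𝟙-nonNeg (c ∈? A)) (fits-nonNeg t (A ∖ c))

fits≤1 : ∀ {k n} (t : PColoring k n) A → fits t A ≤ 1ℚ
fits≤1 []            A = ℚ.≤-refl
fits≤1 (nothing ∷ t) A = fits≤1 t A
fits≤1 (just c ∷ t)  A = *-mono (fits-nonNeg t (A ∖ c)) 0≤1 (𝟙-≤1 (c ∈? A)) (fits≤1 t (A ∖ c))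

∈∖⇒≢ : ∀ {k} (A : Subset k) {c d} → c ∈ A ∖ d → c ≢ d
∈∖⇒≢ A {c} c∈ refl = x∈p─q⇒x∉q A ⁅ c ⁆ c∈ (x∈⁅x⁆ c)

remove-swap : ∀ {k} (A : Subset k) c d → 𝟙 (c ∈? A) * 𝟙 (d ∈? A ∖ c) ≤ 𝟙 (d ∈? A) * 𝟙 (c ∈? A ∖ d)
remove-swap A c d with c ∈? A | d ∈? A ∖ c
... | no _    | yes _ = *-nonNeg (𝟙-nonNeg (d ∈? A)) (𝟙-nonNeg (c ∈? A ∖ d))
... | no _    | no _  = *-nonNeg (𝟙-nonNeg (d ∈? A)) (𝟙-nonNeg (c ∈? A ∖ d))
... | yes _   | no _  = *-nonNeg (𝟙-nonNeg (d ∈? A)) (𝟙-nonNeg (c ∈? A ∖ d))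
... | yes c∈A | yes d∈ = ℚ.≤-reflexive (sym (cong₂ _*_ (𝟙-yes (d ∈? A) (p─q⊆p A ⁅ c ⁆ d∈))
  (𝟙-yes (c ∈? A ∖ d) (x∈p∧x≢y⇒x∈p-y c∈A (λ c≡d → ∈∖⇒≢ A d∈ (sym c≡d))))))

∣A∖c∣∸s : ∀ {k} (A : Subset k) c s → c ∈ A → ∣ A ∖ c ∣ ℕ.∸ s ≡ ∣ A ∣ ℕ.∸ suc s
∣A∖c∣∸s A c s c∈A = cong (ℕ._∸ suc s) (∣A∖c∣ A c c∈A)

-- If `t` fits into `A`, it fits into `A ∖ c` exactly for the ∣ A ∣ - ∣ supp t ∣ colours c that it
-- does not use. These are the choices for a vertex of an edge that `t` leaves uncoloured.
fits-remove : ∀ {k n} (t : PColoring k n) (A : Subset k) →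
  ΣF (λ c → 𝟙 (c ∈? A) * fits t (A ∖ c)) ≤ ⟦ ∣ A ∣ ℕ.∸ ∣ supp t ∣ ⟧ * fits t A
fits-remove [] A = ℚ.≤-reflexive (trans (ΣF-cong (λ c → ℚ.*-identityʳ (𝟙 (c ∈? A))))
  (trans (ΣF-∈ A) (sym (ℚ.*-identityʳ ⟦ ∣ A ∣ ⟧))))
fits-remove (nothing ∷ t) A = fits-remove t A
fits-remove (just d ∷ t) A = begin
  ΣF (λ c → 𝟙 (c ∈? A) * (𝟙 (d ∈? A ∖ c) * fits t (A ∖ c ∖ d)))
    ≤⟨ ΣF-mono swap ⟩
  ΣF (λ c → 𝟙 (d ∈? A) * (𝟙 (c ∈? A ∖ d) * fits t (A ∖ d ∖ c)))
    ≡⟨ ΣF-* (𝟙 (d ∈? A)) (λ c → 𝟙 (c ∈? A ∖ d) * fits t (A ∖ d ∖ c)) ⟩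
  𝟙 (d ∈? A) * ΣF (λ c → 𝟙 (c ∈? A ∖ d) * fits t (A ∖ d ∖ c))
    ≤⟨ *-monoˡ (𝟙 (d ∈? A)) (𝟙-nonNeg (d ∈? A)) (fits-remove t (A ∖ d)) ⟩
  𝟙 (d ∈? A) * (⟦ ∣ A ∖ d ∣ ℕ.∸ s ⟧ * fits t (A ∖ d))
    ≡⟨ resize (d ∈? A) ⟩
  ⟦ ∣ A ∣ ℕ.∸ suc s ⟧ * (𝟙 (d ∈? A) * fits t (A ∖ d)) ∎
  where
  open ℚ.≤-Reasoning
  s = ∣ supp t ∣
  swap : ∀ c → 𝟙 (c ∈? A) * (𝟙 (d ∈? A ∖ c) * fits t (A ∖ c ∖ d)) ≤ 𝟙 (d ∈? A) * (𝟙 (c ∈? A ∖ d) * fits t (A ∖ d ∖ c))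
  swap c = ℚ.≤-trans (ℚ.≤-reflexive (sym (ℚ.*-assoc (𝟙 (c ∈? A)) (𝟙 (d ∈? A ∖ c)) (fits t (A ∖ c ∖ d)))))
    (ℚ.≤-trans (*-monoʳ (fits t (A ∖ c ∖ d)) (fits-nonNeg t (A ∖ c ∖ d)) (remove-swap A c d))
      (ℚ.≤-reflexive (trans (cong (λ B → 𝟙 (d ∈? A) * 𝟙 (c ∈? A ∖ d) * fits t B) (p─x─y≡p─y─x A c d))
        (ℚ.*-assoc (𝟙 (d ∈? A)) (𝟙 (c ∈? A ∖ d)) (fits t (A ∖ d ∖ c))))))
  resize : (d∈? : Dec (d ∈ A)) → 𝟙 d∈? * (⟦ ∣ A ∖ d ∣ ℕ.∸ s ⟧ * fits t (A ∖ d)) ≡ ⟦ ∣ A ∣ ℕ.∸ suc s ⟧ * (𝟙 d∈? * fits t (A ∖ d))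
  resize (no _)    = solve 3 (λ a b f → con 0ℚ :* (a :* f) := b :* (con 0ℚ :* f)) refl ⟦ ∣ A ∖ d ∣ ℕ.∸ s ⟧ ⟦ ∣ A ∣ ℕ.∸ suc s ⟧ (fits t (A ∖ d))
  resize (yes d∈A) = trans (cong (λ i → 1ℚ * (⟦ i ⟧ * fits t (A ∖ d))) (∣A∖c∣∸s A d s d∈A))
    (solve 2 (λ b f → con 1ℚ :* (b :* f) := b :* (con 1ℚ :* f)) refl ⟦ ∣ A ∣ ℕ.∸ suc s ⟧ (fits t (A ∖ d)))

-- An equality for s < n; for n ≤ s the truncated differences give 0 on the left and 0 ! = 1 on the
-- right.
n*[n∸1]!≤n! : ∀ n s → ⟦ n ℕ.∸ s ⟧ * ⟦ (n ℕ.∸ suc s) ! ⟧ ≤ ⟦ (n ℕ.∸ s) ! ⟧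
n*[n∸1]!≤n! n s with n ℕ.∸ s in eq
... | zero  = ℚ.≤-trans (ℚ.≤-reflexive (ℚ.*-zeroˡ ⟦ (n ℕ.∸ suc s) ! ⟧)) 0≤1
... | suc a = ℚ.≤-reflexive (trans (cong (λ i → ⟦ suc a ⟧ * ⟦ i ! ⟧) n∸1+s≡a) (sym (⟦⟧-* (suc a) (a !))))
  where
  n∸1+s≡a : n ℕ.∸ suc s ≡ a
  n∸1+s≡a = trans (cong (n ℕ.∸_) (ℕ.+-comm 1 s)) (trans (sym (ℕ.∸-+-assoc n s 1)) (cong (ℕ._∸ 1) eq))

-- With s = ∣ supp t ∣, the ∣ e ∣ - s missing colours can be chosen injectively in (∣ A ∣ - s) ⋯ (∣
-- A ∣ - ∣ e ∣ + 1) ways, and the (∣ A ∣ - ∣ e ∣) ! repetitions complete this to (∣ A ∣ - s) !. The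
-- repetitions thus make the bound independent of `e`.
count-matches : ∀ {k n} (e : Subset n) (t : PColoring k n) (A : Subset k) →
  ΣL (rainbows e A) (match t) ≤ fits t A * ⟦ (∣ A ∣ ℕ.∸ ∣ supp t ∣) ! ⟧
count-matches [] [] A = ℚ.≤-reflexive (trans (ΣL-replicate (∣ A ∣ !) [] (match [])) (ℚ.*-comm ⟦ ∣ A ∣ ! ⟧ 1ℚ))
count-matches (outside ∷ e) (nothing ∷ t) A = ℚ.≤-trans (ℚ.≤-reflexive (ΣL-map (nothing ∷_) (rainbows e A) (match (nothing ∷ t))))
  (count-matches e t A)
count-matches (outside ∷ e) (just c ∷ t) A = ℚ.≤-trans
  (ℚ.≤-reflexive (trans (ΣL-map (nothing ∷_) (rainbows e A) (match (just c ∷ t)))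
    (trans (ΣL-const (rainbows e A) 0ℚ) (ℚ.*-zeroʳ ⟦ length (rainbows e A) ⟧))))
  (*-nonNeg (fits-nonNeg (just c ∷ t) A) (⟦⟧-nonNeg ((∣ A ∣ ℕ.∸ suc ∣ supp t ∣) !)))
count-matches (inside ∷ e) (nothing ∷ t) A = begin
  ΣL (rainbows (inside ∷ e) A) (match (nothing ∷ t))
    ≡⟨ ΣL-inside e A (match (nothing ∷ t)) ⟩
  ΣF (λ c → 𝟙 (c ∈? A) * ΣL (rainbows e (A ∖ c)) (match t))
    ≤⟨ ΣF-mono (λ c → ℚ.≤-trans
         (*-monoˡ (𝟙 (c ∈? A)) (𝟙-nonNeg (c ∈? A)) (count-matches e t (A ∖ c))) (ℚ.≤-reflexive (resize c (c ∈? A)))) ⟩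
  ΣF (λ c → F * (𝟙 (c ∈? A) * fits t (A ∖ c)))
    ≡⟨ ΣF-* F (λ c → 𝟙 (c ∈? A) * fits t (A ∖ c)) ⟩
  F * ΣF (λ c → 𝟙 (c ∈? A) * fits t (A ∖ c))
    ≤⟨ *-monoˡ F (⟦⟧-nonNeg ((∣ A ∣ ℕ.∸ suc s) !)) (fits-remove t A) ⟩
  F * (⟦ ∣ A ∣ ℕ.∸ s ⟧ * fits t A)
    ≡⟨ solve 3 (λ F m f → F :* (m :* f) := f :* (m :* F)) refl F ⟦ ∣ A ∣ ℕ.∸ s ⟧ (fits t A) ⟩
  fits t A * (⟦ ∣ A ∣ ℕ.∸ s ⟧ * F)
    ≤⟨ *-monoˡ (fits t A) (fits-nonNeg t A) (n*[n∸1]!≤n! ∣ A ∣ s) ⟩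
  fits t A * ⟦ (∣ A ∣ ℕ.∸ s) ! ⟧ ∎
  where
  open ℚ.≤-Reasoning
  s = ∣ supp t ∣
  F = ⟦ (∣ A ∣ ℕ.∸ suc s) ! ⟧
  resize : ∀ c (c∈? : Dec (c ∈ A)) → 𝟙 c∈? * (fits t (A ∖ c) * ⟦ (∣ A ∖ c ∣ ℕ.∸ s) ! ⟧) ≡ F * (𝟙 c∈? * fits t (A ∖ c))
  resize c (no _)    = solve 3 (λ a b f → con 0ℚ :* (f :* a) := b :* (con 0ℚ :* f)) refl ⟦ (∣ A ∖ c ∣ ℕ.∸ s) ! ⟧ F (fits t (A ∖ c))
  resize c (yes c∈A) = trans (cong (λ i → 1ℚ * (fits t (A ∖ c) * ⟦ i ! ⟧)) (∣A∖c∣∸s A c s c∈A))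
    (solve 2 (λ b f → con 1ℚ :* (f :* b) := b :* (con 1ℚ :* f)) refl F (fits t (A ∖ c)))
count-matches (inside ∷ e) (just d ∷ t) A = begin
  ΣL (rainbows (inside ∷ e) A) (match (just d ∷ t))
    ≡⟨ ΣL-inside e A (match (just d ∷ t)) ⟩
  ΣF (λ c → 𝟙 (c ∈? A) * ΣL (rainbows e (A ∖ c)) (λ s → 𝟙 (d Fin.≟ c) * match t s))
    ≡⟨ ΣF-cong (λ c → trans (cong (𝟙 (c ∈? A) *_) (ΣL-* (rainbows e (A ∖ c)) (𝟙 (d Fin.≟ c)) (match t)))
         (solve 3 (λ a b x → a :* (b :* x) := b :* (a :* x)) refl (𝟙 (c ∈? A)) (𝟙 (d Fin.≟ c)) (ΣL (rainbows e (A ∖ c)) (match t)))) ⟩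
  ΣF (λ c → 𝟙 (d Fin.≟ c) * (𝟙 (c ∈? A) * ΣL (rainbows e (A ∖ c)) (match t)))
    ≡⟨ ΣF-δ d (λ c → 𝟙 (c ∈? A) * ΣL (rainbows e (A ∖ c)) (match t)) ⟩
  𝟙 (d ∈? A) * ΣL (rainbows e (A ∖ d)) (match t)
    ≤⟨ *-monoˡ (𝟙 (d ∈? A)) (𝟙-nonNeg (d ∈? A)) (count-matches e t (A ∖ d)) ⟩
  𝟙 (d ∈? A) * (fits t (A ∖ d) * ⟦ (∣ A ∖ d ∣ ℕ.∸ s) ! ⟧)
    ≡⟨ resize (d ∈? A) ⟩
  𝟙 (d ∈? A) * fits t (A ∖ d) * ⟦ (∣ A ∣ ℕ.∸ suc s) ! ⟧ ∎
  where
  open ℚ.≤-Reasoning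
  s = ∣ supp t ∣
  F = ⟦ (∣ A ∣ ℕ.∸ suc s) ! ⟧
  resize : (d∈? : Dec (d ∈ A)) → 𝟙 d∈? * (fits t (A ∖ d) * ⟦ (∣ A ∖ d ∣ ℕ.∸ s) ! ⟧) ≡ 𝟙 d∈? * fits t (A ∖ d) * F
  resize (no _)    = solve 3 (λ a b f → con 0ℚ :* (f :* a) := con 0ℚ :* f :* b) refl ⟦ (∣ A ∖ d ∣ ℕ.∸ s) ! ⟧ F (fits t (A ∖ d))
  resize (yes d∈A) = trans (cong (λ i → 1ℚ * (fits t (A ∖ d) * ⟦ i ! ⟧)) (∣A∖c∣∸s A d s d∈A))
    (sym (ℚ.*-assoc 1ℚ (fits t (A ∖ d)) F))

Fits : ∀ {k n} → PColoring k n → Subset k → Set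
Fits []            A = Unit
Fits (nothing ∷ t) A = Fits t A
Fits (just c ∷ t)  A = c ∈ A × Fits t (A ∖ c)

rainbows-valid : ∀ {k n} (e : Subset n) (A : Subset k) → All (λ s → supp s ≡ e × Fits s A) (rainbows e A)
rainbows-valid             []            A = replicate⁺ (∣ A ∣ !) (refl , tt)
rainbows-valid             (outside ∷ e) A = map⁺ (All.map (λ (eq , f) → cong (outside ∷_) eq , f) (rainbows-valid e A))
rainbows-valid {k} {suc n} (inside ∷ e)  A = concat⁺ (map⁺ (tabulate⁺ λ c →
  All-opt (c ∈? A) λ c∈A → map⁺ (All.map (λ (eq , f) → cong (inside ∷_) eq , (c∈A , f)) (rainbows-valid e (A ∖ c)))))

Fits⇒∈ : ∀ {k n} (t : PColoring k n) A → Fits t A → ∀ x {c} → Vec.lookup t x ≡ just c → c ∈ A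
Fits⇒∈ (just c ∷ t)  A (c∈A , f) zero    refl = c∈A
Fits⇒∈ (just c ∷ t)  A (c∈A , f) (suc x) eq   = p─q⊆p A ⁅ c ⁆ (Fits⇒∈ t (A ∖ c) f x eq)
Fits⇒∈ (nothing ∷ t) A f         (suc x) eq   = Fits⇒∈ t A f x eq

Fits⇒distinct : ∀ {k n} (t : PColoring k n) A → Fits t A → ∀ x y {c d} →
  Vec.lookup t x ≡ just c → Vec.lookup t y ≡ just d → x ≢ y → c ≢ d
Fits⇒distinct (_ ∷ t)       A f         zero    zero    _    _    x≢y = contradiction refl x≢y
Fits⇒distinct (just c ∷ t)  A (c∈A , f) zero    (suc y) refl eq′  x≢y = ∈∖⇒≢ A (Fits⇒∈ t (A ∖ c) f y eq′) ∘ sym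
Fits⇒distinct (just c ∷ t)  A (c∈A , f) (suc x) zero    eq   refl x≢y = ∈∖⇒≢ A (Fits⇒∈ t (A ∖ c) f x eq)
Fits⇒distinct (just c ∷ t)  A (c∈A , f) (suc x) (suc y) eq   eq′  x≢y = Fits⇒distinct t (A ∖ c) f x y eq eq′ (x≢y ∘ cong suc)
Fits⇒distinct (nothing ∷ t) A f         (suc x) (suc y) eq   eq′  x≢y = Fits⇒distinct t A f x y eq eq′ (x≢y ∘ cong suc)

-- Partial colourings as subsets of X × [k]

cell : ∀ {k} → Maybe (Fin k) → Subset k
cell nothing  = ⊥
cell (just c) = ⁅ c ⁆

-- The subset {(x , c) : t x = just c} of X × [k].
graph : ∀ {k n} → PColoring k n → Subset (n ℕ.* k)
graph t = Vec.concat (Vec.map cell t)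

restrict : ∀ {k n} → Vec (Fin k) n → Subset n → PColoring k n
restrict []       []            = []
restrict (c ∷ cs) (inside ∷ W)  = just c ∷ restrict cs W
restrict (c ∷ cs) (outside ∷ W) = nothing ∷ restrict cs W

++-⊆ : ∀ {m n} (p p′ : Subset m) {q q′ : Subset n} → p Vec.++ q ⊆ p′ Vec.++ q′ → p ⊆ p′ × q ⊆ q′
++-⊆ []      []        h = (λ ()) , h
++-⊆ (s ∷ p) (s′ ∷ p′) {q} {q′} h with ++-⊆ p p′ {q} {q′} (drop-∷-⊆ h)
... | p⊆p′ , q⊆q′ = head s s′ h , q⊆q′
  where
  head : ∀ s s′ → (s ∷ p) Vec.++ q ⊆ (s′ ∷ p′) Vec.++ q′ → s ∷ p ⊆ s′ ∷ p′
  head outside _       _ = out⊆ p⊆p′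
  head inside  inside  _ = in⊆in p⊆p′
  head inside  outside h = contradiction (h Vec.here) λ ()

++-mono-⊆ : ∀ {m n} (p p′ : Subset m) {q q′ : Subset n} → p ⊆ p′ → q ⊆ q′ → p Vec.++ q ⊆ p′ Vec.++ q′
++-mono-⊆ []            []             p⊆ q⊆ x∈             = q⊆ x∈
++-mono-⊆ (outside ∷ p) (_ ∷ p′)       p⊆ q⊆ (Vec.there x∈) = Vec.there (++-mono-⊆ p p′ (drop-∷-⊆ p⊆) q⊆ x∈)
++-mono-⊆ (inside ∷ p)  (inside ∷ p′)  p⊆ q⊆ Vec.here       = Vec.here
++-mono-⊆ (inside ∷ p)  (inside ∷ p′)  p⊆ q⊆ (Vec.there x∈) = Vec.there (++-mono-⊆ p p′ (drop-∷-⊆ p⊆) q⊆ x∈)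
++-mono-⊆ (inside ∷ p)  (outside ∷ p′) p⊆ q⊆ x∈             = contradiction (p⊆ Vec.here) λ ()

∣++∣ : ∀ {m n} (p : Subset m) (q : Subset n) → ∣ p Vec.++ q ∣ ≡ ∣ p ∣ ℕ.+ ∣ q ∣
∣++∣ []            q = refl
∣++∣ (inside ∷ p)  q = cong suc (∣++∣ p q)
∣++∣ (outside ∷ p) q = ∣++∣ p q

∣graph∣ : ∀ {k n} (t : PColoring k n) → ∣ graph t ∣ ≡ ∣ supp t ∣
∣graph∣ []                = refl
∣graph∣ {k} (nothing ∷ t) = trans (∣++∣ (⊥ {k}) (graph t)) (cong₂ ℕ._+_ (∣⊥∣≡0 k) (∣graph∣ t))
∣graph∣ (just c ∷ t)      = trans (∣++∣ ⁅ c ⁆ (graph t)) (cong₂ ℕ._+_ (∣⁅x⁆∣≡1 c) (∣graph∣ t))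

drop-supp : ∀ {k n} (m : Maybe (Fin k)) {t : PColoring k n} {x} → suc x ∈ supp (m ∷ t) → x ∈ supp t
drop-supp (just _) (Vec.there i) = i
drop-supp nothing  (Vec.there i) = i

graph⊆restrict : ∀ {k n} (t : PColoring k n) (χ : Vec (Fin k) n) W → graph t ⊆ graph (restrict χ W) →
  ∀ x → x ∈ supp t → x ∈ W × Vec.lookup t x ≡ just (Vec.lookup χ x)
graph⊆restrict (just c ∷ t)  (d ∷ χ) (inside ∷ W)  h zero    Vec.here =
  Vec.here , cong just (x∈⁅y⁆⇒x≡y d (proj₁ (++-⊆ ⁅ c ⁆ ⁅ d ⁆ h) (x∈⁅x⁆ c)))
graph⊆restrict (just c ∷ t)  (d ∷ χ) (outside ∷ W) h zero    Vec.here =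
  contradiction (proj₁ (++-⊆ ⁅ c ⁆ ⊥ h) (x∈⁅x⁆ c)) ∉⊥
graph⊆restrict (m ∷ t) (d ∷ χ) (inside ∷ W)  h (suc x) x∈ with graph⊆restrict t χ W (proj₂ (++-⊆ (cell m) ⁅ d ⁆ h)) x (drop-supp m x∈)
... | x∈W , eq = Vec.there x∈W , eq
graph⊆restrict (m ∷ t) (d ∷ χ) (outside ∷ W) h (suc x) x∈ with graph⊆restrict t χ W (proj₂ (++-⊆ (cell m) ⊥ h)) x (drop-supp m x∈)
... | x∈W , eq = Vec.there x∈W , eq

coloured : ∀ k {n} → List (Subset n) → List (Subset (n ℕ.* k))
coloured k = concatMap (λ e → map graph (rainbows e (⊤ {k})))

ΣL-coloured : ∀ k {n} (H : List (Subset n)) f → ΣL (coloured k H) f ≡ ΣL H (λ e → ΣL (rainbows e (⊤ {k})) (f ∘ graph))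
ΣL-coloured k H f = trans (ΣL-concatMap (λ e → map graph (rainbows e (⊤ {k}))) H f)
  (ΣL-cong H (λ e → ΣL-map graph (rainbows e ⊤) f))

coloured-valid : ∀ k {n} (H : List (Subset n)) →
  All (λ S → ∃[ t ] (S ≡ graph t × supp t ∈ᴸ H × Fits t (⊤ {k}))) (coloured k H)
coloured-valid k H = concat⁺ (map⁺ (All.tabulate λ {e} e∈H →
  map⁺ (All.map (λ { {t} (eq , f) → t , refl , subst (_∈ᴸ H) (sym eq) e∈H , f }) (rainbows-valid e ⊤))))

rainbow-of-coloured : ∀ {k n} (H : List (Subset n)) (χ : Vec (Fin k) n) W →
  Any (_⊆ graph (restrict χ W)) (coloured k H) → Any (λ e → e ⊆ W × Rainbow χ e) H
rainbow-of-coloured {k} H χ W a with find a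
... | S , S∈ , S⊆ with All.lookup (coloured-valid k H) S∈
... | t , refl , e∈H , f = lose e∈H ((λ {x} x∈ → proj₁ (agree x x∈)) ,
  λ x y x∈ y∈ → Fits⇒distinct t ⊤ f x y (proj₂ (agree x x∈)) (proj₂ (agree y y∈)))
  where
  agree = graph⊆restrict t χ W S⊆

-- A set of coloured vertices extends to a coloured edge only if it is a partial colouring itself.
partial? : ∀ {k n} (Ss : Vec (Subset k) n) →
  (Σ (PColoring k n) λ t → ∣ Vec.concat Ss ∣ ≡ ∣ supp t ∣ × (∀ s → Vec.concat Ss ⊆ graph s → 1ℚ ≤ match t s)) ⊎
  (∀ (s : PColoring k n) → ¬ Vec.concat Ss ⊆ graph s)
partial? [] = inj₁ ([] , refl , λ { [] _ → ℚ.≤-refl })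
partial? {k} (S ∷ Ss) with partial? Ss
... | inj₂ none = inj₂ λ { (m ∷ s) h → none s (λ {x} → proj₂ (++-⊆ S (cell m) h) {x}) }
... | inj₁ (t , ∣Ss∣≡ , ext) with nonempty? S
...   | no empty = inj₁ (nothing ∷ t ,
  trans (∣++∣ S (Vec.concat Ss)) (cong₂ ℕ._+_ (trans (cong ∣_∣ (Empty-unique empty)) (∣⊥∣≡0 k)) ∣Ss∣≡) ,
  λ { (m ∷ s) h → ext s (λ {x} → proj₂ (++-⊆ S (cell m) h) {x}) })
...   | yes (c , c∈S) with ∣ S ∣ ℕ.≟ 1
...     | yes ∣S∣≡1 = inj₁ (just c ∷ t , trans (∣++∣ S (Vec.concat Ss)) (cong₂ ℕ._+_ ∣S∣≡1 ∣Ss∣≡) , extend)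
  where
  extend : ∀ s → Vec.concat (S ∷ Ss) ⊆ graph s → 1ℚ ≤ match (just c ∷ t) s
  extend (nothing ∷ s) h = contradiction (proj₁ (++-⊆ S ⊥ h) c∈S) ∉⊥
  extend (just d ∷ s)  h = ℚ.≤-trans (ext s (proj₂ (++-⊆ S ⁅ d ⁆ h))) (ℚ.≤-reflexive (sym (trans
    (cong (_* match t s) (𝟙-yes (c Fin.≟ d) (x∈⁅y⁆⇒x≡y d (proj₁ (++-⊆ S ⁅ d ⁆ h) c∈S)))) (ℚ.*-identityˡ (match t s)))))
-- A nonempty block that is not a singleton has two or more colours, while a partial colouring gives
-- its vertex at most one.
...     | no ∣S∣≢1 = inj₂ λ { (m ∷ s) h → ∣S∣≢1 (ℕ.≤-antisym
    (ℕ.≤-trans (p⊆q⇒∣p∣≤∣q∣ (proj₁ (++-⊆ S (cell m) h))) (∣cell∣≤1 m))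
    (subst (ℕ._≤ ∣ S ∣) (∣⁅x⁆∣≡1 c) (p⊆q⇒∣p∣≤∣q∣ (λ {x} x∈ → subst (_∈ S) (sym (x∈⁅y⁆⇒x≡y c x∈)) c∈S)))) }
  where
  ∣cell∣≤1 : ∀ (m : Maybe (Fin k)) → ∣ cell m ∣ ℕ.≤ 1
  ∣cell∣≤1 nothing  = ℕ.≤-trans (ℕ.≤-reflexive (∣⊥∣≡0 k)) ℕ.z≤n
  ∣cell∣≤1 (just d) = ℕ.≤-reflexive (∣⁅x⁆∣≡1 d)

-- Size, boundedness and spread of the coloured hypergraph

module _ {n k r : ℕ} .{{_ : ℕ.NonZero k}} (r≤k : r ℕ.≤ k) (H : List (Subset n)) (bounded : All (λ e → ∣ e ∣ ℕ.≤ r) H) where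

  private
    β : ℚ
    β = ⟦ 3 ⟧ * (ℤ.+ 1 ℚ./ k)

    0≤1/k : 0ℚ ≤ ℤ.+ 1 ℚ./ k
    0≤1/k = ℚ.<⇒≤ (unit-pos k)

    0≤β : 0ℚ ≤ β
    0≤β = *-nonNeg (⟦⟧-nonNeg 3) 0≤1/k

    -- Prescribing s colours leaves at most a fraction (3 / k) ^ s of the k ! colourings listed for
    -- an edge. The local `κ⁻¹` is 1 / k.
    [k∸s]!≤ : ∀ s → s ℕ.≤ k → ⟦ (k ℕ.∸ s) ! ⟧ ≤ β ^ℚ s * ⟦ k ! ⟧
    [k∸s]!≤ s s≤k = begin
      F                                        ≡⟨ sym (ℚ.*-identityˡ F) ⟩
      1ℚ * F                                   ≡⟨ cong (_* F) (sym (1^n≡1 s)) ⟩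
      1ℚ ^ℚ s * F                              ≡⟨ cong (λ x → x ^ℚ s * F) (sym (trans (ℚ.*-comm κ⁻¹ ⟦ k ⟧) (⟦⟧-unit k))) ⟩
      (κ⁻¹ * ⟦ k ⟧) ^ℚ s * F                   ≡⟨ cong (_* F) (^-distrib-* κ⁻¹ ⟦ k ⟧ s) ⟩
      κ⁻¹ ^ℚ s * ⟦ k ⟧ ^ℚ s * F                ≡⟨ ℚ.*-assoc (κ⁻¹ ^ℚ s) (⟦ k ⟧ ^ℚ s) F ⟩
      κ⁻¹ ^ℚ s * (⟦ k ⟧ ^ℚ s * F)              ≤⟨ *-monoˡ (κ⁻¹ ^ℚ s) (^-nonNeg 0≤1/k s) (k^s[k∸s]!≤3^sk! k s s≤k) ⟩
      κ⁻¹ ^ℚ s * (⟦ 3 ⟧ ^ℚ s * ⟦ k ! ⟧)        ≡⟨ solve 3 (λ a b c → a :* (b :* c) := b :* a :* c) refl (κ⁻¹ ^ℚ s) (⟦ 3 ⟧ ^ℚ s) ⟦ k ! ⟧ ⟩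
      ⟦ 3 ⟧ ^ℚ s * κ⁻¹ ^ℚ s * ⟦ k ! ⟧          ≡⟨ cong (_* ⟦ k ! ⟧) (sym (^-distrib-* ⟦ 3 ⟧ κ⁻¹ s)) ⟩
      β ^ℚ s * ⟦ k ! ⟧                         ∎
      where
      open ℚ.≤-Reasoning
      F = ⟦ (k ℕ.∸ s) ! ⟧
      κ⁻¹ = ℤ.+ 1 ℚ./ k

    edge-count : (Ss : Vec (Subset k) n) (t : PColoring k n) → (∀ s → Vec.concat Ss ⊆ graph s → 1ℚ ≤ match t s) →
      ∀ e → e ∈ᴸ H → ΣL (rainbows e ⊤) (λ s → 𝟙 (Vec.concat Ss ⊆? graph s)) ≤
        (β ^ℚ ∣ supp t ∣ * ⟦ k ! ⟧) * 𝟙 (supp t ⊆? e)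
    edge-count Ss t ext e e∈H = by-cases (supp t ⊆? e)
      where
      below : ∀ s → 𝟙 (Vec.concat Ss ⊆? graph s) ≤ match t s
      below s with Vec.concat Ss ⊆? graph s
      ... | yes h = ext s h
      ... | no _  = match-nonNeg t s
      none : ¬ supp t ⊆ e → ∀ s → s ∈ᴸ rainbows e ⊤ → match t s ≤ 0ℚ
      none ⊈e s s∈ = ℚ.≤-trans (match≤supp t s) (ℚ.≤-reflexive (𝟙-no (supp t ⊆? supp s)
        (λ i → ⊈e (subst (supp t ⊆_) (proj₁ (All.lookup (rainbows-valid e ⊤) s∈)) (λ {x} → i {x})))))
      by-cases : (d : Dec (supp t ⊆ e)) →
        ΣL (rainbows e ⊤) (λ s → 𝟙 (Vec.concat Ss ⊆? graph s)) ≤ (β ^ℚ ∣ supp t ∣ * ⟦ k ! ⟧) * 𝟙 d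
      by-cases (no ⊈e) = ℚ.≤-trans (ΣL-mono (rainbows e ⊤) (λ s s∈ → ℚ.≤-trans (below s) (none (λ i → ⊈e (λ {x} → i {x})) s s∈)))
        (ℚ.≤-reflexive (trans (ΣL-const (rainbows e (⊤ {k})) 0ℚ) (trans (ℚ.*-zeroʳ ⟦ length (rainbows e (⊤ {k})) ⟧)
          (sym (ℚ.*-zeroʳ (β ^ℚ ∣ supp t ∣ * ⟦ k ! ⟧))))))
      by-cases (yes ⊆e) = begin
        ΣL (rainbows e ⊤) (λ s → 𝟙 (Vec.concat Ss ⊆? graph s)) ≤⟨ ΣL-mono (rainbows e ⊤) (λ s _ → below s) ⟩
        ΣL (rainbows e ⊤) (match t)                            ≤⟨ count-matches e t ⊤ ⟩
        fits t ⊤ * ⟦ (∣ ⊤ {k} ∣ ℕ.∸ ∣ supp t ∣) ! ⟧            ≤⟨ *-monoʳ ⟦ (∣ ⊤ {k} ∣ ℕ.∸ ∣ supp t ∣) ! ⟧ (⟦⟧-nonNeg ((∣ ⊤ {k} ∣ ℕ.∸ ∣ supp t ∣) !)) (fits≤1 t ⊤) ⟩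
        1ℚ * ⟦ (∣ ⊤ {k} ∣ ℕ.∸ ∣ supp t ∣) ! ⟧                  ≡⟨ trans (ℚ.*-identityˡ ⟦ (∣ ⊤ {k} ∣ ℕ.∸ ∣ supp t ∣) ! ⟧) (cong (λ i → ⟦ (i ℕ.∸ ∣ supp t ∣) ! ⟧) (∣⊤∣≡n k)) ⟩
        ⟦ (k ℕ.∸ ∣ supp t ∣) ! ⟧                               ≤⟨ [k∸s]!≤ ∣ supp t ∣ (ℕ.≤-trans (p⊆q⇒∣p∣≤∣q∣ ⊆e) (ℕ.≤-trans (All.lookup bounded e∈H) r≤k)) ⟩
        β ^ℚ ∣ supp t ∣ * ⟦ k ! ⟧                              ≡⟨ sym (ℚ.*-identityʳ (β ^ℚ ∣ supp t ∣ * ⟦ k ! ⟧)) ⟩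
        β ^ℚ ∣ supp t ∣ * ⟦ k ! ⟧ * 1ℚ ∎
        where open ℚ.≤-Reasoning

  coloured-length : ⟦ length (coloured k H) ⟧ ≡ ⟦ length H ⟧ * ⟦ k ! ⟧
  coloured-length = trans (sym (trans (ΣL-const (coloured k H) 1ℚ) (ℚ.*-identityʳ ⟦ length (coloured k H) ⟧)))
    (trans (ΣL-coloured k H (λ _ → 1ℚ)) (trans (go H bounded) (ΣL-const H ⟦ k ! ⟧)))
    where
    go : ∀ es → All (λ e → ∣ e ∣ ℕ.≤ r) es → ΣL es (λ e → ΣL (rainbows e (⊤ {k})) (λ _ → 1ℚ)) ≡ ΣL es (λ _ → ⟦ k ! ⟧)
    go []       []        = refl
    go (e ∷ es) (h ∷ hs) = cong₂ _+_ (trans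
      (rainbows-length e ⊤ (ℕ.≤-trans (ℕ.≤-trans h r≤k) (ℕ.≤-reflexive (sym (∣⊤∣≡n k)))))
      (cong (λ i → ⟦ i ! ⟧) (∣⊤∣≡n k))) (go es hs)

  coloured-bounded : All (λ S → ∣ S ∣ ℕ.≤ r) (coloured k H)
  coloured-bounded = All.map (λ { (t , refl , e∈H , _) → subst (ℕ._≤ r) (sym (∣graph∣ t)) (All.lookup bounded e∈H) }) (coloured-valid k H)

  -- The degree factors: s = ∣ supp t ∣ = ∣ S ∣ vertices cost u ^ s in `H`, and prescribing their s
  -- colours costs β ^ s in each edge.
  coloured-spread : ∀ {u} → 0ℚ ≤ u → (∀ S → deg H S ≤ u ^ℚ ∣ S ∣ * ⟦ length H ⟧) →
    ∀ S → deg (coloured k H) S ≤ (u * β) ^ℚ ∣ S ∣ * ⟦ length (coloured k H) ⟧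
  coloured-spread {u} 0≤u spread S with Vec.group n k S
  ... | Ss , refl with partial? Ss
  ...   | inj₂ none = ℚ.≤-trans (ℚ.≤-reflexive zeros) (*-nonNeg (^-nonNeg (*-nonNeg 0≤u 0≤β) ∣ Vec.concat Ss ∣) (⟦⟧-nonNeg (length (coloured k H))))
    where
    zeros : deg (coloured k H) (Vec.concat Ss) ≡ 0ℚ
    zeros = trans (ΣL-coloured k H (λ e → 𝟙 (Vec.concat Ss ⊆? e)))
      (trans (ΣL-cong H (λ e → trans (ΣL-cong (rainbows e (⊤ {k})) (λ s → 𝟙-no (Vec.concat Ss ⊆? graph s) (none s)))
        (trans (ΣL-const (rainbows e (⊤ {k})) 0ℚ) (ℚ.*-zeroʳ ⟦ length (rainbows e (⊤ {k})) ⟧))))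
        (trans (ΣL-const H 0ℚ) (ℚ.*-zeroʳ ⟦ length H ⟧)))
  ...   | inj₁ (t , ∣Ss∣≡ , ext) = begin
    deg (coloured k H) (Vec.concat Ss)
      ≡⟨ ΣL-coloured k H (λ e → 𝟙 (Vec.concat Ss ⊆? e)) ⟩
    ΣL H (λ e → ΣL (rainbows e ⊤) (λ s → 𝟙 (Vec.concat Ss ⊆? graph s)))
      ≤⟨ ΣL-mono H (edge-count Ss t ext) ⟩
    ΣL H (λ e → B * 𝟙 (supp t ⊆? e))
      ≡⟨ ΣL-* H B (λ e → 𝟙 (supp t ⊆? e)) ⟩
    B * deg H (supp t)
      ≤⟨ *-monoˡ B (*-nonNeg (^-nonNeg 0≤β s) (⟦⟧-nonNeg (k !))) (spread (supp t)) ⟩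
    B * (u ^ℚ s * ⟦ length H ⟧)
      ≡⟨ solve 4 (λ b f u l → b :* f :* (u :* l) := u :* b :* (l :* f)) refl (β ^ℚ s) ⟦ k ! ⟧ (u ^ℚ s) ⟦ length H ⟧ ⟩
    u ^ℚ s * β ^ℚ s * (⟦ length H ⟧ * ⟦ k ! ⟧)
      ≡⟨ cong₂ _*_ (sym (^-distrib-* u β s)) (sym coloured-length) ⟩
    (u * β) ^ℚ s * ⟦ length (coloured k H) ⟧
      ≡⟨ cong (λ i → (u * β) ^ℚ i * ⟦ length (coloured k H) ⟧) (sym ∣Ss∣≡) ⟩
    (u * β) ^ℚ ∣ Vec.concat Ss ∣ * ⟦ length (coloured k H) ⟧ ∎
    where
    open ℚ.≤-Reasoning
    s = ∣ supp t ∣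
    B = β ^ℚ s * ⟦ k ! ⟧

-- From independent colours to a random colouring

ΣF-+ : ∀ {k} (f g : Fin k → ℚ) → ΣF (λ c → f c + g c) ≡ ΣF f + ΣF g
ΣF-+ {zero}  f g = refl
ΣF-+ {suc k} f g = trans (cong (f zero + g zero +_) (ΣF-+ (f ∘ suc) (g ∘ suc)))
  (solve 4 (λ a b c d → (a :+ b) :+ (c :+ d) := (a :+ c) :+ (b :+ d)) refl (f zero) (g zero) (ΣF (f ∘ suc)) (ΣF (g ∘ suc)))

ΣF-nonNeg : ∀ {k} {f : Fin k → ℚ} → (∀ c → 0ℚ ≤ f c) → 0ℚ ≤ ΣF f
ΣF-nonNeg {zero}  h = ℚ.≤-refl
ΣF-nonNeg {suc k} h = +-nonNeg (h zero) (ΣF-nonNeg (h ∘ suc))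

ΣF-term : ∀ {k} {f : Fin k → ℚ} → (∀ c → 0ℚ ≤ f c) → ∀ c → f c ≤ ΣF f
ΣF-term {f = f} h zero    = p≤p+q (ΣF-nonNeg (h ∘ suc))
ΣF-term {f = f} h (suc c) = ℚ.≤-trans (ΣF-term (h ∘ suc) c) (q≤p+q (h zero))

ΣF-const : ∀ k a → ΣF {k} (λ _ → a) ≡ ⟦ k ⟧ * a
ΣF-const zero    a = sym (ℚ.*-zeroˡ a)
ΣF-const (suc k) a = trans (cong (a +_) (ΣF-const k a))
  (trans (solve 2 (λ n c → c :+ n :* c := (con 1ℚ :+ n) :* c) refl ⟦ k ⟧ a) (cong (_* a) (sym (⟦⟧-+ 1 k))))

-- Abstract in the functional because it is applied both to `E` and to `Eᶜ`.
additive-ΣF : ∀ {X : Set} (Φ : (X → ℚ) → ℚ) → Φ (λ _ → 0ℚ) ≡ 0ℚ → (∀ f g → Φ (λ x → f x + g x) ≡ Φ f + Φ g) →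
  ∀ {k} (f : Fin k → X → ℚ) → Φ (λ x → ΣF (λ c → f c x)) ≡ ΣF (λ c → Φ (f c))
additive-ΣF Φ Φ-0 Φ-+ {zero}  f = Φ-0
additive-ΣF Φ Φ-0 Φ-+ {suc k} f = trans (Φ-+ (f zero) (λ x → ΣF (λ c → f (suc c) x)))
  (cong (Φ (f zero) +_) (additive-ΣF Φ Φ-0 Φ-+ (f ∘ suc)))

E-++ : ∀ a {b} q (f : Subset (a ℕ.+ b) → ℚ) → E q f ≡ E {a} q (λ S → E {b} q (λ T → f (S Vec.++ T)))
E-++ zero    q f = refl
E-++ (suc a) q f = cong₂ (λ x y → q * x + (1ℚ - q) * y) (E-++ a q (f ∘ (inside ∷_))) (E-++ a q (f ∘ (outside ∷_)))

E-∈ : ∀ {k} q (c : Fin k) → E q (λ S → 𝟙 (c ∈? S)) ≡ q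
E-∈ {suc k} q zero    = trans (cong₂ (λ x y → q * x + (1ℚ - q) * y) (E-const {k} q 1ℚ) (E-const {k} q 0ℚ))
  (solve 1 (λ q → q :* con 1ℚ :+ (con 1ℚ :- q) :* con 0ℚ := q) refl q)
E-∈ {suc k} q (suc c) = trans (cong₂ (λ x y → q * x + (1ℚ - q) * y) (tail inside) (tail outside))
  (solve 1 (λ q → q :* q :+ (con 1ℚ :- q) :* q := q) refl q)
  where
  tail : ∀ s → E q (λ S → 𝟙 (suc c ∈? (s ∷ S))) ≡ q
  tail s = trans (E-cong q shift) (E-∈ q c)
    where
    shift : ∀ S → 𝟙 (suc c ∈? (s ∷ S)) ≡ 𝟙 (c ∈? S)
    shift S with c ∈? S
    ... | yes _ = refl
    ... | no _  = refl

Eᴮ : ∀ {n k} → ℚ → (Vec (Subset k) n → ℚ) → ℚ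
Eᴮ {zero}  q f = f []
Eᴮ {suc n} q f = E q (λ S → Eᴮ q (f ∘ (S ∷_)))

E-concat : ∀ n {k} q (f : Subset (n ℕ.* k) → ℚ) → E q f ≡ Eᴮ {n} {k} q (f ∘ Vec.concat)
E-concat zero    q f = refl
E-concat (suc n) {k} q f = trans (E-++ k q f) (E-cong q (λ S → E-concat n q (λ T → f (S Vec.++ T))))

module _ (k : ℕ) .{{_ : ℕ.NonZero k}} where

  private
    k⁻¹ : ℚ
    k⁻¹ = ℤ.+ 1 ℚ./ k

    0≤k⁻¹ : 0ℚ ≤ k⁻¹
    0≤k⁻¹ = ℚ.<⇒≤ (unit-pos k)

  -- The law of a random colouring restricted to a p-biased set: a vertex is uncoloured with
  -- probability 1 - p and has each colour with probability p / k. In `Eᴮ` at density p / k the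
  -- colours of a vertex appear independently instead.
  Eᶜ : ∀ {n} → ℚ → (PColoring k n → ℚ) → ℚ
  Eᶜ {zero}  p f = f []
  Eᶜ {suc n} p f = (1ℚ - p) * Eᶜ p (f ∘ (nothing ∷_)) + p * k⁻¹ * ΣF (λ c → Eᶜ p (f ∘ (just c ∷_)))

  Eᶜ-cong : ∀ {n} p {f g : PColoring k n → ℚ} → (∀ t → f t ≡ g t) → Eᶜ p f ≡ Eᶜ p g
  Eᶜ-cong {zero}  p h = h []
  Eᶜ-cong {suc n} p h = cong₂ (λ x y → (1ℚ - p) * x + p * k⁻¹ * y) (Eᶜ-cong p (h ∘ (nothing ∷_)))
    (ΣF-cong (λ c → Eᶜ-cong p (h ∘ (just c ∷_))))

  Eᶜ-+ : ∀ {n} p (f g : PColoring k n → ℚ) → Eᶜ p (λ t → f t + g t) ≡ Eᶜ p f + Eᶜ p g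
  Eᶜ-+ {zero}  p f g = refl
  Eᶜ-+ {suc n} p f g = trans
    (cong₂ (λ x y → (1ℚ - p) * x + p * k⁻¹ * y) (Eᶜ-+ p (f ∘ (nothing ∷_)) (g ∘ (nothing ∷_)))
      (trans (ΣF-cong (λ c → Eᶜ-+ p (f ∘ (just c ∷_)) (g ∘ (just c ∷_))))
        (ΣF-+ (λ c → Eᶜ p (f ∘ (just c ∷_))) (λ c → Eᶜ p (g ∘ (just c ∷_))))))
    (solve 6 (λ a b x y z w → a :* (x :+ y) :+ b :* (z :+ w) := (a :* x :+ b :* z) :+ (a :* y :+ b :* w)) refl
      (1ℚ - p) (p * k⁻¹) (Eᶜ p (f ∘ (nothing ∷_))) (Eᶜ p (g ∘ (nothing ∷_)))
      (ΣF (λ c → Eᶜ p (f ∘ (just c ∷_)))) (ΣF (λ c → Eᶜ p (g ∘ (just c ∷_)))))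

  Eᶜ-* : ∀ {n} p a (f : PColoring k n → ℚ) → Eᶜ p (λ t → a * f t) ≡ a * Eᶜ p f
  Eᶜ-* {zero}  p a f = refl
  Eᶜ-* {suc n} p a f = trans
    (cong₂ (λ x y → (1ℚ - p) * x + p * k⁻¹ * y) (Eᶜ-* p a (f ∘ (nothing ∷_)))
      (trans (ΣF-cong (λ c → Eᶜ-* p a (f ∘ (just c ∷_)))) (ΣF-* a (λ c → Eᶜ p (f ∘ (just c ∷_))))))
    (solve 5 (λ b d a x y → b :* (a :* x) :+ d :* (a :* y) := a :* (b :* x :+ d :* y)) refl
      (1ℚ - p) (p * k⁻¹) a (Eᶜ p (f ∘ (nothing ∷_))) (ΣF (λ c → Eᶜ p (f ∘ (just c ∷_)))))

  Eᶜ-0 : ∀ {n} p → Eᶜ {n} p (λ _ → 0ℚ) ≡ 0ℚ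
  Eᶜ-0 {n} p = trans (Eᶜ-* {n} p 0ℚ (λ _ → 0ℚ)) (ℚ.*-zeroˡ (Eᶜ {n} p (λ _ → 0ℚ)))

  -- The blockwise form of `graph t` ⊆ `Vec.concat Z`, suited to an induction that treats one vertex
  -- at a time.
  data _◁_ : ∀ {n} → PColoring k n → Vec (Subset k) n → Set where
    []  : [] ◁ []
    _∷_ : ∀ {n m S} {t : PColoring k n} {Z} → cell m ⊆ S → t ◁ Z → (m ∷ t) ◁ (S ∷ Z)

  Covered : ∀ {n} → (PColoring k n → Set) → Vec (Subset k) n → Set
  Covered R Z = ∃[ t ] (R t × t ◁ Z)

  ◁⇒⊆ : ∀ {n} {t : PColoring k n} {Z} → t ◁ Z → graph t ⊆ Vec.concat Z
  ◁⇒⊆ []                                   = λ x∈ → x∈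
  ◁⇒⊆ (_∷_ {m = m} {S} {t} {Z} i t◁) {x} = ++-mono-⊆ (cell m) S i (◁⇒⊆ t◁) {x}

  ⊆⇒◁ : ∀ {n} (t : PColoring k n) Z → graph t ⊆ Vec.concat Z → t ◁ Z
  ⊆⇒◁ []      []      h = []
  ⊆⇒◁ (m ∷ t) (S ∷ Z) h = (λ {x} → proj₁ (++-⊆ (cell m) S h) {x}) ∷ ⊆⇒◁ t Z (proj₂ (++-⊆ (cell m) S h))

  module _ {p : ℚ} (0≤p : 0ℚ ≤ p) (p≤1 : p ≤ 1ℚ) where

    Eᶜ-mono : ∀ {n} {f g : PColoring k n → ℚ} → (∀ t → f t ≤ g t) → Eᶜ p f ≤ Eᶜ p g
    Eᶜ-mono {zero}  h = h []
    Eᶜ-mono {suc n} h = ℚ.+-mono-≤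
      (*-monoˡ (1ℚ - p) (0≤q-p p≤1) (Eᶜ-mono (h ∘ (nothing ∷_))))
      (*-monoˡ (p * k⁻¹) (*-nonNeg 0≤p 0≤k⁻¹) (ΣF-mono (λ c → Eᶜ-mono (h ∘ (just c ∷_)))))

    private
      q : ℚ
      q = p * k⁻¹

      0≤q : 0ℚ ≤ q
      0≤q = *-nonNeg 0≤p 0≤k⁻¹

      q≤1 : q ≤ 1ℚ
      q≤1 = p/k≤1 k p≤1

      -- One block: a union bound over its colours replaces the independent colours of the
      -- block by at most one of them.
      union-bound : (G : Subset k → ℚ) →
        (∀ S → G ⊥ ≤ G S + ΣF (λ c → 𝟙 (c ∈? S) * (G ⊥ - G ⁅ c ⁆))) →
        (1ℚ - p) * G ⊥ + q * ΣF (λ c → G ⁅ c ⁆) ≤ E q G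
      -- Since k q = p, adding the expected gains of the single colours turns the left side into
      -- exactly `G ⊥`; what is left is the expectation of `h`.
      union-bound G h = +-cancelʳ-≤ (ΣF (λ c → q * (G ⊥ - G ⁅ c ⁆))) (begin
        ((1ℚ - p) * G ⊥ + q * X) + ΣF (λ c → q * (G ⊥ - G ⁅ c ⁆))
          ≡⟨ cong (((1ℚ - p) * G ⊥ + q * X) +_) (trans (ΣF-* q (λ c → G ⊥ - G ⁅ c ⁆)) (cong (q *_)
               (trans (ΣF-+ (λ _ → G ⊥) (λ c → - G ⁅ c ⁆)) (cong₂ _+_ (ΣF-const k (G ⊥)) neg)))) ⟩
        ((1ℚ - p) * G ⊥ + q * X) + q * (⟦ k ⟧ * G ⊥ + (- 1ℚ) * X)
          ≡⟨ solve 5 (λ p i k g x → ((con 1ℚ :- p) :* g :+ p :* i :* x) :+ p :* i :* (k :* g :+ (con (- 1ℚ)) :* x) :=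
               (con 1ℚ :- p) :* g :+ p :* (k :* i) :* g) refl p k⁻¹ ⟦ k ⟧ (G ⊥) X ⟩
        (1ℚ - p) * G ⊥ + p * (⟦ k ⟧ * k⁻¹) * G ⊥
          ≡⟨ cong (λ z → (1ℚ - p) * G ⊥ + p * z * G ⊥) (⟦⟧-unit k) ⟩
        (1ℚ - p) * G ⊥ + p * 1ℚ * G ⊥
          ≡⟨ solve 2 (λ p g → (con 1ℚ :- p) :* g :+ p :* con 1ℚ :* g := g) refl p (G ⊥) ⟩
        G ⊥
          ≡⟨ sym (E-const {k} q (G ⊥)) ⟩
        E {k} q (λ _ → G ⊥)
          ≤⟨ E-mono 0≤q q≤1 h ⟩
        E q (λ S → G S + ΣF (λ c → 𝟙 (c ∈? S) * (G ⊥ - G ⁅ c ⁆)))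
          ≡⟨ E-+ q G (λ S → ΣF (λ c → 𝟙 (c ∈? S) * (G ⊥ - G ⁅ c ⁆))) ⟩
        E q G + E q (λ S → ΣF (λ c → 𝟙 (c ∈? S) * (G ⊥ - G ⁅ c ⁆)))
          ≡⟨ cong (E q G +_) (trans
               (additive-ΣF (E {k} q) (E-const {k} q 0ℚ) (E-+ q) (λ c S → 𝟙 (c ∈? S) * (G ⊥ - G ⁅ c ⁆)))
               (ΣF-cong swap)) ⟩
        E q G + ΣF (λ c → q * (G ⊥ - G ⁅ c ⁆)) ∎)
        where
        open ℚ.≤-Reasoning
        X = ΣF (λ c → G ⁅ c ⁆)
        neg : ΣF (λ c → - G ⁅ c ⁆) ≡ (- 1ℚ) * X
        neg = trans (ΣF-cong (λ c → solve 1 (λ x → :- x := con (- 1ℚ) :* x) refl (G ⁅ c ⁆))) (ΣF-* (- 1ℚ) (λ c → G ⁅ c ⁆))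
        swap : ∀ c → E q (λ S → 𝟙 (c ∈? S) * (G ⊥ - G ⁅ c ⁆)) ≡ q * (G ⊥ - G ⁅ c ⁆)
        swap c = trans (E-cong q (λ S → ℚ.*-comm (𝟙 (c ∈? S)) (G ⊥ - G ⁅ c ⁆)))
          (trans (E-* q (G ⊥ - G ⁅ c ⁆) (λ S → 𝟙 (c ∈? S)))
            (trans (cong ((G ⊥ - G ⁅ c ⁆) *_) (E-∈ q c)) (ℚ.*-comm (G ⊥ - G ⁅ c ⁆) q)))

    -- The first block is made independent while the others still carry at most one colour each;
    -- then the induction hypothesis is applied for every value S of it. Once S is fixed, the target
    -- family becomes `R′ S`, again an arbitrary predicate, which is why `R` is general. The
    -- hypothesis says that `g` indicates failure and at the same time decides `Covered`.
    Eᶜ≤Eᴮ : ∀ {n} (R : PColoring k n → Set) (g : Vec (Subset k) n → ℚ) →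
      (∀ Z → (g Z ≡ 1ℚ × ¬ Covered R Z) ⊎ (g Z ≡ 0ℚ × Covered R Z)) →
      Eᶜ p (g ∘ Vec.map cell) ≤ Eᴮ q g
    Eᶜ≤Eᴮ {zero}  R g h = ℚ.≤-refl
    Eᶜ≤Eᴮ {suc n} R g h = ℚ.≤-trans (union-bound G G-bound) (E-mono 0≤q q≤1 (λ S → Eᶜ≤Eᴮ (R′ S) (g ∘ (S ∷_)) (h′ S)))
      where
      R′ : Subset k → PColoring k n → Set
      R′ S t = ∃[ m ] (R (m ∷ t) × cell m ⊆ S)
      h′ : ∀ S Z → (g (S ∷ Z) ≡ 1ℚ × ¬ Covered (R′ S) Z) ⊎ (g (S ∷ Z) ≡ 0ℚ × Covered (R′ S) Z)
      h′ S Z with h (S ∷ Z)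
      ... | inj₁ (eq , ¬cov) = inj₁ (eq , λ (t , (m , Rt , i) , t◁) → ¬cov (m ∷ t , Rt , (λ {x} → i {x}) ∷ t◁))
      ... | inj₂ (eq , (m ∷ t , Rt , i ∷ t◁)) = inj₂ (eq , (t , (m , Rt , (λ {x} → i {x})) , t◁))
      G : Subset k → ℚ
      G S = Eᶜ p (λ t → g (S ∷ Vec.map cell t))
      -- If the block `⊥` fails and `S` succeeds, the covered colouring uses some colour c of `S` at
      -- this vertex; then the block ⁅ c ⁆ succeeds too, and the summand of c equals 1.
      pointwise : ∀ S Z → g (⊥ ∷ Z) ≤ g (S ∷ Z) + ΣF (λ c → 𝟙 (c ∈? S) * (g (⊥ ∷ Z) - g (⁅ c ⁆ ∷ Z)))
      pointwise S Z with h (⊥ ∷ Z)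
      ... | inj₂ (eq , (m ∷ t , Rt , i ∷ t◁)) rewrite eq = +-nonNeg 0≤gS (ℚ.≤-reflexive (sym (ΣF-0 vanish)))
        where
        0≤gS : 0ℚ ≤ g (S ∷ Z)
        0≤gS with h (S ∷ Z)
        ... | inj₁ (eq′ , _) = ℚ.≤-trans 0≤1 (ℚ.≤-reflexive (sym eq′))
        ... | inj₂ (eq′ , _) = ℚ.≤-reflexive (sym eq′)
        vanish : ∀ c → 𝟙 (c ∈? S) * (0ℚ - g (⁅ c ⁆ ∷ Z)) ≡ 0ℚ
        vanish c with h (⁅ c ⁆ ∷ Z)
        ... | inj₁ (_ , ¬cov)  = contradiction (m ∷ t , Rt , (λ {x} x∈ → contradiction (i x∈) ∉⊥) ∷ t◁) ¬cov
        ... | inj₂ (eq′ , _)   = trans (cong (λ z → 𝟙 (c ∈? S) * (0ℚ - z)) eq′) (ℚ.*-zeroʳ (𝟙 (c ∈? S)))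
      ... | inj₁ (eq , ¬cov) rewrite eq = bound
        where
        term-nonNeg : ∀ c → 0ℚ ≤ 𝟙 (c ∈? S) * (1ℚ - g (⁅ c ⁆ ∷ Z))
        term-nonNeg c = *-nonNeg (𝟙-nonNeg (c ∈? S)) (0≤q-p ≤1)
          where
          ≤1 : g (⁅ c ⁆ ∷ Z) ≤ 1ℚ
          ≤1 with h (⁅ c ⁆ ∷ Z)
          ... | inj₁ (eq′ , _) = ℚ.≤-reflexive eq′
          ... | inj₂ (eq′ , _) = ℚ.≤-trans (ℚ.≤-reflexive eq′) 0≤1
        bound : 1ℚ ≤ g (S ∷ Z) + ΣF (λ c → 𝟙 (c ∈? S) * (1ℚ - g (⁅ c ⁆ ∷ Z)))
        bound with h (S ∷ Z)
        ... | inj₁ (eq′ , _) = ℚ.≤-trans (ℚ.≤-reflexive (sym eq′)) (p≤p+q (ΣF-nonNeg term-nonNeg))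
        ... | inj₂ (eq′ , (nothing ∷ t , Rt , i ∷ t◁)) = contradiction (nothing ∷ t , Rt , (λ {x} x∈ → x∈) ∷ t◁) ¬cov
        ... | inj₂ (eq′ , (just c ∷ t , Rt , i ∷ t◁)) = ℚ.≤-trans (ℚ.≤-reflexive (sym one))
          (ℚ.≤-trans (ΣF-term term-nonNeg c) (q≤p+q (ℚ.≤-reflexive (sym eq′))))
          where
          one : 𝟙 (c ∈? S) * (1ℚ - g (⁅ c ⁆ ∷ Z)) ≡ 1ℚ
          one with h (⁅ c ⁆ ∷ Z)
          ... | inj₁ (_ , ¬cov′) = contradiction (just c ∷ t , Rt , (λ {x} x∈ → x∈) ∷ t◁) ¬cov′
          ... | inj₂ (eq″ , _)   = cong₂ (λ a b → a * (1ℚ - b)) (𝟙-yes (c ∈? S) (i (x∈⁅x⁆ c))) eq″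
      G-bound : ∀ S → G ⊥ ≤ G S + ΣF (λ c → 𝟙 (c ∈? S) * (G ⊥ - G ⁅ c ⁆))
      G-bound S = ℚ.≤-trans (Eᶜ-mono (λ t → pointwise S (Vec.map cell t))) (ℚ.≤-reflexive
        (trans (Eᶜ-+ p (λ t → g (S ∷ Vec.map cell t)) (λ t → ΣF (λ c → term c t)))
          (cong (G S +_) (trans (additive-ΣF (Eᶜ {n} p) (Eᶜ-0 {n} p) (Eᶜ-+ p) term) (ΣF-cong split)))))
        where
        term : Fin k → PColoring k n → ℚ
        term c t = 𝟙 (c ∈? S) * (g (⊥ ∷ Vec.map cell t) - g (⁅ c ⁆ ∷ Vec.map cell t))
        split : ∀ c → Eᶜ p (term c) ≡ 𝟙 (c ∈? S) * (G ⊥ - G ⁅ c ⁆)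
        split c = trans (Eᶜ-* p (𝟙 (c ∈? S)) (λ t → g (⊥ ∷ Vec.map cell t) - g (⁅ c ⁆ ∷ Vec.map cell t)))
          (cong (𝟙 (c ∈? S) *_) (trans
            (Eᶜ-cong p (λ t → cong (g (⊥ ∷ Vec.map cell t) +_) (solve 1 (λ x → :- x := con (- 1ℚ) :* x) refl (g (⁅ c ⁆ ∷ Vec.map cell t)))))
            (trans (Eᶜ-+ p (λ t → g (⊥ ∷ Vec.map cell t)) (λ t → (- 1ℚ) * g (⁅ c ⁆ ∷ Vec.map cell t)))
              (trans (cong (G ⊥ +_) (Eᶜ-* p (- 1ℚ) (λ t → g (⁅ c ⁆ ∷ Vec.map cell t))))
                (solve 2 (λ a x → a :+ con (- 1ℚ) :* x := a :- x) refl (G ⊥) (G ⁅ c ⁆))))))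

    rainbow-fail≤ : ∀ {n} (H : List (Subset n)) → Eᶜ {n} p (λ t → fail (coloured k H) (graph t)) ≤ E q (fail (coloured k H))
    rainbow-fail≤ {n} H = ℚ.≤-trans (Eᶜ≤Eᴮ {n} (λ t → graph t ∈ᴸ coloured k H) (fail (coloured k H) ∘ Vec.concat {m = k} {n = n}) cases)
      (ℚ.≤-reflexive (sym (E-concat n q (fail (coloured k H)))))
      where
      cases : ∀ (Z : Vec (Subset k) n) → (fail (coloured k H) (Vec.concat Z) ≡ 1ℚ × ¬ Covered (λ t → graph t ∈ᴸ coloured k H) Z) ⊎
                    (fail (coloured k H) (Vec.concat Z) ≡ 0ℚ × Covered (λ t → graph t ∈ᴸ coloured k H) Z)
      cases Z with any? (_⊆? Vec.concat Z) (coloured k H)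
      ... | no ¬a = inj₁ (refl , λ (t , t∈ , t◁) → ¬a (lose t∈ (◁⇒⊆ t◁)))
      ... | yes a with find a
      ...   | S , S∈ , S⊆ with All.lookup (coloured-valid k H) S∈
      ...     | t , refl , _ = inj₂ (refl , t , S∈ , ⊆⇒◁ t Z S⊆)

-- Probabilities as polynomials in the density

-- The i-th term of a real expectation. The weights are the i-th terms of the real weights and may
-- be negative.
Ex : ∀ {A : Set} → ℕ → Dist A → (A → ℚ) → ℚ
Ex i d f = ΣL d (λ (a , w) → seq w i * f a)

seq-sum : ∀ i (ws : List ℝ) → seq (foldr _+ℝ_ 0ℝ ws) i ≡ ΣL ws (λ w → seq w i)
seq-sum i []       = refl
seq-sum i (w ∷ ws) = cong (seq w i +_) (seq-sum i ws)

Ex-filter : ∀ {A : Set} i (d : Dist A) {P : A → Set} (P? : ∀ a → Dec (P a)) →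
  ΣL (map proj₂ (filter (P? ∘ proj₁) d)) (λ w → seq w i) ≡ Ex i d (λ a → 𝟙 (P? a))
Ex-filter i []            P? = refl
Ex-filter i ((a , w) ∷ d) P? with P? a
... | yes _ = cong₂ _+_ (sym (ℚ.*-identityʳ (seq w i))) (Ex-filter i d P?)
... | no _  = trans (Ex-filter i d P?) (trans (sym (ℚ.+-identityˡ (Ex i d (λ a → 𝟙 (P? a)))))
  (cong (_+ Ex i d (λ a → 𝟙 (P? a))) (sym (ℚ.*-zeroʳ (seq w i)))))

Pr-seq : ∀ {A : Set} i (d : Dist A) {P : A → Set} (P? : ∀ a → Dec (P a)) → seq (Pr d P?) i ≡ Ex i d (λ a → 𝟙 (P? a))
Pr-seq i d P? = trans (seq-sum i (map proj₂ (filter (P? ∘ proj₁) d))) (Ex-filter i d P?)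

Ex-⊗ : ∀ {A B : Set} i (d : Dist A) (d′ : Dist B) f → Ex i (d ⊗ d′) f ≡ Ex i d (λ a → Ex i d′ (λ b → f (a , b)))
Ex-⊗ i []            d′ f = refl
Ex-⊗ i ((a , v) ∷ d) d′ f = trans (ΣL-++ (map (λ (b , w) → (a , b) , v *ℝ w) d′) (d ⊗ d′) (λ (ab , w) → seq w i * f ab))
  (cong₂ _+_
    (trans (ΣL-map (λ (b , w) → (a , b) , v *ℝ w) d′ (λ (ab , w) → seq w i * f ab))
      (trans (ΣL-cong d′ (λ (b , w) → ℚ.*-assoc (seq v i) (seq w i) (f (a , b))))
        (ΣL-* d′ (seq v i) (λ (b , w) → seq w i * f (a , b)))))
    (Ex-⊗ i d d′ f))

Ex-iid : ∀ {A : Set} i n (d : Dist A) f → Ex i (iid (suc n) d) f ≡ Ex i d (λ a → Ex i (iid n d) (λ as → f (a ∷ as)))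
Ex-iid i n d f = trans (ΣL-map (λ ((a , as) , w) → a ∷ as , w) (d ⊗ iid n d) (λ (as , w) → seq w i * f as))
  (Ex-⊗ i d (iid n d) (λ (a , as) → f (a ∷ as)))

Ex-randomSubset : ∀ i n p f → Ex i (randomSubset n p) f ≡ E (seq p i) f
Ex-randomSubset i zero    p f = solve 1 (λ x → con 1ℚ :* x :+ con 0ℚ := x) refl (f [])
Ex-randomSubset i (suc n) p f = trans (Ex-iid i n (bernoulli p) f)
  (cong₂ _+_ (cong (seq p i *_) (Ex-randomSubset i n p (f ∘ (inside ∷_))))
    (trans (ℚ.+-identityʳ ((1ℚ - seq p i) * Ex i (randomSubset n p) (f ∘ (outside ∷_))))
      (cong ((1ℚ - seq p i) *_) (Ex-randomSubset i n p (f ∘ (outside ∷_))))))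

module _ (k : ℕ) .{{_ : ℕ.NonZero k}} where

  private
    k⁻¹ : ℚ
    k⁻¹ = ℤ.+ 1 ℚ./ k

    0≤k⁻¹ : 0ℚ ≤ k⁻¹
    0≤k⁻¹ = ℚ.<⇒≤ (unit-pos k)

  Eᵡ : ∀ {n} → (Vec (Fin k) n → ℚ) → ℚ
  Eᵡ {zero}  f = f []
  Eᵡ {suc n} f = ΣF (λ c → k⁻¹ * Eᵡ (f ∘ (c ∷_)))

  Ex-randomColoring : ∀ i n f → Ex i (randomColoring n k) f ≡ Eᵡ f
  Ex-randomColoring i zero    f = solve 1 (λ x → con 1ℚ :* x :+ con 0ℚ := x) refl (f [])
  Ex-randomColoring i (suc n) f = trans (Ex-iid i n (uniform k) f)
    (trans (ΣL-map (λ c → c , fromℚ k⁻¹) (allFin k) (λ (c , w) → seq w i * Ex i (randomColoring n k) (f ∘ (c ∷_))))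
      (trans (ΣL-tabulate id (λ c → k⁻¹ * Ex i (randomColoring n k) (f ∘ (c ∷_))))
        (ΣF-cong (λ c → cong (k⁻¹ *_) (Ex-randomColoring i n (f ∘ (c ∷_)))))))

  Eᵡ-cong : ∀ {n} {f g : Vec (Fin k) n → ℚ} → (∀ χ → f χ ≡ g χ) → Eᵡ f ≡ Eᵡ g
  Eᵡ-cong {zero}  h = h []
  Eᵡ-cong {suc n} h = ΣF-cong (λ c → cong (k⁻¹ *_) (Eᵡ-cong (h ∘ (c ∷_))))

  Eᵡ-mono : ∀ {n} {f g : Vec (Fin k) n → ℚ} → (∀ χ → f χ ≤ g χ) → Eᵡ f ≤ Eᵡ g
  Eᵡ-mono {zero}  h = h []
  Eᵡ-mono {suc n} h = ΣF-mono (λ c → *-monoˡ k⁻¹ 0≤k⁻¹ (Eᵡ-mono (h ∘ (c ∷_))))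

  Eᵡ-lin : ∀ {n} a b (f g : Vec (Fin k) n → ℚ) → Eᵡ (λ χ → a * f χ + b * g χ) ≡ a * Eᵡ f + b * Eᵡ g
  Eᵡ-lin {zero}  a b f g = refl
  Eᵡ-lin {suc n} a b f g = trans
    (ΣF-cong (λ c → trans (cong (k⁻¹ *_) (Eᵡ-lin a b (f ∘ (c ∷_)) (g ∘ (c ∷_))))
      (solve 5 (λ i a b x y → i :* (a :* x :+ b :* y) := a :* (i :* x) :+ b :* (i :* y)) refl
        k⁻¹ a b (Eᵡ (f ∘ (c ∷_))) (Eᵡ (g ∘ (c ∷_))))))
    (trans (ΣF-+ (λ c → a * (k⁻¹ * Eᵡ (f ∘ (c ∷_)))) (λ c → b * (k⁻¹ * Eᵡ (g ∘ (c ∷_)))))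
      (cong₂ _+_ (ΣF-* a (λ c → k⁻¹ * Eᵡ (f ∘ (c ∷_)))) (ΣF-* b (λ c → k⁻¹ * Eᵡ (g ∘ (c ∷_))))))

  Eᵡ-const : ∀ {n} a → Eᵡ {n} (λ _ → a) ≡ a
  Eᵡ-const {zero}  a = refl
  Eᵡ-const {suc n} a = trans (ΣF-const k (k⁻¹ * Eᵡ {n} (λ _ → a))) (trans (sym (ℚ.*-assoc ⟦ k ⟧ k⁻¹ (Eᵡ {n} (λ _ → a))))
    (trans (cong₂ _*_ (⟦⟧-unit k) (Eᵡ-const {n} a)) (ℚ.*-identityˡ a)))

  -- The colour of a vertex outside `W` is forgotten, so its average over the k colours is trivial:
  -- k · `k⁻¹` = 1.
  Eᵡ-E : ∀ {n} p (h : PColoring k n → ℚ) → Eᵡ {n} (λ χ → E p (λ W → h (restrict χ W))) ≡ Eᶜ k p h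
  Eᵡ-E {zero}  p h = refl
  Eᵡ-E {suc n} p h = trans (ΣF-cong (λ c → cong (k⁻¹ *_) (trans
      (Eᵡ-lin p (1ℚ - p) (λ χ → E p (λ W → h (just c ∷ restrict χ W))) (λ χ → E p (λ W → h (nothing ∷ restrict χ W))))
      (cong₂ (λ x y → p * x + (1ℚ - p) * y) (Eᵡ-E p (h ∘ (just c ∷_))) (Eᵡ-E p (h ∘ (nothing ∷_)))))))
    (trans (ΣF-cong (λ c → solve 4 (λ i p x y → i :* (p :* x :+ (con 1ℚ :- p) :* y) := (p :* i) :* x :+ (con 1ℚ :- p) :* y :* i) refl
        k⁻¹ p (Eᶜ k p (h ∘ (just c ∷_))) (Eᶜ k p (h ∘ (nothing ∷_)))))
      (trans (ΣF-+ (λ c → (p * k⁻¹) * Eᶜ k p (h ∘ (just c ∷_))) (λ _ → (1ℚ - p) * A * k⁻¹))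
        (trans (cong₂ _+_ (ΣF-* (p * k⁻¹) (λ c → Eᶜ k p (h ∘ (just c ∷_)))) (trans (ΣF-const k ((1ℚ - p) * A * k⁻¹))
            (trans (solve 3 (λ k x i → k :* (x :* i) := x :* (k :* i)) refl ⟦ k ⟧ ((1ℚ - p) * A) k⁻¹)
              (trans (cong ((1ℚ - p) * A *_) (⟦⟧-unit k)) (ℚ.*-identityʳ ((1ℚ - p) * A))))))
          (ℚ.+-comm (p * k⁻¹ * ΣF (λ c → Eᶜ k p (h ∘ (just c ∷_)))) ((1ℚ - p) * A)))))
    where
    A = Eᶜ k p (h ∘ (nothing ∷_))

  module _ {n : ℕ} (H : MultiHypergraph n) where

    success : Vec (Fin k) n → Subset n → ℚ
    success χ W = 𝟙 (containsRainbowEdge? H (χ , W))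

    Pr-polynomial : ∀ p i → seq (Pr (randomColoring n k ⊗ randomSubset n p) (containsRainbowEdge? H)) i ≡
      Eᵡ (λ χ → E (seq p i) (success χ))
    Pr-polynomial p i = trans (Pr-seq i (randomColoring n k ⊗ randomSubset n p) (containsRainbowEdge? H))
      (trans (Ex-⊗ i (randomColoring n k) (randomSubset n p) (λ (χ , W) → success χ W))
        (trans (Ex-randomColoring i n (λ χ → Ex i (randomSubset n p) (success χ)))
          (Eᵡ-cong (λ χ → Ex-randomSubset i n p (success χ)))))

    -- 72 = 24 · 3: the coloured hypergraph has degree parameter 3 u / k and is tested at density x
    -- / k, so `spread⇒fail≤` asks for 24 · L · 3 u / k ≤ x / k, and k cancels.
    rainbow-probability : ∀ {r} L {u x} → All (λ e → ∣ e ∣ ℕ.≤ r) (edges H) → r ℕ.< 2 ℕ.^ L → r ℕ.≤ k → 0ℚ ≤ u →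
      (∀ S → deg (edges H) S ≤ u ^ℚ ∣ S ∣ * ⟦ length (edges H) ⟧) →
      x ≤ 1ℚ → ⟦ 72 ⟧ * ⟦ L ⟧ * u ≤ x →
      1ℚ - (ℤ.+ 1 ℚ./ suc L) ≤ Eᵡ (λ χ → E x (success χ))
    rainbow-probability {r} L {u} {x} bounded r<2^L r≤k 0≤u spread x≤1 x≥ = begin
      1ℚ - (ℤ.+ 1 ℚ./ suc L)
        ≤⟨ ℚ.+-monoʳ-≤ 1ℚ (ℚ.neg-antimono-≤ (ℚ.≤-trans (rainbow-fail≤ k 0≤x x≤1 (edges H)) small)) ⟩
      1ℚ - Eᶜ k {n} x (λ t → f (graph t))
        ≡⟨ cong (λ z → 1ℚ - z) (sym (Eᵡ-E {n} x (λ t → f (graph t)))) ⟩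
      1ℚ - Eᵡ {n} (λ χ → E x (λ W → f (graph (restrict χ W))))
        ≡⟨ sym (trans (Eᵡ-lin {n} 1ℚ (- 1ℚ) (λ _ → 1ℚ) (λ χ → E x (λ W → f (graph (restrict χ W)))))
             (trans (cong (λ y → 1ℚ * y + (- 1ℚ) * X) (Eᵡ-const {n} 1ℚ))
               (solve 1 (λ x → con 1ℚ :* con 1ℚ :+ con (- 1ℚ) :* x := con 1ℚ :- x) refl X))) ⟩
      Eᵡ {n} (λ χ → 1ℚ * 1ℚ + (- 1ℚ) * E x (λ W → f (graph (restrict χ W))))
        ≤⟨ Eᵡ-mono (λ χ → ℚ.≤-trans (ℚ.≤-reflexive (sym (trans (E-lin {n} x 1ℚ (- 1ℚ) (λ _ → 1ℚ) (λ W → f (graph (restrict χ W))))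
               (cong (λ y → 1ℚ * y + (- 1ℚ) * E x (λ W → f (graph (restrict χ W)))) (E-const {n} x 1ℚ)))))
             (E-mono 0≤x x≤1 (pointwise χ))) ⟩
      Eᵡ (λ χ → E x (success χ)) ∎
      where
      open ℚ.≤-Reasoning
      f = fail (coloured k (edges H))
      X = Eᵡ {n} (λ χ → E x (λ W → f (graph (restrict χ W))))
      0≤x : 0ℚ ≤ x
      0≤x = ℚ.≤-trans (*-nonNeg (*-nonNeg (⟦⟧-nonNeg 72) (⟦⟧-nonNeg L)) 0≤u) x≥
      pointwise : ∀ χ W → 1ℚ * 1ℚ + (- 1ℚ) * f (graph (restrict χ W)) ≤ success χ W
      pointwise χ W with containsRainbowEdge? H (χ , W)
      ... | yes _ = ≤-by (f (graph (restrict χ W))) (𝟙-nonNeg (¬? (any? (_⊆? graph (restrict χ W)) (coloured k (edges H)))))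
        (solve 1 (λ x → (con 1ℚ :* con 1ℚ :+ con (- 1ℚ) :* x) :+ x := con 1ℚ) refl (f (graph (restrict χ W))))
      ... | no ¬c = ℚ.≤-reflexive (cong (λ y → 1ℚ * 1ℚ + (- 1ℚ) * y)
        (𝟙-yes (¬? (any? (_⊆? graph (restrict χ W)) (coloured k (edges H)))) (λ a → ¬c (rainbow-of-coloured (edges H) χ W a))))
      β = ⟦ 3 ⟧ * k⁻¹
      density : ⟦ 24 ⟧ * ⟦ L ⟧ * (u * β) ≤ x * k⁻¹
      density = ℚ.≤-trans (ℚ.≤-reflexive (solve 3 (λ L u i → con ⟦ 24 ⟧ :* L :* (u :* (con ⟦ 3 ⟧ :* i)) := con ⟦ 72 ⟧ :* L :* u :* i) refl ⟦ L ⟧ u k⁻¹))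
        (*-monoʳ k⁻¹ 0≤k⁻¹ x≥)
      nonempty : 0ℚ < ⟦ length (coloured k (edges H)) ⟧
      nonempty = subst (0ℚ <_) (sym (coloured-length r≤k (edges H) bounded))
        (*-pos (⟦⟧-pos (ℕ.pred (length (edges H)))) (subst (λ i → 0ℚ < ⟦ i ⟧) (ℕ.suc-pred (k !) {{k ℕ.!≢0}}) (⟦⟧-pos (ℕ.pred (k !)))))
      small : E (x * k⁻¹) f ≤ ℤ.+ 1 ℚ./ suc L
      small = Rounds.spread⇒fail≤ L {u * β} (*-nonNeg 0≤u (*-nonNeg (⟦⟧-nonNeg 3) 0≤k⁻¹)) density (p/k≤1 k x≤1)
        (coloured k (edges H)) nonempty
        (All.map (λ h → ℕ.≤-<-trans h r<2^L) (coloured-bounded r≤k (edges H) bounded))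
        (coloured-spread r≤k (edges H) bounded 0≤u spread)

-- Lipschitz continuity in the density

lip : ℕ → ℚ
lip zero    = 0ℚ
lip (suc n) = ⟦ 4 ⟧ * lip n + 1ℚ

lip-nonNeg : ∀ n → 0ℚ ≤ lip n
lip-nonNeg zero    = ℚ.≤-refl
lip-nonNeg (suc n) = +-nonNeg (*-nonNeg (⟦⟧-nonNeg 4) (lip-nonNeg n)) 0≤1

∣a∣≤ : ∀ {a b} → a ≤ b → - a ≤ b → ℚ.∣ a ∣ ≤ b
∣a∣≤ {a} {b} h h′ with ℚ.∣p∣≡p∨∣p∣≡-p a
... | inj₁ eq = subst (_≤ b) (sym eq) h
... | inj₂ eq = subst (_≤ b) (sym eq) h′

a≤∣a∣ : ∀ a → a ≤ ℚ.∣ a ∣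
a≤∣a∣ a with ℚ.≤-total 0ℚ a
... | inj₁ 0≤a = ℚ.≤-reflexive (sym (ℚ.0≤p⇒∣p∣≡p 0≤a))
... | inj₂ a≤0 = ℚ.≤-trans a≤0 (ℚ.0≤∣p∣ a)

∣a*b∣≤ : ∀ {a b A B} → ℚ.∣ a ∣ ≤ A → ℚ.∣ b ∣ ≤ B → ℚ.∣ a * b ∣ ≤ A * B
∣a*b∣≤ {a} {b} {A} {B} h h′ = subst (_≤ A * B) (sym (ℚ.∣p*q∣≡∣p∣*∣q∣ a b))
  (*-mono (ℚ.0≤∣p∣ b) (ℚ.≤-trans (ℚ.0≤∣p∣ a) h) h h′)

∣a+b∣≤ : ∀ {a b A B} → ℚ.∣ a ∣ ≤ A → ℚ.∣ b ∣ ≤ B → ℚ.∣ a + b ∣ ≤ A + B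
∣a+b∣≤ {a} {b} h h′ = ℚ.≤-trans (ℚ.∣p+q∣≤∣p∣+∣q∣ a b) (ℚ.+-mono-≤ h h′)

-- Densities slightly outside [0 , 1] occur as approximations of real ones.
E-lipschitz : ∀ {n x y γ} → 0ℚ ≤ y → y ≤ 1ℚ → γ ≤ 1ℚ → ℚ.∣ y - x ∣ ≤ γ →
  (f : Subset n → ℚ) → (∀ W → 0ℚ ≤ f W) → (∀ W → f W ≤ 1ℚ) → ℚ.∣ E y f - E x f ∣ ≤ lip n * γ
E-lipschitz {zero} {γ = γ} _ _ _ _ f _ _ = ℚ.≤-reflexive (trans (cong ℚ.∣_∣ (ℚ.+-inverseʳ (f []))) (sym (ℚ.*-zeroˡ γ)))
E-lipschitz {suc n} {x} {y} {γ} 0≤y y≤1 γ≤1 close f 0≤f f≤1 = begin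
  ℚ.∣ (y * Yᵢ + (1ℚ - y) * Yₒ) - (x * Xᵢ + (1ℚ - x) * Xₒ) ∣
    -- In this split, x and 1 - x multiply only the inductive differences and are at most 2 in
    -- absolute value, hence the 4 in `lip`. The last term compares expectations at the genuine
    -- density y, which lie in [0,1], hence the 1.
    ≡⟨ cong ℚ.∣_∣ (solve 6 (λ y x a b c d →
         (y :* a :+ (con 1ℚ :- y) :* b) :- (x :* c :+ (con 1ℚ :- x) :* d) :=
         x :* (a :- c) :+ (con 1ℚ :- x) :* (b :- d) :+ (y :- x) :* (a :- b)) refl y x Yᵢ Yₒ Xᵢ Xₒ) ⟩
  ℚ.∣ x * (Yᵢ - Xᵢ) + (1ℚ - x) * (Yₒ - Xₒ) + (y - x) * (Yᵢ - Yₒ) ∣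
    ≤⟨ ∣a+b∣≤ {x * (Yᵢ - Xᵢ) + (1ℚ - x) * (Yₒ - Xₒ)} {(y - x) * (Yᵢ - Yₒ)}
         (∣a+b∣≤ {x * (Yᵢ - Xᵢ)} {(1ℚ - x) * (Yₒ - Xₒ)}
           (∣a*b∣≤ {x} {Yᵢ - Xᵢ} ∣x∣≤2 (ih (f ∘ (inside ∷_)) (0≤f ∘ (inside ∷_)) (f≤1 ∘ (inside ∷_))))
           (∣a*b∣≤ {1ℚ - x} {Yₒ - Xₒ} ∣1-x∣≤2 (ih (f ∘ (outside ∷_)) (0≤f ∘ (outside ∷_)) (f≤1 ∘ (outside ∷_)))))
         (∣a*b∣≤ {y - x} {Yᵢ - Yₒ} close ∣Yᵢ-Yₒ∣≤1) ⟩
  ⟦ 2 ⟧ * (lip n * γ) + ⟦ 2 ⟧ * (lip n * γ) + γ * 1ℚ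
    ≡⟨ solve 2 (λ l g → con ⟦ 2 ⟧ :* (l :* g) :+ con ⟦ 2 ⟧ :* (l :* g) :+ g :* con 1ℚ := (con ⟦ 4 ⟧ :* l :+ con 1ℚ) :* g) refl (lip n) γ ⟩
  lip (suc n) * γ ∎
  where
  open ℚ.≤-Reasoning
  Yᵢ = E y (f ∘ (inside ∷_))
  Yₒ = E y (f ∘ (outside ∷_))
  Xᵢ = E x (f ∘ (inside ∷_))
  Xₒ = E x (f ∘ (outside ∷_))
  ih : (g : Subset n → ℚ) → (∀ W → 0ℚ ≤ g W) → (∀ W → g W ≤ 1ℚ) → ℚ.∣ E y g - E x g ∣ ≤ lip n * γ
  ih = E-lipschitz 0≤y y≤1 γ≤1 close
  unit : ∀ {g : Subset n → ℚ} → (∀ W → g W ≤ 1ℚ) → E y g ≤ 1ℚ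
  unit {g} h = subst (E y g ≤_) (E-const {n} y 1ℚ) (E-mono 0≤y y≤1 h)
  ∣_-_∣≤1 : ∀ {a b} → 0ℚ ≤ a × a ≤ 1ℚ → 0ℚ ≤ b × b ≤ 1ℚ → ℚ.∣ a - b ∣ ≤ 1ℚ
  ∣_-_∣≤1 {a} {b} (0≤a , a≤1) (0≤b , b≤1) = ∣a∣≤ {a - b}
    (≤-by ((1ℚ - a) + b) (+-nonNeg (0≤q-p a≤1) 0≤b) (solve 2 (λ a b → (a :- b) :+ ((con 1ℚ :- a) :+ b) := con 1ℚ) refl a b))
    (≤-by ((1ℚ - b) + a) (+-nonNeg (0≤q-p b≤1) 0≤a) (solve 2 (λ a b → (:- (a :- b)) :+ ((con 1ℚ :- b) :+ a) := con 1ℚ) refl a b))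
  ∣Yᵢ-Yₒ∣≤1 : ℚ.∣ Yᵢ - Yₒ ∣ ≤ 1ℚ
  ∣Yᵢ-Yₒ∣≤1 = ∣_-_∣≤1 {Yᵢ} {Yₒ}
    (E-nonNeg 0≤y y≤1 (0≤f ∘ (inside ∷_)) , unit (f≤1 ∘ (inside ∷_)))
    (E-nonNeg 0≤y y≤1 (0≤f ∘ (outside ∷_)) , unit (f≤1 ∘ (outside ∷_)))
  close′ : ℚ.∣ x - y ∣ ≤ 1ℚ
  close′ = ℚ.≤-trans (ℚ.≤-reflexive (trans (cong ℚ.∣_∣ (solve 2 (λ x y → x :- y := :- (y :- x)) refl x y)) (ℚ.∣-p∣≡∣p∣ (y - x))))
    (ℚ.≤-trans close γ≤1)
  ∣y∣≤1 : ℚ.∣ y ∣ ≤ 1ℚ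
  ∣y∣≤1 = ℚ.≤-trans (ℚ.≤-reflexive (ℚ.0≤p⇒∣p∣≡p 0≤y)) y≤1
  ∣x∣≤2 : ℚ.∣ x ∣ ≤ ⟦ 2 ⟧
  ∣x∣≤2 = subst (λ z → ℚ.∣ z ∣ ≤ ⟦ 2 ⟧) (solve 2 (λ x y → y :+ (x :- y) := x) refl x y) (∣a+b∣≤ {y} {x - y} ∣y∣≤1 close′)
  ∣1-x∣≤2 : ℚ.∣ 1ℚ - x ∣ ≤ ⟦ 2 ⟧
  ∣1-x∣≤2 = subst (λ z → ℚ.∣ z ∣ ≤ ⟦ 2 ⟧) (solve 2 (λ x y → (con 1ℚ :- y) :+ (y :- x) := con 1ℚ :- x) refl x y)
    (∣a+b∣≤ {1ℚ - y} {y - x} (∣_-_∣≤1 {1ℚ} {y} (0≤1 , ℚ.≤-refl) (0≤y , y≤1)) (ℚ.≤-trans close γ≤1))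

-- Logarithms

archimedean : ∀ q → 0ℚ < q → ∃[ K ] (ℤ.+ 1 ℚ./ suc K ≤ q)
archimedean (ℚ.mkℚ (ℤ.+ zero) d c)    (ℚ.*<* (ℤ.+<+ ()))
archimedean (ℚ.mkℚ ℤ.-[1+ a ] d c)    (ℚ.*<* ())
archimedean (ℚ.mkℚ (ℤ.+ suc a) d c)   _ = d , ℚ.toℚᵘ-cancel-≤ (ℚᵘ.≤-trans
  (ℚᵘ.≤-reflexive (ℚ.toℚᵘ-fromℚᵘ (mkℚᵘ (ℤ.+ 1) d)))
  (ℚᵘ.*≤* (ℤ.*-monoʳ-≤-nonNeg (ℤ.+ suc d) (ℤ.+≤+ (ℕ.s≤s (ℕ.z≤n {a}))))))

bernoulli-≥ : ∀ {w} → 0ℚ ≤ w → w ≤ 1ℚ → ∀ j → 1ℚ - ⟦ j ⟧ * w ≤ (1ℚ - w) ^ℚ j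
bernoulli-≥ {w} 0≤w w≤1 zero    = ℚ.≤-reflexive (solve 1 (λ w → con 1ℚ :- con 0ℚ :* w := con 1ℚ) refl w)
bernoulli-≥ {w} 0≤w w≤1 (suc j) = ℚ.≤-trans
  (≤-by (⟦ j ⟧ * (w * w)) (*-nonNeg (⟦⟧-nonNeg j) (*-nonNeg 0≤w 0≤w)) (trans
    (cong (λ t → 1ℚ - t * w + ⟦ j ⟧ * (w * w)) (⟦⟧-+ 1 j))
    (solve 2 (λ w j → (con 1ℚ :- (con 1ℚ :+ j) :* w) :+ j :* (w :* w) := (con 1ℚ :- w) :* (con 1ℚ :- j :* w)) refl w ⟦ j ⟧)))
  (*-monoˡ (1ℚ - w) (0≤q-p w≤1) (bernoulli-≥ 0≤w w≤1 j))

module _ (m : ℕ) where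

  private
    r = suc m
    w = ℤ.+ 1 ℚ./ r
    q = 1-1/ r

    0≤w : 0ℚ ≤ w
    0≤w = ℚ.<⇒≤ (unit-pos r)

    w≤1 : w ≤ 1ℚ
    w≤1 = unit-antitone {0} {r} (ℕ.s≤s ℕ.z≤n)

    0≤q : 0ℚ ≤ q
    0≤q = 0≤q-p w≤1

    ½≤q^ : ∀ j → 2 ℕ.* j ℕ.≤ r → ½ ≤ q ^ℚ j
    ½≤q^ j 2j≤r = ℚ.≤-trans
      (≤-by (½ * (1ℚ - ⟦ 2 ⟧ * ⟦ j ⟧ * w)) (*-nonNeg 0≤½ (0≤q-p 2jw≤1))
        (solve 2 (λ j w → con ½ :+ con ½ :* (con 1ℚ :- con ⟦ 2 ⟧ :* j :* w) := con 1ℚ :- j :* w) refl ⟦ j ⟧ w))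
      (bernoulli-≥ 0≤w w≤1 j)
      where
      2jw≤1 : ⟦ 2 ⟧ * ⟦ j ⟧ * w ≤ 1ℚ
      2jw≤1 = ℚ.≤-trans (*-monoʳ w 0≤w (ℚ.≤-trans (ℚ.≤-reflexive (sym (⟦⟧-* 2 j))) (⟦⟧-mono 2j≤r))) (ℚ.≤-reflexive (⟦⟧-unit r))

    mercator-mono : ∀ {N M} → N ℕ.≤ M → mercator q N ≤ mercator q M
    mercator-mono {N} {M} N≤M = subst (λ i → mercator q N ≤ mercator q i) (ℕ.m∸n+n≡m N≤M) (go (M ℕ.∸ N))
      where
      go : ∀ d → mercator q N ≤ mercator q (d ℕ.+ N)
      go zero    = ℚ.≤-refl
      go (suc d) = ℚ.≤-trans (go d) (p≤p+q (*-nonNeg (^-nonNeg 0≤q (suc (d ℕ.+ N))) (ℚ.<⇒≤ (unit-pos (suc (d ℕ.+ N))))))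

    -- The terms with index between a and 2 a are at least 1 / (4 a).
    mercator-block : ∀ a .{{_ : ℕ.NonZero (2 ℕ.* a)}} → 2 ℕ.* (2 ℕ.* a) ℕ.≤ r → ∀ d → d ℕ.≤ a →
      mercator q a + ⟦ d ⟧ * (½ * (ℤ.+ 1 ℚ./ (2 ℕ.* a))) ≤ mercator q (d ℕ.+ a)
    mercator-block a 4a≤r zero    _   = ℚ.≤-reflexive
      (solve 2 (λ s c → s :+ con 0ℚ :* c := s) refl (mercator q a) (½ * (ℤ.+ 1 ℚ./ (2 ℕ.* a))))
    mercator-block a 4a≤r (suc d) d<a = ℚ.≤-trans
      (ℚ.≤-reflexive (trans (cong (λ t → mercator q a + t * c) (⟦⟧-+ 1 d))
        (solve 3 (λ s d c → s :+ (con 1ℚ :+ d) :* c := (s :+ d :* c) :+ c) refl (mercator q a) ⟦ d ⟧ c)))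
      (ℚ.+-mono-≤ (mercator-block a 4a≤r d (ℕ.<⇒≤ d<a))
        (*-mono (ℚ.<⇒≤ (unit-pos (2 ℕ.* a))) (^-nonNeg 0≤q (suc (d ℕ.+ a)))
          (½≤q^ (suc (d ℕ.+ a)) (ℕ.≤-trans (ℕ.*-monoʳ-≤ 2 index≤2a) 4a≤r)) (unit-antitone index≤2a)))
      where
      c = ½ * (ℤ.+ 1 ℚ./ (2 ℕ.* a))
      index≤2a : suc (d ℕ.+ a) ℕ.≤ 2 ℕ.* a
      index≤2a = ℕ.≤-trans (ℕ.+-monoˡ-≤ a d<a) (ℕ.≤-reflexive (cong (a ℕ.+_) (sym (ℕ.+-identityʳ a))))

    -- As in the divergence of the harmonic series, each dyadic block adds at least a · 1 / (4 a) =
    -- 1 / 4. The powers of q = 1 - 1 / r stay above ½ up to index r / 2, hence the hypothesis.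
    mercator-2^ : ∀ h → 2 ℕ.* 2 ℕ.^ h ℕ.≤ r → ⟦ h ⟧ * (½ * ½) ≤ mercator q (2 ℕ.^ h)
    mercator-2^ zero    _     = ℚ.≤-trans (ℚ.≤-reflexive (ℚ.*-zeroˡ (½ * ½))) (mercator-mono {0} {1} ℕ.z≤n)
    mercator-2^ (suc h) 2h≤r = ℚ.≤-trans
      (ℚ.≤-reflexive (trans (cong (_* (½ * ½)) (⟦⟧-+ 1 h))
        (solve 1 (λ h → (con 1ℚ :+ h) :* con (½ * ½) := h :* con (½ * ½) :+ con (½ * ½)) refl ⟦ h ⟧)))
      (ℚ.≤-trans (ℚ.+-mono-≤ (mercator-2^ h (ℕ.≤-trans (ℕ.m≤n*m (2 ℕ.* a) 2) 2h≤r)) (ℚ.≤-reflexive quarter))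
        (subst (λ i → mercator q a + ⟦ a ⟧ * (½ * (ℤ.+ 1 ℚ./ (2 ℕ.* a))) ≤ mercator q i)
          (cong (a ℕ.+_) (sym (ℕ.+-identityʳ a))) (mercator-block a 2h≤r a ℕ.≤-refl)))
      where
      a = 2 ℕ.^ h
      instance
        2a≢0 : ℕ.NonZero (2 ℕ.* a)
        2a≢0 = ℕ.m^n≢0 2 (suc h)
      quarter : ½ * ½ ≡ ⟦ a ⟧ * (½ * (ℤ.+ 1 ℚ./ (2 ℕ.* a)))
      quarter = trans (cong (λ x → ½ * ½ * x) (sym (⟦⟧-unit (2 ℕ.* a))))
        (trans (cong (λ x → ½ * ½ * (x * (ℤ.+ 1 ℚ./ (2 ℕ.* a)))) (⟦⟧-* 2 a))
          (solve 2 (λ a i → con (½ * ½) :* (con ⟦ 2 ⟧ :* a :* i) := a :* (con ½ :* i)) refl ⟦ a ⟧ (ℤ.+ 1 ℚ./ (2 ℕ.* a))))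

  log-lower : ∀ h → 2 ℕ.* 2 ℕ.^ h ℕ.≤ suc m → ∀ i → 2 ℕ.^ h ℕ.≤ i → ⟦ h ⟧ * (½ * ½) ≤ seq (log (suc m)) i
  log-lower h 2h≤r i h≤i = ℚ.≤-trans (mercator-2^ h 2h≤r) (mercator-mono h≤i)

-- The length of the binary expansion, that is, the least b with r < 2 ^ b. It becomes the number of
-- rounds.
bits : ℕ → ℕ
bits zero    = 0
bits (suc r) with suc r ℕ.<? 2 ℕ.^ bits r
... | yes _ = bits r
... | no _  = suc (bits r)

r<2^bits : ∀ r → r ℕ.< 2 ℕ.^ bits r
r<2^bits zero    = ℕ.s≤s ℕ.z≤n
r<2^bits (suc r) with suc r ℕ.<? 2 ℕ.^ bits r
... | yes lt = lt
... | no _   = ℕ.≤-<-trans (r<2^bits r) (ℕ.^-monoʳ-< 2 (ℕ.s≤s (ℕ.s≤s ℕ.z≤n)) (ℕ.n<1+n (bits r)))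

2^bits≤r : ∀ r h → bits r ≡ suc h → 2 ℕ.^ h ℕ.≤ r
2^bits≤r (suc r) h eq with suc r ℕ.<? 2 ℕ.^ bits r
... | yes _  = ℕ.m≤n⇒m≤1+n (2^bits≤r r h eq)
... | no ¬lt = subst (λ b → 2 ℕ.^ b ℕ.≤ suc r) (ℕ.suc-injective eq) (ℕ.≮⇒≥ ¬lt)

2^K≤r⇒K<bits : ∀ K r → 2 ℕ.^ K ℕ.≤ r → K ℕ.< bits r
2^K≤r⇒K<bits K r h = ℕ.≰⇒> (λ b≤K → ℕ.<-irrefl refl
  (ℕ.<-≤-trans (r<2^bits r) (ℕ.≤-trans (ℕ.^-monoʳ-≤ 2 b≤K) h)))

-- Passage to the reals

Ev : (ℕ → Set) → Set
Ev P = ∃[ N ] (∀ i → N ℕ.≤ i → P i)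

Ev-× : ∀ {P Q : ℕ → Set} → Ev P → Ev Q → Ev (λ i → P i × Q i)
Ev-× (N , p) (M , q) = N ℕ.⊔ M , λ i h → p i (ℕ.m⊔n≤o⇒m≤o N M h) , q i (ℕ.m⊔n≤o⇒n≤o N M h)

Ev-map : ∀ {P Q : ℕ → Set} → (∀ i → P i → Q i) → Ev P → Ev Q
Ev-map f (N , p) = N , λ i h → f i (p i h)

Ev-∀ : ∀ {n} (P : Subset n → ℕ → Set) → (∀ S → Ev (P S)) → Ev (λ i → ∀ S → P S i)
Ev-∀ {zero}  P h = Ev-map (λ { i p [] → p }) (h [])
Ev-∀ {suc n} P h = Ev-map (λ { i (p , q) (inside ∷ S) → p S ; i (p , q) (outside ∷ S) → q S })
  (Ev-× (Ev-∀ (λ S → P (inside ∷ S)) (λ S → h (inside ∷ S))) (Ev-∀ (λ S → P (outside ∷ S)) (λ S → h (outside ∷ S))))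

recip-inverse : ∀ q → 0ℚ < q → q * recip q ≡ 1ℚ
recip-inverse q 0<q with q ℚ.≟ 0ℚ
... | yes refl = contradiction 0<q (ℚ.<-irrefl refl)
... | no q≢0   = ℚ.*-inverseʳ q {{ℚ.≢-nonZero q≢0}}

recip-pos : ∀ q → 0ℚ < q → 0ℚ < recip q
recip-pos q 0<q = ℚ.*-cancelˡ-<-nonNeg q {{ℚ.nonNegative (ℚ.<⇒≤ 0<q)}}
  (subst₂ _<_ (sym (ℚ.*-zeroʳ q)) (sym (recip-inverse q 0<q)) (ℚ.positive⁻¹ 1ℚ))

recip-antitone : ∀ p q → 0ℚ < p → p ≤ q → recip q ≤ recip p
recip-antitone p q 0<p p≤q = begin
  recip q                     ≡⟨ trans (sym (ℚ.*-identityʳ (recip q))) (cong (recip q *_) (sym (recip-inverse p 0<p))) ⟩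
  recip q * (p * recip p)     ≤⟨ *-monoˡ (recip q) (ℚ.<⇒≤ (recip-pos q 0<q)) (*-monoʳ (recip p) (ℚ.<⇒≤ (recip-pos p 0<p)) p≤q) ⟩
  recip q * (q * recip p)     ≡⟨ solve 3 (λ a b c → a :* (b :* c) := (b :* a) :* c) refl (recip q) q (recip p) ⟩
  q * recip q * recip p       ≡⟨ trans (cong (_* recip p) (recip-inverse q 0<q)) (ℚ.*-identityˡ (recip p)) ⟩
  recip p                     ∎
  where
  open ℚ.≤-Reasoning
  0<q = ℚ.<-≤-trans 0<p p≤q

-- A Cauchy sequence is eventually bounded above, so the reciprocals stay above a fixed w > 0.
-- Slacks have to be fixed before the index i is known, and w is the scale for them.
recip-bounded-below : ∀ κ → 0ℝ <ℝ κ → ∃[ w ] (0ℚ < w × Ev (λ i → w ≤ recip (seq κ i)))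
recip-bounded-below κ (η , 0<η , N₀ , h₀) with isCauchy κ 1ℚ (ℚ.positive⁻¹ 1ℚ)
... | N₁ , h₁ = recip B , recip-pos B 0<B , N₀ ℕ.⊔ N₁ , λ i h →
    recip-antitone (seq κ i) B (0<κ i (ℕ.m⊔n≤o⇒m≤o N₀ N₁ h)) (κ≤B i (ℕ.m⊔n≤o⇒n≤o N₀ N₁ h))
  where
  B = seq κ N₁ + 1ℚ
  0<κ : ∀ i → N₀ ℕ.≤ i → 0ℚ < seq κ i
  0<κ i h = ℚ.<-≤-trans 0<η (ℚ.≤-trans (ℚ.≤-reflexive (sym (ℚ.+-identityˡ η))) (h₀ i h))
  κ≤B : ∀ i → N₁ ℕ.≤ i → seq κ i ≤ B
  κ≤B i h = ℚ.≤-trans (ℚ.≤-reflexive (solve 2 (λ a b → a := b :+ (a :- b)) refl (seq κ i) (seq κ N₁)))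
    (ℚ.+-monoʳ-≤ (seq κ N₁) (ℚ.≤-trans (a≤∣a∣ (seq κ i - seq κ N₁)) (ℚ.<⇒≤ (h₁ i N₁ h ℕ.≤-refl))))
  0<B : 0ℚ < B
  0<B = ℚ.<-≤-trans (0<κ (N₀ ℕ.⊔ N₁) (ℕ.m≤m⊔n N₀ N₁)) (κ≤B (N₀ ℕ.⊔ N₁) (ℕ.m≤n⊔m N₀ N₁))

seq-^ : ∀ x s i → seq (x ^ℝ s) i ≡ seq x i ^ℚ s
seq-^ x zero    i = refl
seq-^ x (suc s) i = cong (seq x i *_) (seq-^ x s i)

length-filter : ∀ {n} (S : Subset n) Es → ⟦ length (filter (S ⊆?_) Es) ⟧ ≡ deg Es S
length-filter S []       = refl
length-filter S (e ∷ Es) with S ⊆? e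
... | yes _ = trans (⟦⟧-+ 1 (length (filter (S ⊆?_) Es))) (cong (1ℚ +_) (length-filter S Es))
... | no _  = trans (length-filter S Es) (sym (ℚ.+-identityˡ (deg Es S)))

deg≤length : ∀ {n} Es (S : Subset n) → deg Es S ≤ ⟦ length Es ⟧
deg≤length []       S = ℚ.≤-refl
deg≤length (e ∷ Es) S = ℚ.≤-trans (ℚ.+-mono-≤ (𝟙-≤1 (S ⊆? e)) (deg≤length Es S)) (ℚ.≤-reflexive (sym (⟦⟧-+ 1 (length Es))))

-- The slack δ of _≤ℝ_ is absorbed by doubling 1 / κ; the empty set needs no slack.
spread-rational : ∀ {n} (H : MultiHypergraph n) κ (κ>0 : 0ℝ <ℝ κ) → Spread H κ κ>0 → ∀ {w} → 0ℚ < w → Ev (λ i → w ≤ recip (seq κ i)) →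
  Ev (λ i → ∀ S → deg (edges H) S ≤ (⟦ 2 ⟧ * recip (seq κ i)) ^ℚ ∣ S ∣ * ⟦ length (edges H) ⟧)
spread-rational H κ κ>0 spread {w} 0<w w≤ = Ev-∀ _ λ S → go S ∣ S ∣ refl
  where
  M = ⟦ length (edges H) ⟧
  go : ∀ S s → ∣ S ∣ ≡ s → Ev (λ i → deg (edges H) S ≤ (⟦ 2 ⟧ * recip (seq κ i)) ^ℚ ∣ S ∣ * M)
  go S zero eq = 0 , λ i _ → ℚ.≤-trans (deg≤length (edges H) S)
    (ℚ.≤-reflexive (sym (trans (cong (λ s → (⟦ 2 ⟧ * recip (seq κ i)) ^ℚ s * M) eq) (ℚ.*-identityˡ M))))
  -- The slack w ^ ∣ S ∣ is at most ρ ^ ∣ S ∣, hence at most the main term because M ≥ 1; the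
  -- resulting factor 2 is at most 2 ^ ∣ S ∣.
  go S (suc s) eq = Ev-map bound (Ev-× (spread S (w ^ℚ suc s) (^-pos 0<w (suc s))) w≤)
    where
    bound : ∀ i → (⟦ degree H S ⟧ ≤ seq (inv κ κ>0 ^ℝ ∣ S ∣) i * M + w ^ℚ suc s) × w ≤ recip (seq κ i) →
      deg (edges H) S ≤ (⟦ 2 ⟧ * recip (seq κ i)) ^ℚ ∣ S ∣ * M
    bound i (h , w≤ρ) = begin
      deg (edges H) S                          ≡⟨ sym (length-filter S (edges H)) ⟩
      ⟦ degree H S ⟧                           ≤⟨ h ⟩
      seq (inv κ κ>0 ^ℝ ∣ S ∣) i * M + w ^ℚ suc s ≡⟨ cong (λ x → x * M + w ^ℚ suc s) (trans (seq-^ (inv κ κ>0) ∣ S ∣ i) (cong (ρ ^ℚ_) eq)) ⟩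
      ρˢ * M + w ^ℚ suc s                      ≤⟨ ℚ.+-monoʳ-≤ (ρˢ * M) (^-mono (ℚ.<⇒≤ 0<w) w≤ρ (suc s)) ⟩
      ρˢ * M + ρˢ                              ≤⟨ ≤-by (ρˢ * (M - 1ℚ)) (*-nonNeg 0≤ρˢ (0≤q-p (⟦⟧-mono {1} {length (edges H)} (ℕ.s≤s ℕ.z≤n))))
                                                    (solve 2 (λ x M → (x :* M :+ x) :+ x :* (M :- con 1ℚ) := con ⟦ 2 ⟧ :* con 1ℚ :* x :* M) refl ρˢ M) ⟩
      ⟦ 2 ⟧ ^ℚ 1 * ρˢ * M                      ≤⟨ *-monoʳ M (⟦⟧-nonNeg (length (edges H))) (*-monoʳ ρˢ 0≤ρˢ
                                                    (^-monoʳ (⟦⟧-mono {1} {2} (ℕ.s≤s ℕ.z≤n)) {1} {suc s} (ℕ.s≤s ℕ.z≤n))) ⟩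
      ⟦ 2 ⟧ ^ℚ suc s * ρˢ * M                  ≡⟨ cong (_* M) (sym (^-distrib-* ⟦ 2 ⟧ ρ (suc s))) ⟩
      (⟦ 2 ⟧ * ρ) ^ℚ suc s * M                 ≡⟨ cong (λ s → (⟦ 2 ⟧ * ρ) ^ℚ s * M) (sym eq) ⟩
      (⟦ 2 ⟧ * ρ) ^ℚ ∣ S ∣ * M                 ∎
      where
      open ℚ.≤-Reasoning
      ρ = recip (seq κ i)
      ρˢ = ρ ^ℚ suc s
      0≤ρˢ = ^-nonNeg (ℚ.≤-trans (ℚ.<⇒≤ 0<w) w≤ρ) (suc s)

clamp : ∀ x {γ} → 0ℚ ≤ γ → 0ℚ ≤ x + γ → x ≤ 1ℚ + γ → ∃[ y ] (0ℚ ≤ y × y ≤ 1ℚ × ℚ.∣ y - x ∣ ≤ γ)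
clamp x {γ} 0≤γ h₀ h₁ with ℚ.≤-total 0ℚ x | ℚ.≤-total x 1ℚ
... | inj₂ x≤0 | _ = 0ℚ , ℚ.≤-refl , 0≤1 , ∣a∣≤ {0ℚ - x}
  (≤-by (x + γ) h₀ (solve 2 (λ x g → (con 0ℚ :- x) :+ (x :+ g) := g) refl x γ))
  (≤-by (γ - x) (+-nonNeg 0≤γ (ℚ.neg-antimono-≤ x≤0)) (solve 2 (λ x g → (:- (con 0ℚ :- x)) :+ (g :- x) := g) refl x γ))
... | inj₁ 0≤x | inj₁ x≤1 = x , 0≤x , x≤1 , ℚ.≤-trans (ℚ.≤-reflexive (cong ℚ.∣_∣ (ℚ.+-inverseʳ x))) 0≤γ
... | inj₁ 0≤x | inj₂ 1≤x = 1ℚ , 0≤1 , ℚ.≤-refl , ∣a∣≤ {1ℚ - x}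
  (≤-by (γ + (x - 1ℚ)) (+-nonNeg 0≤γ (0≤q-p 1≤x)) (solve 2 (λ x g → (con 1ℚ :- x) :+ (g :+ (x :- con 1ℚ)) := g) refl x γ))
  (≤-by ((1ℚ + γ) - x) (0≤q-p h₁) (solve 2 (λ x g → (:- (con 1ℚ :- x)) :+ ((con 1ℚ :+ g) :- x) := g) refl x γ))

⊓-pos : ∀ {a b} → 0ℚ < a → 0ℚ < b → 0ℚ < a ℚ.⊓ b
⊓-pos {a} {b} 0<a 0<b with ℚ.⊓-sel a b
... | inj₁ eq = subst (0ℚ <_) (sym eq) 0<a
... | inj₂ eq = subst (0ℚ <_) (sym eq) 0<b

module _ {n : ℕ} (H : MultiHypergraph n) (k : ℕ) .{{_ : ℕ.NonZero k}} where

  Pr-continuous : ∀ {x y γ} → 0ℚ ≤ y → y ≤ 1ℚ → γ ≤ 1ℚ → ℚ.∣ y - x ∣ ≤ γ →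
    Eᵡ k (λ χ → E y (success k H χ)) ≤ Eᵡ k (λ χ → E x (success k H χ)) + lip n * γ
  Pr-continuous {x} {y} {γ} 0≤y y≤1 γ≤1 close = begin
    Eᵡ k (λ χ → E y (success k H χ))
      ≤⟨ Eᵡ-mono k (λ χ → ℚ.≤-trans
           (ℚ.≤-reflexive (solve 2 (λ a b → a := con 1ℚ :* b :+ con 1ℚ :* (a :- b)) refl (E y (success k H χ)) (E x (success k H χ))))
           (ℚ.+-monoʳ-≤ (1ℚ * E x (success k H χ)) (*-monoˡ 1ℚ 0≤1 (ℚ.≤-trans (a≤∣a∣ (E y (success k H χ) - E x (success k H χ)))
             (E-lipschitz 0≤y y≤1 γ≤1 close (success k H χ)
               (λ W → 𝟙-nonNeg (containsRainbowEdge? H (χ , W))) (λ W → 𝟙-≤1 (containsRainbowEdge? H (χ , W)))))))) ⟩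
    Eᵡ k {n} (λ χ → 1ℚ * E x (success k H χ) + 1ℚ * (lip n * γ))
      ≡⟨ Eᵡ-lin k {n} 1ℚ 1ℚ (λ χ → E x (success k H χ)) (λ _ → lip n * γ) ⟩
    1ℚ * X + 1ℚ * Eᵡ k {n} (λ _ → lip n * γ)
      ≡⟨ cong₂ _+_ (ℚ.*-identityˡ X) (trans (ℚ.*-identityˡ (Eᵡ k {n} (λ _ → lip n * γ))) (Eᵡ-const k {n} (lip n * γ))) ⟩
    X + lip n * γ ∎
    where
    open ℚ.≤-Reasoning
    X = Eᵡ k (λ χ → E x (success k H χ))

  -- The term `seq p i` may lie outside [0,1], where the combinatorial bound says nothing. The bound
  -- is used at the clamped density y and carried back by Lipschitz continuity, at the price of δ.
  success-lower : ∀ p → 0ℝ ≤ℝ p → p ≤ℝ 1ℝ → ∀ v {γ₀} → 0ℚ < γ₀ →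
    Ev (λ i → ∀ y → 0ℚ ≤ y → y ≤ 1ℚ → ℚ.∣ y - seq p i ∣ ≤ γ₀ → v ≤ Eᵡ k (λ χ → E y (success k H χ))) →
    ∀ δ → 0ℚ < δ → Ev (λ i → v ≤ Eᵡ k (λ χ → E (seq p i) (success k H χ)) + δ)
  success-lower p 0≤p p≤1 v {γ₀} 0<γ₀ good δ 0<δ with inverse (lip n + 1ℚ) (ℚ.<-≤-trans (ℚ.positive⁻¹ 1ℚ) (q≤p+q (lip-nonNeg n)))
  ... | l , 0<l , l-inv = Ev-map conclude (Ev-× good (Ev-× (0≤p γ 0<γ) (p≤1 γ 0<γ)))
    where
    -- The three bounds on γ make the Lipschitz error at most δ, make `E-lipschitz` applicable, and
    -- keep y within reach of `good`. Here l = 1 / (`lip n` + 1), the 1 covering `lip 0` = 0.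
    γ = (l * δ) ℚ.⊓ (1ℚ ℚ.⊓ γ₀)
    0<γ : 0ℚ < γ
    0<γ = ⊓-pos (*-pos 0<l 0<δ) (⊓-pos (ℚ.positive⁻¹ 1ℚ) 0<γ₀)
    γ≤1 : γ ≤ 1ℚ
    γ≤1 = ℚ.≤-trans (ℚ.p⊓q≤q (l * δ) (1ℚ ℚ.⊓ γ₀)) (ℚ.p⊓q≤p 1ℚ γ₀)
    γ≤γ₀ : γ ≤ γ₀
    γ≤γ₀ = ℚ.≤-trans (ℚ.p⊓q≤q (l * δ) (1ℚ ℚ.⊓ γ₀)) (ℚ.p⊓q≤q 1ℚ γ₀)
    lipγ≤δ : lip n * γ ≤ δ
    lipγ≤δ = begin
      lip n * γ              ≤⟨ *-monoˡ (lip n) (lip-nonNeg n) (ℚ.p⊓q≤p (l * δ) (1ℚ ℚ.⊓ γ₀)) ⟩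
      lip n * (l * δ)        ≤⟨ *-monoʳ (l * δ) (ℚ.<⇒≤ (*-pos 0<l 0<δ)) (p≤p+q {lip n} 0≤1) ⟩
      (lip n + 1ℚ) * (l * δ) ≡⟨ solve 3 (λ a l d → a :* (l :* d) := (l :* a) :* d) refl (lip n + 1ℚ) l δ ⟩
      l * (lip n + 1ℚ) * δ   ≡⟨ trans (cong (_* δ) l-inv) (ℚ.*-identityˡ δ) ⟩
      δ                      ∎
      where open ℚ.≤-Reasoning
    conclude : ∀ i → (∀ y → 0ℚ ≤ y → y ≤ 1ℚ → ℚ.∣ y - seq p i ∣ ≤ γ₀ → v ≤ Eᵡ k (λ χ → E y (success k H χ))) ×
      (0ℚ ≤ seq p i + γ) × (seq p i ≤ 1ℚ + γ) →
      v ≤ Eᵡ k (λ χ → E (seq p i) (success k H χ)) + δ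
    conclude i (h , h₀ , h₁) with clamp (seq p i) (ℚ.<⇒≤ 0<γ) h₀ h₁
    ... | y , 0≤y , y≤1 , close = begin
      v                                                     ≤⟨ h y 0≤y y≤1 (ℚ.≤-trans close γ≤γ₀) ⟩
      Eᵡ k (λ χ → E y (success k H χ))                      ≤⟨ Pr-continuous 0≤y y≤1 γ≤1 close ⟩
      Eᵡ k (λ χ → E (seq p i) (success k H χ)) + lip n * γ  ≤⟨ ℚ.+-monoʳ-≤ (Eᵡ k (λ χ → E (seq p i) (success k H χ))) lipγ≤δ ⟩
      Eᵡ k (λ χ → E (seq p i) (success k H χ)) + δ          ∎
      where open ℚ.≤-Reasoning

-- The truncated subtraction makes this 1 when `bits r` ≤ 2, that is r ≤ 3, where the lower bound on
-- log r is too weak to use and the claim is trivial. For larger r it is 1 / (`bits r` - 1).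
εℚ : ℕ → ℚ
εℚ r = ℤ.+ 1 ℚ./ suc (bits r ℕ.∸ 2)

0≤εℚ : ∀ r → 0ℚ ≤ εℚ r
0≤εℚ r = ℚ.<⇒≤ (unit-pos (suc (bits r ℕ.∸ 2)))

ε-tendsToZero : TendsToZero (λ r → fromℚ (εℚ r))
-- `ε` is pushed below half of the margin η; the other half is the gap demanded by `_<ℝ_`.
ε-tendsToZero δ (η , 0<η , N , h) with archimedean (½ * η) (*-pos (ℚ.positive⁻¹ ½) 0<η)
... | K , K≤ = 2 ℕ.^ suc K , λ r r≥ →
    (½ * η , 0<½η , N , λ i N≤i → ℚ.≤-trans (below i N≤i) (0≤εℚ r)) ,
    (½ * η , 0<½η , N , λ i N≤i → ℚ.≤-trans (ℚ.+-monoˡ-≤ (½ * η) (ε≤ r r≥)) (ℚ.≤-trans (ℚ.≤-reflexive halves) (h i N≤i)))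
  where
  0<½η = *-pos (ℚ.positive⁻¹ ½) 0<η
  halves : ½ * η + ½ * η ≡ 0ℚ + η
  halves = solve 1 (λ e → con ½ :* e :+ con ½ :* e := con 0ℚ :+ e) refl η
  below : ∀ i → N ℕ.≤ i → - seq δ i + ½ * η ≤ 0ℚ
  below i N≤i = ≤-by ((seq δ i - (0ℚ + η)) + ½ * η) (+-nonNeg (0≤q-p (h i N≤i)) (ℚ.<⇒≤ 0<½η))
    (solve 2 (λ d e → (:- d :+ con ½ :* e) :+ ((d :- (con 0ℚ :+ e)) :+ con ½ :* e) := con 0ℚ) refl (seq δ i) η)
  ε≤ : ∀ r → 2 ℕ.^ suc K ℕ.≤ r → εℚ r ≤ ½ * η
  ε≤ r r≥ = ℚ.≤-trans (unit-antitone {K} (ℕ.s≤s (ℕ.∸-monoˡ-≤ 2 (2^K≤r⇒K<bits (suc K) r r≥)))) K≤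

-- 72 · 2 from the rational estimate and the doubling of 1 / κ, 12 from log r ≥ bits r / 12, and 1 as slack.
C : ℝ
C = fromℕ 1729

-- 3 + h ≤ 12 · (1 + h) / 4 ≤ 12 l accounts for 1728 = 72 · 2 · 12. The spare l · ρ ≥ w / 4 pays for
-- two errors of w / 8: the slack in the hypothesis on the density, and the distance from x to the
-- clamped y.
density-lower : ∀ {h l ρ w y x} → ⟦ suc h ⟧ * (½ * ½) ≤ l → w ≤ ρ → 0ℚ < w →
  ⟦ 1729 ⟧ * l * ρ ≤ x + w * (½ * ½ * ½) → ℚ.∣ y - x ∣ ≤ w * (½ * ½ * ½) →
  ⟦ 72 ⟧ * ⟦ 3 ℕ.+ h ⟧ * (⟦ 2 ⟧ * ρ) ≤ y
density-lower {h} {l} {ρ} {w} {y} {x} l≥ w≤ρ 0<w main close = begin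
  ⟦ 72 ⟧ * ⟦ 3 ℕ.+ h ⟧ * (⟦ 2 ⟧ * ρ)
    ≡⟨ cong (λ t → ⟦ 72 ⟧ * t * (⟦ 2 ⟧ * ρ)) (⟦⟧-+ 3 h) ⟩
  ⟦ 72 ⟧ * (⟦ 3 ⟧ + ⟦ h ⟧) * (⟦ 2 ⟧ * ρ)
    ≤⟨ ≤-by (⟦ 288 ⟧ * (⟦ h ⟧ * ρ)) (*-nonNeg (⟦⟧-nonNeg 288) (*-nonNeg (⟦⟧-nonNeg h) 0≤ρ))
         (trans (solve 2 (λ h r → con ⟦ 72 ⟧ :* (con ⟦ 3 ⟧ :+ h) :* (con ⟦ 2 ⟧ :* r) :+ con ⟦ 288 ⟧ :* (h :* r) :=
             con ⟦ 1728 ⟧ :* ((con 1ℚ :+ h) :* con (½ * ½)) :* r) refl ⟦ h ⟧ ρ)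
           (cong (λ t → ⟦ 1728 ⟧ * (t * (½ * ½)) * ρ) (sym (⟦⟧-+ 1 h)))) ⟩
  ⟦ 1728 ⟧ * (⟦ suc h ⟧ * (½ * ½)) * ρ
    ≤⟨ *-monoʳ ρ 0≤ρ (*-monoˡ ⟦ 1728 ⟧ (⟦⟧-nonNeg 1728) l≥) ⟩
  ⟦ 1728 ⟧ * l * ρ
    ≡⟨ solve 2 (λ l r → con ⟦ 1728 ⟧ :* l :* r := con ⟦ 1729 ⟧ :* l :* r :- l :* r) refl l ρ ⟩
  ⟦ 1729 ⟧ * l * ρ - l * ρ
    ≤⟨ ℚ.+-mono-≤ main (ℚ.neg-antimono-≤ slack) ⟩
  x + w * (½ * ½ * ½) - w * (½ * ½)
    ≡⟨ solve 2 (λ x w → x :+ w :* con (½ * ½ * ½) :- w :* con (½ * ½) := x :- w :* con (½ * ½ * ½)) refl x w ⟩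
  x - w * (½ * ½ * ½)
    ≤⟨ ≤-by (w * (½ * ½ * ½) - (x - y)) (0≤q-p x-y≤)
         (solve 3 (λ x y g → (x :- g) :+ (g :- (x :- y)) := y) refl x y (w * (½ * ½ * ½))) ⟩
  y ∎
  where
  open ℚ.≤-Reasoning
  0≤ρ = ℚ.≤-trans (ℚ.<⇒≤ 0<w) w≤ρ
  ¼≤l : ½ * ½ ≤ l
  ¼≤l = ℚ.≤-trans (ℚ.≤-trans (ℚ.≤-reflexive (sym (ℚ.*-identityˡ (½ * ½))))
    (*-monoʳ (½ * ½) (ℚ.nonNegative⁻¹ (½ * ½)) (⟦⟧-mono {1} {suc h} (ℕ.s≤s ℕ.z≤n)))) l≥
  slack : w * (½ * ½) ≤ l * ρ
  slack = ℚ.≤-trans (ℚ.≤-reflexive (ℚ.*-comm w (½ * ½)))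
    (*-mono (ℚ.<⇒≤ 0<w) (ℚ.≤-trans (ℚ.nonNegative⁻¹ (½ * ½)) ¼≤l) ¼≤l w≤ρ)
  x-y≤ : x - y ≤ w * (½ * ½ * ½)
  x-y≤ = ℚ.≤-trans (a≤∣a∣ (x - y)) (ℚ.≤-trans (ℚ.≤-reflexive (trans
    (cong ℚ.∣_∣ (solve 2 (λ x y → x :- y := :- (y :- x)) refl x y)) (ℚ.∣-p∣≡∣p∣ (y - x)))) close)

success-threshold : ∀ {n} (H : MultiHypergraph n) r κ (κ>0 : 0ℝ <ℝ κ) → Bounded H r → Spread H κ κ>0 →
  ∀ k .{{_ : ℕ.NonZero k}} → r ℕ.≤ k → ∀ p → 0ℝ ≤ℝ p → p ≤ℝ 1ℝ →
  (∀ δ → 0ℚ < δ → Ev (λ i → ⟦ 1729 ⟧ * seq (log r) i * recip (seq κ i) ≤ seq p i + δ)) →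
  ∀ δ → 0ℚ < δ → Ev (λ i → 1ℚ - εℚ r ≤ Eᵡ k (λ χ → E (seq p i) (success k H χ)) + δ)
success-threshold {n} H r κ κ>0 bounded spread k r≤k p 0≤p p≤1 main = by-size (bits r) refl (recip-bounded-below κ κ>0)
  where
  Goal : Set
  Goal = ∀ δ → 0ℚ < δ → Ev (λ i → 1ℚ - εℚ r ≤ Eᵡ k (λ χ → E (seq p i) (success k H χ)) + δ)
  trivial : bits r ℕ.∸ 2 ≡ 0 → Goal
  -- Here `εℚ r` = 1, so only nonnegativity of the probability is claimed.
  trivial eq = success-lower H k p 0≤p p≤1 (1ℚ - εℚ r) (ℚ.positive⁻¹ 1ℚ) (0 , λ i _ y 0≤y y≤1 _ →
    ℚ.≤-trans (ℚ.≤-reflexive (cong (λ b → 1ℚ - (ℤ.+ 1 ℚ./ suc b)) eq))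
      (ℚ.≤-trans (ℚ.≤-reflexive (sym (Eᵡ-const k {n} 0ℚ)))
        (Eᵡ-mono k (λ χ → E-nonNeg 0≤y y≤1 (λ W → 𝟙-nonNeg (containsRainbowEdge? H (χ , W)))))))
  by-size : ∀ b → bits r ≡ b → ∃[ w ] (0ℚ < w × Ev (λ i → w ≤ recip (seq κ i))) → Goal
  by-size 0 eq _ = trivial (cong (ℕ._∸ 2) eq)
  by-size 1 eq _ = trivial (cong (ℕ._∸ 2) eq)
  by-size 2 eq _ = trivial (cong (ℕ._∸ 2) eq)
  by-size b@(suc (suc (suc h))) eq (w , 0<w , w≤) = success-lower H k p 0≤p p≤1 (1ℚ - εℚ r) 0<γ
    (Ev-map good (Ev-× (Ev-× w≤ (spread-rational H κ κ>0 spread 0<w w≤)) (Ev-× (main (w * (½ * ½ * ½)) 0<γ) (log-large r 2^≤r))))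
    where
    0<γ : 0ℚ < w * (½ * ½ * ½)
    0<γ = *-pos 0<w (ℚ.positive⁻¹ (½ * ½ * ½))
    2^≤r : 2 ℕ.* 2 ℕ.^ suc h ℕ.≤ r
    2^≤r = 2^bits≤r r (suc (suc h)) eq
    log-large : ∀ r → 2 ℕ.* 2 ℕ.^ suc h ℕ.≤ r → Ev (λ i → ⟦ suc h ⟧ * (½ * ½) ≤ seq (log r) i)
    log-large (suc m) le = 2 ℕ.^ suc h , log-lower m (suc h) le
    log-large zero    le = contradiction (ℕ.<-≤-trans (ℕ.m^n>0 2 (suc (suc h))) le) λ ()
    good : ∀ i → ((w ≤ recip (seq κ i)) × (∀ S → deg (edges H) S ≤ (⟦ 2 ⟧ * recip (seq κ i)) ^ℚ ∣ S ∣ * ⟦ length (edges H) ⟧)) ×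
      ((⟦ 1729 ⟧ * seq (log r) i * recip (seq κ i) ≤ seq p i + w * (½ * ½ * ½)) × (⟦ suc h ⟧ * (½ * ½) ≤ seq (log r) i)) →
      ∀ y → 0ℚ ≤ y → y ≤ 1ℚ → ℚ.∣ y - seq p i ∣ ≤ w * (½ * ½ * ½) → 1ℚ - εℚ r ≤ Eᵡ k (λ χ → E y (success k H χ))
    good i ((w≤ρ , spread′) , (main′ , l≥)) y 0≤y y≤1 close = ℚ.≤-trans
      -- With L = b the rounds yield the error 1 / (1 + b), which is below `εℚ r`.
      (ℚ.+-monoʳ-≤ 1ℚ (ℚ.neg-antimono-≤ (unit-antitone {bits r ℕ.∸ 2} {suc b}
        (ℕ.s≤s (ℕ.≤-trans (ℕ.m∸n≤m (bits r) 2) (ℕ.≤-reflexive eq))))))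
      (rainbow-probability k H b bounded (subst (λ b → r ℕ.< 2 ℕ.^ b) eq (r<2^bits r)) r≤k
        (*-nonNeg (⟦⟧-nonNeg 2) (ℚ.≤-trans (ℚ.<⇒≤ 0<w) w≤ρ)) spread′ y≤1 (density-lower {h} l≥ w≤ρ 0<w main′ close))

threshold : ∀ {n} (H : MultiHypergraph n) r κ (κ>0 : 0ℝ <ℝ κ) → Bounded H r → Spread H κ κ>0 →
  ∀ k .{{_ : ℕ.NonZero k}} → r ℕ.≤ k → ∀ p → 0ℝ ≤ℝ p → p ≤ℝ 1ℝ → (C *ℝ log r) *ℝ inv κ κ>0 ≤ℝ p →
  1ℝ -ℝ fromℚ (εℚ r) ≤ℝ Pr (randomColoring n k ⊗ randomSubset n p) (containsRainbowEdge? H)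
threshold {n} H r κ κ>0 bounded spread k r≤k p 0≤p p≤1 main δ 0<δ =
  Ev-map (λ i → subst (λ x → 1ℚ - εℚ r ≤ x + δ) (sym (Pr-polynomial k H p i)))
    (success-threshold H r κ κ>0 bounded spread k r≤k p 0≤p p≤1 main δ 0<δ)

theorem3 : ∃[ C ] ∃[ ε ]
    (0ℝ <ℝ C)
    × (∀ r → 0ℝ ≤ℝ ε r × ε r ≤ℝ 1ℝ)
    × TendsToZero ε
    × (∀ {n : ℕ} (H : MultiHypergraph n) (r : ℕ) (κ : ℝ) (κ>0 : 0ℝ <ℝ κ) →
    Bounded H r →
    Spread H κ κ>0 →
    (k : ℕ) .{{_ : ℕ.NonZero k}} → r ℕ.≤ k →
    (p : ℝ) → 0ℝ ≤ℝ p → p ≤ℝ 1ℝ →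
    (C *ℝ log r) *ℝ inv κ κ>0 ≤ℝ p →
    1ℝ -ℝ ε r ≤ℝ Pr (randomColoring n k ⊗ randomSubset n p) (containsRainbowEdge? H))
theorem3 = C , (λ r → fromℚ (εℚ r)) ,
  (1ℚ , ℚ.positive⁻¹ 1ℚ , 0 , λ _ _ → ⟦⟧-mono {1} {1729} (ℕ.s≤s ℕ.z≤n)) ,
  (λ r → (λ δ 0<δ → 0 , λ _ _ → ℚ.≤-trans (0≤εℚ r) (p≤p+q (ℚ.<⇒≤ 0<δ))) ,
         (λ δ 0<δ → 0 , λ _ _ → ℚ.≤-trans (unit-antitone {0} {suc (bits r ℕ.∸ 2)} (ℕ.s≤s ℕ.z≤n)) (p≤p+q (ℚ.<⇒≤ 0<δ)))) ,
  ε-tendsToZero ,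
  λ H r κ κ>0 bounded spread k r≤k p → threshold H r κ κ>0 bounded spread k r≤k p
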